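{- Let $\varepsilon_n := \frac{4}{(n-3)^2+6} = \frac{4+o(1)}{n^2}$. There is a family $\{g_n\}$ of unbiased linear threshold functions $g_n : \{ -1,1\}^n \to \{ -1,1\}$ (one for each odd integer $n \ge 5$) such that the following holds for all odd integers $n \geq 5$: (i) $\mathrm{Stab}_\rho[g_n] < \mathrm{Stab}_\rho[\mathrm{Maj}_n]$ for all $\rho \in (0, 1 - 2\varepsilon_n)$; (ii) $\Phi_p[g_n] > \Phi_p[\mathrm{Maj}_n]$ for all $p \in (\varepsilon_n, \frac12)$.
   Context: A function $f:\{ -1,1\}^n\to\{ -1,1\}$ is unbiased if $\mathbb{E}[f(x)]=0$ for $x$ uniform on $\{ -1,1\}^n$. It is a linear threshold function (LTF) if $f(x)=\mathrm{sign}(\sum_{i=1}^n w_i x_i)$ for some real weights $w_1,\dots,w_n$ (with $\sum_i w_i x_i\neq 0$ for all $x\in\{ -1,1\}^n$), where $\mathrm{sign}(t)=1$ for $t>0$ and $-1$ for $t<0$. For odd $n$, $\mathrm{Maj}_n(x)=\mathrm{sign}(\sum_{i=1}^n x_i)$. For $\rho\in[0,1]$, $\mathrm{DSBS}_\rho$ is the distribution of $(x,y)\in\{ -1,1\}^2$ with $\Pr[x=y=1]=\Pr[x=y=-1]=\frac{1+\rho}{4}$ and $\Pr[x=1,y=-1]=\Pr[x=-1,y=1]=\frac{1-\rho}{4}$. The noise stability is $\mathrm{Stab}_\rho[f]:=\mathbb{E}[f(x)f(y)]$ for $(x,y)\sim \mathrm{DSBS}_\rho^{\otimes n}$, i.e.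 the coordinate pairs $(x_i,y_i)$ are i.i.d. from $\mathrm{DSBS}_\rho$. For $p\in[0,1]$, $\mathrm{SBES}_p$ is the distribution of $(x,y)\in\{ -1,1\}\times\{ -1,1,\star\}$ where $x$ is uniform and $y=x$ with probability $p$ and $y=\star$ (erased) with probability $1-p$, independently of $x$. Define $\Phi_p[f]:=\mathbb{E}_y\big[\,|\mathbb{E}[f(x)\mid y]|\,\big]$ for $(x,y)\sim\mathrm{SBES}_p^{\otimes n}$ (i.i.d. coordinate pairs). -}

module Defs where

open import Algebra.Bundles using (module CommutativeMonoid)
import Algebra.Properties.CommutativeSemigroup as CommutativeSemigroup
import Algebra.Properties.Group as Group
import Algebra.Properties.Ring as Ring
open import Data.Bool using (if_then_else_; true; false)
open import Data.Integer as ℤ using (ℤ; _◃_)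
open import Data.List as List using (List; []; _∷_; cartesianProduct; cartesianProductWith)
open import Data.List.Membership.Propositional using (_∈_)
open import Data.List.Membership.Propositional.Properties
  using (∈-cartesianProductWith⁺)
open import Data.List.Relation.Unary.Any using (here; there)
open import Data.Maybe using (Maybe; just; nothing)
import Data.Maybe.Properties as Maybe
open import Data.Nat as ℕ using (ℕ; zero; suc)
import Data.Nat.Properties as ℕ
open import Data.Product using (Σ; ∃; ∃-syntax; _×_; _,_; proj₁; proj₂)
open import Data.Rational as ℚ using (ℚ; 0ℚ; 1ℚ; ½)
import Data.Rational.Properties as ℚ
open import Data.Sign using (Sign)
import Data.Sign.Properties as Sign
open import Data.Sum using (_⊎_; inj₁; inj₂)
open import Data.Vec as Vec using (Vec; []; _∷_)
import Data.Vec.Properties as Vec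
open import Relation.Binary.PropositionalEquality
  using (_≡_; _≢_; refl; sym; trans; cong; cong₂; subst; subst₂)
open import Relation.Nullary using (Dec; does; yes; no; contradiction)

private
  module +-Group = Group ℚ.+-0-group

  a-b+b : ∀ a b → (a ℚ.- b) ℚ.+ b ≡ a
  a-b+b a b = +-Group.//-rightDividesˡ b a

  a+b-b : ∀ a b → (a ℚ.+ b) ℚ.- b ≡ a
  a+b-b a b = +-Group.//-rightDividesʳ b a

  b+[a-b] : ∀ a b → b ℚ.+ (a ℚ.- b) ≡ a
  b+[a-b] a b = trans (ℚ.+-comm b (a ℚ.- b)) (a-b+b a b)

  -[a-b] : ∀ a b → ℚ.- (a ℚ.- b) ≡ b ℚ.- a
  -[a-b] a b = +-Group.⁻¹-anti-homo-// a b

  telescope : ∀ a b c → (a ℚ.- b) ℚ.+ (b ℚ.- c) ≡ a ℚ.- c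
  telescope a b c =
    trans (sym (ℚ.+-assoc (a ℚ.- b) b (ℚ.- c))) (cong (ℚ._- c) (a-b+b a b))

  +-diff : ∀ a b c d → (a ℚ.- b) ℚ.+ (c ℚ.- d) ≡ (a ℚ.+ c) ℚ.- (b ℚ.+ d)
  +-diff a b c d = trans
    (CommutativeSemigroup.interchange
      (CommutativeMonoid.commutativeSemigroup ℚ.+-0-commutativeMonoid) a (ℚ.- b) c (ℚ.- d))
    (cong (a ℚ.+ c ℚ.+_) (sym (ℚ.neg-distrib-+ b d)))

  *-distrib-diff : ∀ a b c → a ℚ.* (b ℚ.- c) ≡ a ℚ.* b ℚ.- a ℚ.* c
  *-distrib-diff a b c = Ring.x[y-z]≈xy-xz ℚ.+-*-ring a b c

  *-diff : ∀ a b c d → a ℚ.* (c ℚ.- d) ℚ.+ d ℚ.* (a ℚ.- b) ≡ a ℚ.* c ℚ.- b ℚ.* d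
  *-diff a b c d = trans
    (cong₂ ℚ._+_ (*-distrib-diff a c d)
      (trans (*-distrib-diff d a b) (cong₂ ℚ._-_ (ℚ.*-comm d a) (ℚ.*-comm d b))))
    (telescope (a ℚ.* c) (a ℚ.* d) (b ℚ.* d))

  ½>0 : 0ℚ ℚ.< ½
  ½>0 = ℚ.positive⁻¹ ½

  +-pos : ∀ {p q} → 0ℚ ℚ.< p → 0ℚ ℚ.< q → 0ℚ ℚ.< p ℚ.+ q
  +-pos 0<p 0<q = ℚ.+-mono-< 0<p 0<q

  *-pos : ∀ {p q} → 0ℚ ℚ.< p → 0ℚ ℚ.< q → 0ℚ ℚ.< p ℚ.* q
  *-pos {p} {q} 0<p 0<q =
    ℚ.positive⁻¹ (p ℚ.* q) {{ℚ.pos*pos⇒pos p {{ℚ.positive 0<p}} q {{ℚ.positive 0<q}}}}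

  *-nonNeg : ∀ {p q} → 0ℚ ℚ.≤ p → 0ℚ ℚ.≤ q → 0ℚ ℚ.≤ p ℚ.* q
  *-nonNeg {p} {q} 0≤p 0≤q =
    ℚ.nonNegative⁻¹ (p ℚ.* q)
      {{ℚ.nonNeg*nonNeg⇒nonNeg p {{ℚ.nonNegative 0≤p}} q {{ℚ.nonNegative 0≤q}}}}

  *-mono-≤ : ∀ {p q r s} → 0ℚ ℚ.≤ q → 0ℚ ℚ.≤ r → p ℚ.≤ q → r ℚ.≤ s → p ℚ.* r ℚ.≤ q ℚ.* s
  *-mono-≤ {p} {q} {r} {s} 0≤q 0≤r p≤q r≤s =
    ℚ.≤-trans (ℚ.*-monoʳ-≤-nonNeg r {{ℚ.nonNegative 0≤r}} p≤q)
              (ℚ.*-monoˡ-≤-nonNeg q {{ℚ.nonNegative 0≤q}} r≤s)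

  0≤1 : 0ℚ ℚ.≤ 1ℚ
  0≤1 = ℚ.<⇒≤ (ℚ.positive⁻¹ 1ℚ)

  halves : ∀ e → ½ ℚ.* e ℚ.+ ½ ℚ.* e ≡ e
  halves e = trans (sym (ℚ.*-distribʳ-+ e ½ ½)) (ℚ.*-identityˡ e)

-- Convention: recip 0 = 0.
recip : ℚ → ℚ
recip q with q ℚ.≟ 0ℚ
... | yes _  = 0ℚ
... | no q≢0 = (ℚ.1/ q) {{ℚ.≢-nonZero q≢0}}

recip-inverse : ∀ q → q ≢ 0ℚ → recip q ℚ.* q ≡ 1ℚ
recip-inverse q q≢0 with q ℚ.≟ 0ℚ
... | yes q≡0 = contradiction q≡0 q≢0
... | no q≢0′ = ℚ.*-inverseˡ q {{ℚ.≢-nonZero q≢0′}}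

private
  pos⇒≢0 : ∀ {q} → 0ℚ ℚ.< q → q ≢ 0ℚ
  pos⇒≢0 0<q refl = ℚ.<-irrefl refl 0<q

  recip-pos : ∀ {q} → 0ℚ ℚ.< q → 0ℚ ℚ.< recip q
  recip-pos {q} 0<q with q ℚ.≟ 0ℚ
  ... | yes q≡0 = contradiction q≡0 (pos⇒≢0 0<q)
  ... | no q≢0  =
    ℚ.positive⁻¹ ((ℚ.1/ q) {{ℚ.≢-nonZero q≢0}}) {{ℚ.1/pos⇒pos q {{ℚ.positive 0<q}}}}

  recip-anti : ∀ {d q} → 0ℚ ℚ.< d → d ℚ.≤ q → recip q ℚ.≤ recip d
  recip-anti {d} {q} 0<d d≤q =
    subst₂ ℚ._≤_ lhs rhs
      (ℚ.*-monoʳ-≤-nonNeg (recip d) {{ℚ.nonNegative (ℚ.<⇒≤ (recip-pos 0<d))}}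
        (ℚ.*-monoˡ-≤-nonNeg (recip q) {{ℚ.nonNegative (ℚ.<⇒≤ (recip-pos 0<q))}} d≤q))
    where
    0<q : 0ℚ ℚ.< q
    0<q = ℚ.<-≤-trans 0<d d≤q
    lhs : recip q ℚ.* d ℚ.* recip d ≡ recip q
    lhs = trans (ℚ.*-assoc (recip q) d (recip d))
         (trans (cong (recip q ℚ.*_)
                  (trans (ℚ.*-comm d (recip d)) (recip-inverse d (pos⇒≢0 0<d))))
                (ℚ.*-identityʳ (recip q)))
    rhs : recip q ℚ.* q ℚ.* recip d ≡ recip d
    rhs = trans (cong (ℚ._* recip d) (recip-inverse q (pos⇒≢0 0<q))) (ℚ.*-identityˡ (recip d))

  recip-diff : ∀ a b → a ≢ 0ℚ → b ≢ 0ℚ →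
               recip a ℚ.- recip b ≡ (recip a ℚ.* recip b) ℚ.* (b ℚ.- a)
  recip-diff a b a≢0 b≢0 = sym (trans (*-distrib-diff (ra ℚ.* rb) b a) (cong₂ ℚ._-_
    (trans (ℚ.*-assoc ra rb b)
      (trans (cong (ra ℚ.*_) (recip-inverse b b≢0)) (ℚ.*-identityʳ ra)))
    (trans (cong (ℚ._* a) (ℚ.*-comm ra rb)) (trans (ℚ.*-assoc rb ra a)
      (trans (cong (rb ℚ.*_) (recip-inverse a a≢0)) (ℚ.*-identityʳ rb))))))
    where
    ra = recip a
    rb = recip b

-- Reals are Cauchy sequences of rationals with modulus; equality of reals is _≃_.

IsCauchy : (ℕ → ℚ) → Set
IsCauchy x = ∀ e → 0ℚ ℚ.< e →
  ∃[ N ] (∀ m n → N ℕ.≤ m → N ℕ.≤ n → ℚ.∣ x m ℚ.- x n ∣ ℚ.≤ e)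

private abstract
  cauchy-const : ∀ q → IsCauchy (λ _ → q)
  cauchy-const q e 0<e =
    0 , λ _ _ _ _ → subst (ℚ._≤ e) (sym (cong ℚ.∣_∣ (ℚ.+-inverseʳ q))) (ℚ.<⇒≤ 0<e)

  cauchy-+ : ∀ x y → IsCauchy x → IsCauchy y → IsCauchy (λ n → x n ℚ.+ y n)
  cauchy-+ x y cx cy e 0<e with cx (½ ℚ.* e) (*-pos ½>0 0<e) | cy (½ ℚ.* e) (*-pos ½>0 0<e)
  ... | N , hx | M , hy = N ℕ.⊔ M , λ m n m≥ n≥ →
    subst₂ ℚ._≤_ (cong ℚ.∣_∣ (+-diff (x m) (x n) (y m) (y n))) (halves e)
      (ℚ.≤-trans (ℚ.∣p+q∣≤∣p∣+∣q∣ (x m ℚ.- x n) (y m ℚ.- y n))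
        (ℚ.+-mono-≤
          (hx m n (ℕ.m⊔n≤o⇒m≤o N M m≥) (ℕ.m⊔n≤o⇒m≤o N M n≥))
          (hy m n (ℕ.m⊔n≤o⇒n≤o N M m≥) (ℕ.m⊔n≤o⇒n≤o N M n≥))))

  cauchy-neg : ∀ x → IsCauchy x → IsCauchy (λ n → ℚ.- x n)
  cauchy-neg x cx e 0<e = let N , h = cx e 0<e in
    N , λ m n m≥ n≥ → subst (ℚ._≤ e)
      (trans (sym (ℚ.∣-p∣≡∣p∣ (x m ℚ.- x n)))
             (cong ℚ.∣_∣ (ℚ.neg-distrib-+ (x m) (ℚ.- x n))))
      (h m n m≥ n≥)

  -- Every Cauchy sequence is eventually bounded.
  bound : ∀ x → IsCauchy x → ∃[ B ] (0ℚ ℚ.< B × ∃[ N ] (∀ n → N ℕ.≤ n → ℚ.∣ x n ∣ ℚ.≤ B))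
  bound x cx with cx 1ℚ (ℚ.positive⁻¹ 1ℚ)
  ... | N , h = 1ℚ ℚ.+ ℚ.∣ x N ∣
              , ℚ.+-mono-<-≤ (ℚ.positive⁻¹ 1ℚ) (ℚ.0≤∣p∣ (x N))
              , N , λ n n≥ →
    subst (λ q → ℚ.∣ q ∣ ℚ.≤ 1ℚ ℚ.+ ℚ.∣ x N ∣) (a-b+b (x n) (x N))
      (ℚ.≤-trans (ℚ.∣p+q∣≤∣p∣+∣q∣ (x n ℚ.- x N) (x N))
        (ℚ.+-monoˡ-≤ ℚ.∣ x N ∣ (h n N n≥ ℕ.≤-refl)))

  scaled : ∀ B e → 0ℚ ℚ.< B → B ℚ.* (recip B ℚ.* e) ≡ e
  scaled B e 0<B = trans (sym (ℚ.*-assoc B (recip B) e))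
    (trans (cong (ℚ._* e) (trans (ℚ.*-comm B (recip B)) (recip-inverse B (pos⇒≢0 0<B))))
           (ℚ.*-identityˡ e))

  cauchy-* : ∀ x y → IsCauchy x → IsCauchy y → IsCauchy (λ n → x n ℚ.* y n)
  cauchy-* x y cx cy e 0<e with bound x cx | bound y cy
  ... | A , 0<A , N₁ , hA | B , 0<B , N₂ , hB
    with cx (recip B ℚ.* (½ ℚ.* e)) (*-pos (recip-pos 0<B) (*-pos ½>0 0<e))
       | cy (recip A ℚ.* (½ ℚ.* e)) (*-pos (recip-pos 0<A) (*-pos ½>0 0<e))
  ... | N₃ , hx | N₄ , hy = (N₁ ℕ.⊔ N₂) ℕ.⊔ (N₃ ℕ.⊔ N₄) , λ m n m≥ n≥ →
    subst₂ ℚ._≤_ (cong ℚ.∣_∣ (*-diff (x m) (x n) (y m) (y n)))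
      (trans (cong₂ ℚ._+_ (scaled A (½ ℚ.* e) 0<A) (scaled B (½ ℚ.* e) 0<B)) (halves e))
      (ℚ.≤-trans (ℚ.∣p+q∣≤∣p∣+∣q∣ (x m ℚ.* (y m ℚ.- y n)) (y n ℚ.* (x m ℚ.- x n)))
        (ℚ.+-mono-≤
          (prod 0<A (hA m (≥₁ m≥)) (hy m n (≥₄ m≥) (≥₄ n≥)))
          (prod 0<B (hB n (≥₂ n≥)) (hx m n (≥₃ m≥) (≥₃ n≥)))))
    where
    prod : ∀ {C u v w} → 0ℚ ℚ.< C → ℚ.∣ u ∣ ℚ.≤ C → ℚ.∣ v ∣ ℚ.≤ w → ℚ.∣ u ℚ.* v ∣ ℚ.≤ C ℚ.* w
    prod {C} {u} {v} {w} 0<C u≤ v≤ = subst (ℚ._≤ C ℚ.* w) (sym (ℚ.∣p*q∣≡∣p∣*∣q∣ u v))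
      (*-mono-≤ (ℚ.<⇒≤ 0<C) (ℚ.0≤∣p∣ v) u≤ v≤)
    ≥₁ : ∀ {k} → (N₁ ℕ.⊔ N₂) ℕ.⊔ (N₃ ℕ.⊔ N₄) ℕ.≤ k → N₁ ℕ.≤ k
    ≥₁ h = ℕ.m⊔n≤o⇒m≤o N₁ N₂ (ℕ.m⊔n≤o⇒m≤o (N₁ ℕ.⊔ N₂) (N₃ ℕ.⊔ N₄) h)
    ≥₂ : ∀ {k} → (N₁ ℕ.⊔ N₂) ℕ.⊔ (N₃ ℕ.⊔ N₄) ℕ.≤ k → N₂ ℕ.≤ k
    ≥₂ h = ℕ.m⊔n≤o⇒n≤o N₁ N₂ (ℕ.m⊔n≤o⇒m≤o (N₁ ℕ.⊔ N₂) (N₃ ℕ.⊔ N₄) h)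
    ≥₃ : ∀ {k} → (N₁ ℕ.⊔ N₂) ℕ.⊔ (N₃ ℕ.⊔ N₄) ℕ.≤ k → N₃ ℕ.≤ k
    ≥₃ h = ℕ.m⊔n≤o⇒m≤o N₃ N₄ (ℕ.m⊔n≤o⇒n≤o (N₁ ℕ.⊔ N₂) (N₃ ℕ.⊔ N₄) h)
    ≥₄ : ∀ {k} → (N₁ ℕ.⊔ N₂) ℕ.⊔ (N₃ ℕ.⊔ N₄) ℕ.≤ k → N₄ ℕ.≤ k
    ≥₄ h = ℕ.m⊔n≤o⇒n≤o N₃ N₄ (ℕ.m⊔n≤o⇒n≤o (N₁ ℕ.⊔ N₂) (N₃ ℕ.⊔ N₄) h)

  one-sided : ∀ a b → ℚ.∣ a ∣ ℚ.- ℚ.∣ b ∣ ℚ.≤ ℚ.∣ a ℚ.- b ∣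
  one-sided a b = subst (ℚ.∣ a ∣ ℚ.- ℚ.∣ b ∣ ℚ.≤_) (a+b-b ℚ.∣ a ℚ.- b ∣ ℚ.∣ b ∣)
    (ℚ.+-monoˡ-≤ (ℚ.- ℚ.∣ b ∣)
      (subst (λ q → ℚ.∣ q ∣ ℚ.≤ ℚ.∣ a ℚ.- b ∣ ℚ.+ ℚ.∣ b ∣) (a-b+b a b)
        (ℚ.∣p+q∣≤∣p∣+∣q∣ (a ℚ.- b) b)))

  reverse-triangle : ∀ a b → ℚ.∣ ℚ.∣ a ∣ ℚ.- ℚ.∣ b ∣ ∣ ℚ.≤ ℚ.∣ a ℚ.- b ∣
  reverse-triangle a b with ℚ.∣p∣≡p∨∣p∣≡-p (ℚ.∣ a ∣ ℚ.- ℚ.∣ b ∣)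
  ... | inj₁ eq = subst (ℚ._≤ ℚ.∣ a ℚ.- b ∣) (sym eq) (one-sided a b)
  ... | inj₂ eq = subst₂ ℚ._≤_ (trans (sym (-[a-b] ℚ.∣ a ∣ ℚ.∣ b ∣)) (sym eq))
    (trans (cong ℚ.∣_∣ (sym (-[a-b] a b))) (ℚ.∣-p∣≡∣p∣ (a ℚ.- b))) (one-sided b a)

  cauchy-abs : ∀ x → IsCauchy x → IsCauchy (λ n → ℚ.∣ x n ∣)
  cauchy-abs x cx e 0<e = let N , h = cx e 0<e in
    N , λ m n m≥ n≥ → ℚ.≤-trans (reverse-triangle (x m) (x n)) (h m n m≥ n≥)

  cauchy-inv : ∀ x → IsCauchy x → ∀ d N → 0ℚ ℚ.< d → (∀ n → N ℕ.≤ n → 0ℚ ℚ.+ d ℚ.≤ x n) →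
               IsCauchy (λ n → recip (x n))
  cauchy-inv x cx d N 0<d x≥d e 0<e = go
    where
    d≤ : ∀ {n} → N ℕ.≤ n → d ℚ.≤ x n
    d≤ {n} n≥ = subst (ℚ._≤ x n) (ℚ.+-identityˡ d) (x≥d n n≥)
    D : ℚ
    D = recip d ℚ.* recip d
    0<D : 0ℚ ℚ.< D
    0<D = *-pos (recip-pos 0<d) (recip-pos 0<d)
    go : ∃[ M ] (∀ m n → M ℕ.≤ m → M ℕ.≤ n → ℚ.∣ recip (x m) ℚ.- recip (x n) ∣ ℚ.≤ e)
    go with cx (recip D ℚ.* e) (*-pos (recip-pos 0<D) 0<e)
    ... | M , h = N ℕ.⊔ M , λ m n m≥ n≥ →
      let m≥N = ℕ.m⊔n≤o⇒m≤o N M m≥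
          n≥N = ℕ.m⊔n≤o⇒m≤o N M n≥
          0<xm = ℚ.<-≤-trans 0<d (d≤ m≥N)
          0<xn = ℚ.<-≤-trans 0<d (d≤ n≥N)
          0<r = *-pos (recip-pos 0<xm) (recip-pos 0<xn)
      in subst₂ ℚ._≤_
        (sym (trans (cong ℚ.∣_∣ (recip-diff (x m) (x n) (pos⇒≢0 0<xm) (pos⇒≢0 0<xn)))
             (trans (ℚ.∣p*q∣≡∣p∣*∣q∣ (recip (x m) ℚ.* recip (x n)) (x n ℚ.- x m))
               (cong (ℚ._* ℚ.∣ x n ℚ.- x m ∣) (ℚ.0≤p⇒∣p∣≡p (ℚ.<⇒≤ 0<r))))))
        (scaled D e 0<D)
        (*-mono-≤ (ℚ.<⇒≤ 0<D) (ℚ.0≤∣p∣ (x n ℚ.- x m))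
          (*-mono-≤ (ℚ.<⇒≤ (recip-pos 0<d)) (ℚ.<⇒≤ (recip-pos 0<xn))
            (recip-anti 0<d (d≤ m≥N)) (recip-anti 0<d (d≤ n≥N)))
          (h n m (ℕ.m⊔n≤o⇒n≤o N M n≥) (ℕ.m⊔n≤o⇒n≤o N M m≥)))

record ℝ : Set where
  constructor mkℝ
  field
    seq    : ℕ → ℚ
    cauchy : IsCauchy seq

open ℝ public

infix 4 _≃_ _<_ _#_
infixl 6 _+_ _-_
infixl 7 _*_

_≃_ : ℝ → ℝ → Set
x ≃ y = ∀ e → 0ℚ ℚ.< e → ∃[ N ] (∀ n → N ℕ.≤ n → ℚ.∣ seq x n ℚ.- seq y n ∣ ℚ.≤ e)

record _<_ (x y : ℝ) : Set where
  constructor less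
  field
    gap       : ℚ
    gap>0     : 0ℚ ℚ.< gap
    start     : ℕ
    separated : ∀ n → start ℕ.≤ n → seq x n ℚ.+ gap ℚ.≤ seq y n

-- Apartness, the constructive form of x ≠ y.
_#_ : ℝ → ℝ → Set
x # y = x < y ⊎ y < x

fromℚ : ℚ → ℝ
seq    (fromℚ q) _ = q
cauchy (fromℚ q)   = cauchy-const q

0ℝ 1ℝ : ℝ
0ℝ = fromℚ 0ℚ
1ℝ = fromℚ 1ℚ

_+_ : ℝ → ℝ → ℝ
seq    (x + y) n = seq x n ℚ.+ seq y n
cauchy (x + y)   = cauchy-+ (seq x) (seq y) (cauchy x) (cauchy y)

-_ : ℝ → ℝ
seq    (- x) n = ℚ.- seq x n
cauchy (- x)   = cauchy-neg (seq x) (cauchy x)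

_-_ : ℝ → ℝ → ℝ
x - y = x + (- y)

_*_ : ℝ → ℝ → ℝ
seq    (x * y) n = seq x n ℚ.* seq y n
cauchy (x * y)   = cauchy-* (seq x) (seq y) (cauchy x) (cauchy y)

∣_∣ : ℝ → ℝ
seq    ∣ x ∣ n = ℚ.∣ seq x n ∣
cauchy ∣ x ∣   = cauchy-abs (seq x) (cauchy x)

-- The reciprocal of a positive real.  Only finitely many terms of the sequence
-- can be 0, so the convention recip 0 = 0 does not matter.
inv : (x : ℝ) → 0ℝ < x → ℝ
seq    (inv x _) n                = recip (seq x n)
cauchy (inv x (less d 0<d N x≥d)) = cauchy-inv (seq x) (cauchy x) d N 0<d x≥d

<-trans : ∀ {x y z} → x < y → y < z → x < z
<-trans {x} {y} {z} (less d 0<d N x<y) (less d′ 0<d′ M y<z) = less d 0<d (N ℕ.⊔ M) λ n n≥ →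
  ℚ.≤-trans (x<y n (ℕ.m⊔n≤o⇒m≤o N M n≥))
    (ℚ.≤-trans (subst (ℚ._≤ seq y n ℚ.+ d′) (ℚ.+-identityʳ (seq y n))
                 (ℚ.+-monoʳ-≤ (seq y n) (ℚ.<⇒≤ 0<d′)))
               (y<z n (ℕ.m⊔n≤o⇒n≤o N M n≥)))

fromℚ-mono-< : ∀ {p q} → p ℚ.< q → fromℚ p < fromℚ q
fromℚ-mono-< {p} {q} p<q = less (q ℚ.- p)
  (subst (ℚ._< q ℚ.- p) (ℚ.+-inverseʳ p) (ℚ.+-monoˡ-< (ℚ.- p) p<q))
  0 λ _ _ → ℚ.≤-reflexive (b+[a-b] q p)

sign : ∀ t → t # 0ℝ → Sign
sign t (inj₁ t<0) = Sign.-
sign t (inj₂ 0<t) = Sign.+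

-- Outcomes are meant to be listed without repetition.  Neither that nor total mass 1
-- is enforced; DSBS ρ and SBES p are probability distributions for ρ, p in [0,1].
record Measure (A : Set) : Set where
  field
    outcomes : List A
    mass     : A → ℝ

open Measure public

sum : List ℝ → ℝ
sum = List.foldr _+_ 0ℝ

product : ∀ {n} → Vec ℝ n → ℝ
product = Vec.foldr _ _*_ 1ℝ

𝔼 : ∀ {A} → Measure A → (A → ℝ) → ℝ
𝔼 μ h = sum (List.map (λ a → mass μ a * h a) (outcomes μ))

𝟙 : ∀ {P : Set} → Dec P → ℝ
𝟙 P? = if does P? then 1ℝ else 0ℝ

vectors : ∀ {A : Set} → List A → ∀ n → List (Vec A n)
vectors as zero    = [] ∷ []
vectors as (suc n) = cartesianProductWith _∷_ as (vectors as n)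

infix 8 _^⊗_

-- The law of n independent samples.
_^⊗_ : ∀ {A} → Measure A → ∀ n → Measure (Vec A n)
outcomes (μ ^⊗ n)    = vectors (outcomes μ) n
mass     (μ ^⊗ n) as = product (Vec.map (mass μ) as)

-- Sign plays the role of {-1,1}; ⟦_⟧ and toℤ give the numerical value.

BoolFun : ℕ → Set
BoolFun n = Vec Sign n → Sign

signs : List Sign
signs = Sign.- ∷ Sign.+ ∷ []

toℤ : Sign → ℤ
toℤ s = s ◃ 1

⟦_⟧ : Sign → ℝ
⟦ s ⟧ = fromℚ (toℤ s ℚ./ 1)

uniform : ∀ n → Measure (Vec Sign n)
outcomes (uniform n)   = vectors signs n
mass     (uniform n) _ = fromℚ ((ℤ.+ 1 ℚ./ (2 ℕ.^ n)) {{ℕ.m^n≢0 2 n}})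

Unbiased : ∀ {n} → BoolFun n → Set
Unbiased {n} f = 𝔼 (uniform n) (λ x → ⟦ f x ⟧) ≃ 0ℝ

weightedSum : ∀ {n} → Vec ℝ n → Vec Sign n → ℝ
weightedSum w x = Vec.foldr _ _+_ 0ℝ (Vec.zipWith (λ wᵢ xᵢ → wᵢ * ⟦ xᵢ ⟧) w x)

IsLTF : ∀ {n} → BoolFun n → Set
IsLTF {n} f =
  Σ (Vec ℝ n) λ w →
  Σ (∀ x → weightedSum w x # 0ℝ) λ w·x≠0 →
  ∀ x → f x ≡ sign (weightedSum w x) (w·x≠0 x)

-- Only meaningful for odd n: for even n, ties are sent to +.
Maj : ∀ n → BoolFun n
Maj n x = ℤ.sign (Vec.foldr _ ℤ._+_ (ℤ.+ 0) (Vec.map toℤ x))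

DSBS : ℝ → Measure (Sign × Sign)
outcomes (DSBS ρ)         = cartesianProduct signs signs
mass     (DSBS ρ) (x , y) =
  if does (x Sign.≟ y) then fromℚ (ℤ.+ 1 ℚ./ 4) * (1ℝ + ρ)
                       else fromℚ (ℤ.+ 1 ℚ./ 4) * (1ℝ - ρ)

Stab : ∀ {n} → ℝ → BoolFun n → ℝ
Stab {n} ρ f = 𝔼 (DSBS ρ ^⊗ n) λ z → ⟦ f (Vec.map proj₁ z) ⟧ * ⟦ f (Vec.map proj₂ z) ⟧

pattern ⋆ = nothing

symbols : List (Maybe Sign)
symbols = just Sign.- ∷ just Sign.+ ∷ ⋆ ∷ []

SBES : ℝ → Measure (Sign × Maybe Sign)
outcomes (SBES p)              = cartesianProduct signs symbols
mass     (SBES p) (x , just y) = if does (x Sign.≟ y) then fromℚ ½ * p else 0ℝ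
mass     (SBES p) (x , ⋆)      = fromℚ ½ * (1ℝ - p)

source : ∀ {n} → Vec (Sign × Maybe Sign) n → Vec Sign n
source = Vec.map proj₁

received : ∀ {n} → Vec (Sign × Maybe Sign) n → Vec (Maybe Sign) n
received = Vec.map proj₂

infix 4 _≟_

_≟_ : ∀ {n} (y y′ : Vec (Maybe Sign) n) → Dec (y ≡ y′)
_≟_ = Vec.≡-dec (Maybe.≡-dec Sign._≟_)

Pr[received≡_] : ∀ {n} → Vec (Maybe Sign) n → ℝ → ℝ
Pr[received≡_] {n} y p = 𝔼 (SBES p ^⊗ n) λ z → 𝟙 (received z ≟ y)

private
  Pos : ℝ → Set
  Pos x = 0ℝ < x

  record NonNeg (x : ℝ) : Set where
    constructor nonNeg
    field
      from : ℕ
      0≤   : ∀ n → from ℕ.≤ n → 0ℚ ℚ.≤ seq x n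

  fromℚ-nonNeg : ∀ {q} → 0ℚ ℚ.≤ q → NonNeg (fromℚ q)
  fromℚ-nonNeg 0≤q = nonNeg 0 λ _ _ → 0≤q

  Pos⇒NonNeg : ∀ {x} → Pos x → NonNeg x
  Pos⇒NonNeg {x} (less d 0<d N h) = nonNeg N λ n n≥ →
    ℚ.≤-trans (ℚ.<⇒≤ 0<d) (subst (ℚ._≤ seq x n) (ℚ.+-identityˡ d) (h n n≥))

  NonNeg-+ : ∀ {x y} → NonNeg x → NonNeg y → NonNeg (x + y)
  NonNeg-+ (nonNeg N hx) (nonNeg M hy) = nonNeg (N ℕ.⊔ M) λ n n≥ →
    ℚ.+-mono-≤ (hx n (ℕ.m⊔n≤o⇒m≤o N M n≥)) (hy n (ℕ.m⊔n≤o⇒n≤o N M n≥))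

  NonNeg-* : ∀ {x y} → NonNeg x → NonNeg y → NonNeg (x * y)
  NonNeg-* (nonNeg N hx) (nonNeg M hy) = nonNeg (N ℕ.⊔ M) λ n n≥ →
    *-nonNeg (hx n (ℕ.m⊔n≤o⇒m≤o N M n≥)) (hy n (ℕ.m⊔n≤o⇒n≤o N M n≥))

  Pos-+ˡ : ∀ {x y} → Pos x → NonNeg y → Pos (x + y)
  Pos-+ˡ {x} {y} (less d 0<d N hx) (nonNeg M hy) = less d 0<d (N ℕ.⊔ M) λ n n≥ →
    subst (ℚ._≤ seq x n ℚ.+ seq y n) (ℚ.+-identityʳ (0ℚ ℚ.+ d))
      (ℚ.+-mono-≤ (hx n (ℕ.m⊔n≤o⇒m≤o N M n≥)) (hy n (ℕ.m⊔n≤o⇒n≤o N M n≥)))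

  Pos-+ʳ : ∀ {x y} → NonNeg x → Pos y → Pos (x + y)
  Pos-+ʳ {x} {y} (nonNeg N hx) (less d 0<d M hy) = less d 0<d (N ℕ.⊔ M) λ n n≥ →
    subst (ℚ._≤ seq x n ℚ.+ seq y n) (ℚ.+-identityˡ (0ℚ ℚ.+ d))
      (ℚ.+-mono-≤ (hx n (ℕ.m⊔n≤o⇒m≤o N M n≥)) (hy n (ℕ.m⊔n≤o⇒n≤o N M n≥)))

  Pos-* : ∀ {x y} → Pos x → Pos y → Pos (x * y)
  Pos-* {x} {y} (less d 0<d N hx) (less e 0<e M hy) = less (d ℚ.* e) (*-pos 0<d 0<e) (N ℕ.⊔ M)
    λ n n≥ →
      let d≤x = subst (ℚ._≤ seq x n) (ℚ.+-identityˡ d) (hx n (ℕ.m⊔n≤o⇒m≤o N M n≥))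
          e≤y = subst (ℚ._≤ seq y n) (ℚ.+-identityˡ e) (hy n (ℕ.m⊔n≤o⇒n≤o N M n≥))
      in subst (ℚ._≤ seq x n ℚ.* seq y n) (sym (ℚ.+-identityˡ (d ℚ.* e)))
           (*-mono-≤ (ℚ.≤-trans (ℚ.<⇒≤ 0<d) d≤x) (ℚ.<⇒≤ 0<e) d≤x e≤y)

  sum-nonNeg : ∀ {A : Set} (h : A → ℝ) as → (∀ a → NonNeg (h a)) → NonNeg (sum (List.map h as))
  sum-nonNeg h []       nn = fromℚ-nonNeg ℚ.≤-refl
  sum-nonNeg h (a ∷ as) nn = NonNeg-+ (nn a) (sum-nonNeg h as nn)

  sum-pos : ∀ {A : Set} (h : A → ℝ) {as a} → (∀ a → NonNeg (h a)) →
            a ∈ as → Pos (h a) → Pos (sum (List.map h as))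
  sum-pos h {a ∷ as} nn (here refl) pos = Pos-+ˡ pos (sum-nonNeg h as nn)
  sum-pos h {a ∷ as} nn (there a∈)  pos = Pos-+ʳ (nn a) (sum-pos h nn a∈ pos)

  𝟙-nonNeg : ∀ {P : Set} (P? : Dec P) → NonNeg (𝟙 P?)
  𝟙-nonNeg P? with does P?
  ... | true  = fromℚ-nonNeg 0≤1
  ... | false = fromℚ-nonNeg ℚ.≤-refl

  𝟙-true : ∀ {P : Set} (P? : Dec P) → P → Pos (𝟙 P?)
  𝟙-true (yes _) _ = fromℚ-mono-< (ℚ.positive⁻¹ 1ℚ)
  𝟙-true (no ¬p) p = contradiction p ¬p

  -- An outcome of positive mass at which y is received.
  lift₁ : Maybe Sign → Sign × Maybe Sign
  lift₁ (just s) = s , just s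
  lift₁ ⋆        = Sign.+ , ⋆

  received-lift : ∀ {n} (y : Vec _ n) → received (Vec.map lift₁ y) ≡ y
  received-lift []           = refl
  received-lift (just _ ∷ y) = cong (_ ∷_) (received-lift y)
  received-lift (⋆ ∷ y)      = cong (_ ∷_) (received-lift y)

  module _ (p : ℝ) (0<p : 0ℝ < p) (p<1 : p < 1ℝ) where
    0<½p : Pos (fromℚ ½ * p)
    0<½p = Pos-* (fromℚ-mono-< ½>0) 0<p

    0<1-p : Pos (1ℝ - p)
    0<1-p = let less d 0<d N h = p<1 in less d 0<d N λ n n≥ →
      subst₂ ℚ._≤_ (eq (seq p n) d) refl (ℚ.+-monoˡ-≤ (ℚ.- seq p n) (h n n≥))
      where
      eq : ∀ u d → (u ℚ.+ d) ℚ.- u ≡ 0ℚ ℚ.+ d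
      eq u d = trans (cong (ℚ._- u) (ℚ.+-comm u d)) (trans (a+b-b d u) (sym (ℚ.+-identityˡ d)))

    0<½[1-p] : Pos (fromℚ ½ * (1ℝ - p))
    0<½[1-p] = Pos-* (fromℚ-mono-< ½>0) 0<1-p

    mass-nonNeg : ∀ z → NonNeg (mass (SBES p) z)
    mass-nonNeg (x , just y) with does (x Sign.≟ y)
    ... | true  = Pos⇒NonNeg 0<½p
    ... | false = fromℚ-nonNeg ℚ.≤-refl
    mass-nonNeg (x , ⋆) = Pos⇒NonNeg 0<½[1-p]

    product-nonNeg : ∀ {n} (z : Vec _ n) → NonNeg (mass (SBES p ^⊗ n) z)
    product-nonNeg []      = fromℚ-nonNeg 0≤1
    product-nonNeg (a ∷ z) = NonNeg-* (mass-nonNeg a) (product-nonNeg z)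

    lift₁∈ : ∀ y → lift₁ y ∈ outcomes (SBES p)
    lift₁∈ (just Sign.-) = here refl
    lift₁∈ (just Sign.+) = there (there (there (there (here refl))))
    lift₁∈ ⋆             = there (there (there (there (there (here refl)))))

    lift₁-pos : ∀ y → Pos (mass (SBES p) (lift₁ y))
    lift₁-pos (just Sign.-) = 0<½p
    lift₁-pos (just Sign.+) = 0<½p
    lift₁-pos ⋆             = 0<½[1-p]

    lift∈ : ∀ {n} (y : Vec _ n) → Vec.map lift₁ y ∈ outcomes (SBES p ^⊗ n)
    lift∈ []      = here refl
    lift∈ (a ∷ y) = ∈-cartesianProductWith⁺ _∷_ (lift₁∈ a) (lift∈ y)

    lift-pos : ∀ {n} (y : Vec _ n) → Pos (mass (SBES p ^⊗ n) (Vec.map lift₁ y))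
    lift-pos []      = fromℚ-mono-< (ℚ.positive⁻¹ 1ℚ)
    lift-pos (a ∷ y) = Pos-* (lift₁-pos a) (lift-pos y)

Pr[received]>0 : ∀ {n p} → 0ℝ < p → p < 1ℝ → (y : Vec (Maybe Sign) n) → 0ℝ < Pr[received≡ y ] p
Pr[received]>0 {n} {p} 0<p p<1 y = sum-pos
  (λ z → mass (SBES p ^⊗ n) z * 𝟙 (received z ≟ y))
  (λ z → NonNeg-* (product-nonNeg p 0<p p<1 z) (𝟙-nonNeg (received z ≟ y)))
  (lift∈ p 0<p p<1 y)
  (Pos-* (lift-pos p 0<p p<1 y)
    (𝟙-true (received z₀ ≟ y) (received-lift y)))
  where
  z₀ = Vec.map lift₁ y

-- E[f(x) | y] as the elementary quotient E[f(x)·1{received = y}] / Pr[received = y].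
𝔼[_∣received≡_] : ∀ {n p} → BoolFun n → Vec (Maybe Sign) n → 0ℝ < p → p < 1ℝ → ℝ
𝔼[_∣received≡_] {n} {p} f y 0<p p<1 =
  𝔼 (SBES p ^⊗ n) (λ z → ⟦ f (source z) ⟧ * 𝟙 (received z ≟ y))
    * inv (Pr[received≡ y ] p) (Pr[received]>0 0<p p<1 y)

Φ : ∀ {n} p → 0ℝ < p → p < 1ℝ → BoolFun n → ℝ
Φ {n} p 0<p p<1 f = 𝔼 (SBES p ^⊗ n) λ z → ∣ 𝔼[ f ∣received≡ received z ] 0<p p<1 ∣

-- For n ≥ 3, truncated subtraction agrees with n - 3.
ε : ℕ → ℚ
ε n = ℤ.+ 4 ℚ./ (6 ℕ.+ (n ℕ.∸ 3) ℕ.^ 2)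

0<ε : ∀ n → 0ℝ < fromℚ (ε n)
0<ε n = fromℚ-mono-< (ℚ.positive⁻¹ (ε n) {{ℚ.normalize-pos 4 (6 ℕ.+ (n ℕ.∸ 3) ℕ.^ 2)}})

½<1 : fromℚ ½ < 1ℝ
½<1 = less ½ ½>0 0 λ _ _ → ℚ.≤-refl

TendsToZero : (ℕ → ℚ) → Set
TendsToZero a = ∀ e → 0ℚ ℚ.< e → ∃[ N ] (∀ n → N ℕ.≤ n → ℚ.∣ a n ∣ ℚ.≤ e)

1/_² : ∀ n → .{{ℕ.NonZero n}} → ℚ
1/ n ² = (ℤ.+ 1 ℚ./ (n ℕ.^ 2)) {{ℕ.m^n≢0 n 2}}

module Submission where

-- Let n = 2k + 1 and u = (-, +, -, ..., -), so that u sums to -1, and let g agree with Maj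
-- except at ±u.  Write a, b for (1 + ρ)/4, (1 - ρ)/4 or for (1 - p)/2, p/2.  Up to a constant
-- factor, both Stab[Maj] - Stab[g] and Φ[g] - Φ[Maj] are at least (a - b) W - (aⁿ - bⁿ).  Here
-- W is the weight of the k-step walks on ℤ from 0 to 0 that stay with weight a² + b² and move
-- in either direction with weight ab: a pair (-, +) of coordinates of u makes one step, and
-- the unpaired coordinate gives the factor a - b.  The walks with no move and with exactly two
-- moves already give W ≥ (a² + b²)ᵏ + k(k - 1)(a² + b²)ᵏ⁻²(ab)², and this exceeds
-- (aⁿ - bⁿ)/(a - b) = Σ a²ᵏ⁻ⁱ bⁱ because b ≥ ε/2 implies (k² - 1) b ≥ a + 3b/2.  All
-- operations on reals act termwise on Cauchy sequences, so it suffices to prove these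
-- inequalities over ℚ, with a gap that does not depend on the index.

open import Defs
  using ( ℝ; seq; 0ℝ; 1ℝ; fromℚ; _<_; _#_; less; sign; <-trans; ½<1; recip; recip-inverse
        ; Measure; outcomes; mass; sum; product; 𝔼; 𝟙; vectors; _^⊗_
        ; BoolFun; signs; toℤ; ⟦_⟧; uniform; Unbiased; weightedSum; IsLTF; Maj; DSBS; Stab
        ; symbols; SBES; source; received; 𝔼[_∣received≡_]; Φ
        ; ε; 0<ε; TendsToZero; 1/_² )
  renaming (_≟_ to infix 4 _≟ₘ_)
import Defs
open import Data.Bool using (Bool; true; false; if_then_else_)
open import Data.Integer as ℤ using (ℤ; 0ℤ; 1ℤ; -1ℤ)
import Data.Integer.Properties as ℤ
open import Data.Integer.Tactic.RingSolver using () renaming (solve-∀ to solve-∀ᶻ)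
open import Data.List as List using (List; []; _∷_; _++_; cartesianProduct)
open import Data.Maybe using (Maybe; just; nothing)
open import Data.Nat as ℕ using (ℕ; zero; suc; _%_; NonZero)
open import Data.Nat.DivMod using (m≡m%n+[m/n]*n)
import Data.Nat.Properties as ℕ
open import Data.Product using (Σ; ∃; _×_; _,_; proj₁; proj₂)
open import Data.Rational as ℚ using (ℚ; 0ℚ; 1ℚ; ½; _+_; _*_; _-_; -_; _/_; _≤_)
import Data.Rational.Properties as ℚ
import Data.Rational.Unnormalised as ℚᵘ
import Data.Rational.Unnormalised.Properties as ℚᵘ
open import Data.Sign as Sign using (Sign; opposite)
import Data.Sign.Properties as Sign
open import Data.Sum using (_⊎_; inj₁; inj₂)
open import Data.Vec as Vec using (Vec; []; _∷_)
import Data.Vec.Properties as Vec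
open import Function using (_∘_)
open import Level using (0ℓ)
open import Relation.Binary.PropositionalEquality
  using (_≡_; _≢_; refl; sym; trans; cong; cong₂; subst; subst₂)
open import Relation.Nullary using (Dec; does; yes; no; contradiction)
open import Relation.Nullary.Decidable using (dec⇒maybe)
open import Tactic.RingSolver using (solve-∀)
open import Tactic.RingSolver.Core.AlmostCommutativeRing
  using (AlmostCommutativeRing; fromCommutativeRing)

-- Maj is decided at `u` and `-u` by one vote, so these are its most fragile values; as Maj is
-- symmetric, the order of the signs in `u` is free, and alternating them lets neighbouring
-- coordinates be paired. With p = (1 - ρ)/2 both claims live in one regime: a + b = 1/2 and ε/2 < b
-- < a. Write g = Maj + 2 D with D = δ_u - δ_(-u). The linear effect of D is the gain (a - b) W. The
-- loss aⁿ - bⁿ is, for Stab, the quadratic term ⟨D, D⟩. For Φ it corrects the pointwise bound: aⁿ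
-- comes from the fully erased y, where the changes at u and -u cancel, and bⁿ from the y that
-- reveal all of u or of -u. As b tends to 0, gain and loss agree to leading order. After division
-- by a - b, what remains is about k² a²ᵏ⁻² b² - a²ᵏ⁻¹ b, positive only once b exceeds about a/k²,
-- that is about 2/n²; this is the origin of ε ~ 4/n². The walks that never move supply only k of
-- the factor k², so the walks with two moves are indispensable.

private
  ring : AlmostCommutativeRing 0ℓ 0ℓ
  ring = fromCommutativeRing ℚ.+-*-commutativeRing λ x → dec⇒maybe (0ℚ ℚ.≟ x)

  variable
    A B : Set
    n : ℕ

-- Polynomial inequalities are proved below by an explicit nonnegative slack `r`, which leaves an
-- identity for the ring solver.
≤-by : ∀ {p q} r → 0ℚ ≤ r → p + r ≡ q → p ≤ q
≤-by {p} r 0≤r eq = subst₂ _≤_ (ℚ.+-identityʳ p) eq (ℚ.+-monoʳ-≤ p 0≤r)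

≤⇒0≤ : ∀ {p q} → p ≤ q → 0ℚ ≤ q - p
≤⇒0≤ {p} {q} p≤q = subst (_≤ q - p) (ℚ.+-inverseʳ p) (ℚ.+-monoˡ-≤ (- p) p≤q)

+-nonNeg : ∀ {p q} → 0ℚ ≤ p → 0ℚ ≤ q → 0ℚ ≤ p + q
+-nonNeg = ℚ.+-mono-≤

*-nonNeg : ∀ {p q} → 0ℚ ≤ p → 0ℚ ≤ q → 0ℚ ≤ p * q
*-nonNeg {p} {q} 0≤p 0≤q = subst (_≤ p * q) (ℚ.*-zeroʳ p)
  (ℚ.*-monoˡ-≤-nonNeg p {{ℚ.nonNegative 0≤p}} 0≤q)

*-monoˡ : ∀ {p q} r → 0ℚ ≤ r → p ≤ q → r * p ≤ r * q
*-monoˡ r 0≤r = ℚ.*-monoˡ-≤-nonNeg r {{ℚ.nonNegative 0≤r}}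

*-mono-≤ : ∀ {p q r s} → 0ℚ ≤ p → 0ℚ ≤ r → p ≤ q → r ≤ s → p * r ≤ q * s
*-mono-≤ {p} {q} {r} {s} 0≤p 0≤r p≤q r≤s =
  ℚ.≤-trans (*-monoˡ p 0≤p r≤s)
    (ℚ.*-monoʳ-≤-nonNeg s {{ℚ.nonNegative (ℚ.≤-trans 0≤r r≤s)}} p≤q)

0≤1 : 0ℚ ≤ 1ℚ
0≤1 = ℚ.nonNegative⁻¹ 1ℚ

0≤½ : 0ℚ ≤ ½
0≤½ = ℚ.nonNegative⁻¹ ½

infixr 8 _^_

_^_ : ℚ → ℕ → ℚ
x ^ zero  = 1ℚ
x ^ suc n = x * x ^ n

^-nonNeg : ∀ {x} → 0ℚ ≤ x → ∀ n → 0ℚ ≤ x ^ n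
^-nonNeg 0≤x zero    = 0≤1
^-nonNeg 0≤x (suc n) = *-nonNeg 0≤x (^-nonNeg 0≤x n)

^-mono-≤ : ∀ {x y} → 0ℚ ≤ x → x ≤ y → ∀ n → x ^ n ≤ y ^ n
^-mono-≤ 0≤x x≤y zero    = ℚ.≤-refl
^-mono-≤ 0≤x x≤y (suc n) = *-mono-≤ 0≤x (^-nonNeg 0≤x n) x≤y (^-mono-≤ 0≤x x≤y n)

^-double : ∀ x k → x ^ (k ℕ.* 2) ≡ (x * x) ^ k
^-double x zero    = refl
^-double x (suc k) = trans (sym (ℚ.*-assoc x x _)) (cong (x * x *_) (^-double x k))

-- Polynomial and walk inequalities

-- Unlike a normalised fraction over 1, this embedding unfolds by computation, so the ring solver
-- sees `ι (suc (suc m))` as a polynomial in `ι m`.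
ι : ℕ → ℚ
ι zero    = 0ℚ
ι (suc n) = 1ℚ + ι n

0≤ι : ∀ n → 0ℚ ≤ ι n
0≤ι zero    = ℚ.≤-refl
0≤ι (suc n) = +-nonNeg 0≤1 (0≤ι n)

-- The complete homogeneous symmetric polynomial Σ_{j ≤ m} x^(m-j) y^j.
h : ℚ → ℚ → ℕ → ℚ
h x y zero    = 1ℚ
h x y (suc m) = x * h x y m + y ^ suc m

-- The definition splits off the pure power of y; by symmetry of the polynomial the pure power of x
-- can be split off instead. The inductions below need both recursions.
h-flip : ∀ x y m → h x y (suc m) ≡ y * h x y m + x ^ suc m
h-flip x y zero    = eq x y
  where
  eq : ∀ x y → x * 1ℚ + y * 1ℚ ≡ y * 1ℚ + x * 1ℚ
  eq = solve-∀ ring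
h-flip x y (suc m) = trans (cong (λ z → x * z + y ^ suc (suc m)) (h-flip x y m))
                           (eq x y (h x y m) (x ^ m) (y ^ m))
  where
  eq : ∀ x y H X Y → x * (y * H + x * X) + y * (y * Y) ≡ y * (x * H + y * Y) + x * (x * X)
  eq = solve-∀ ring

h-telescope : ∀ x y m → (x - y) * h x y m ≡ x ^ suc m - y ^ suc m
h-telescope x y zero    = eq x y
  where
  eq : ∀ x y → (x - y) * 1ℚ ≡ x * 1ℚ - y * 1ℚ
  eq = solve-∀ ring
h-telescope x y (suc m) = trans (eq₁ x y (h x y m) (y ^ suc m))
  (trans (cong (λ z → x * z + (x - y) * y ^ suc m) (h-telescope x y m))
    (eq₂ x y (x ^ suc m) (y ^ suc m)))
  where
  eq₁ : ∀ x y H Y → (x - y) * (x * H + Y) ≡ x * ((x - y) * H) + (x - y) * Y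
  eq₁ = solve-∀ ring
  eq₂ : ∀ x y X Y → x * (X - Y) + (x - y) * Y ≡ x * X - y * Y
  eq₂ = solve-∀ ring

module _ {x y : ℚ} (0≤x : 0ℚ ≤ x) (0≤y : 0ℚ ≤ y) where

  h-nonNeg : ∀ m → 0ℚ ≤ h x y m
  h-nonNeg zero    = 0≤1
  h-nonNeg (suc m) = +-nonNeg (*-nonNeg 0≤x (h-nonNeg m)) (^-nonNeg 0≤y (suc m))

  yᵐ≤h : ∀ m → y ^ m ≤ h x y m
  yᵐ≤h zero    = ℚ.≤-refl
  yᵐ≤h (suc m) = ≤-by (x * h x y m) (*-nonNeg 0≤x (h-nonNeg m)) (ℚ.+-comm (y ^ suc m) _)

  xᵐ≤h : ∀ m → x ^ m ≤ h x y m
  xᵐ≤h zero    = ℚ.≤-refl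
  xᵐ≤h (suc m) = ≤-by (y * h x y m) (*-nonNeg 0≤y (h-nonNeg m))
    (trans (ℚ.+-comm (x ^ suc m) _) (sym (h-flip x y m)))

  h≤[x+y]ᵐ : ∀ m → h x y m ≤ (x + y) ^ m
  h≤[x+y]ᵐ zero    = ℚ.≤-refl
  h≤[x+y]ᵐ (suc m) = ℚ.≤-trans
    (ℚ.+-monoʳ-≤ (x * h x y m) (*-monoˡ y 0≤y (yᵐ≤h m)))
    (subst (_≤ (x + y) * (x + y) ^ m) (ℚ.*-distribʳ-+ (h x y m) x y)
      (*-monoˡ (x + y) (+-nonNeg 0≤x 0≤y) (h≤[x+y]ᵐ m)))

  -- The product `x * y * h x y m` collects the interior monomials of degree m + 2, and each
  -- interior binomial coefficient is at least m + 2.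
  [x+y]ᵐ⁺²≥ : ∀ m → x ^ suc (suc m) + y ^ suc (suc m) + ι (suc (suc m)) * (x * y * h x y m)
                  ≤ (x + y) ^ suc (suc m)
  [x+y]ᵐ⁺²≥ zero    = ℚ.≤-reflexive (eq x y)
    where
    eq : ∀ x y → x * (x * 1ℚ) + y * (y * 1ℚ) + (1ℚ + (1ℚ + 0ℚ)) * (x * y * 1ℚ)
               ≡ (x + y) * ((x + y) * 1ℚ)
    eq = solve-∀ ring
  [x+y]ᵐ⁺²≥ (suc m) = ℚ.≤-trans
    (≤-by ((1ℚ + ι m) * (x * y * (x * (H - X))))
      (*-nonNeg (+-nonNeg 0≤1 (0≤ι m)) (*-nonNeg (*-nonNeg 0≤x 0≤y)
        (*-nonNeg 0≤x (≤⇒0≤ (xᵐ≤h m)))))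
      step)
    (*-monoˡ (x + y) (+-nonNeg 0≤x 0≤y) ([x+y]ᵐ⁺²≥ m))
    where
    H = h x y m
    X = x ^ m
    Y = y ^ m
    -- `Z` stands for `h x y (suc m)`. The two differences containing it vanish by `h-flip` and by
    -- the definition of `h`; keeping them in the identity makes it polynomial in independent
    -- variables.
    eq : ∀ x y k H X Y Z → x * (x * (x * X)) + y * (y * (y * Y))
      + (1ℚ + (1ℚ + (1ℚ + k))) * (x * y * Z)
         + (1ℚ + k) * (x * y * (x * (H - X)))
         ≡ (x + y) * (x * (x * X) + y * (y * Y) + (1ℚ + (1ℚ + k)) * (x * y * H))
           + (1ℚ + (1ℚ + k)) * (x * y) * (Z - (y * H + x * X)) + x * y * (Z - (x * H + y * Y))
    eq = solve-∀ ring
    step : _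
    step = trans (eq x y (ι m) H X Y (h x y (suc m)))
      (trans (cong₂ (λ u v → (x + y) * (x * (x * X) + y * (y * Y) + (1ℚ + (1ℚ + ι m)) * (x * y * H))
                             + (1ℚ + (1ℚ + ι m)) * (x * y) * u + x * y * v)
                (trans (cong (_- (y * H + x * X)) (h-flip x y m)) (ℚ.+-inverseʳ (y * H + x * X)))
                (ℚ.+-inverseʳ (x * H + y * Y)))
        (eq′ (x + y) _ ((1ℚ + (1ℚ + ι m)) * (x * y)) (x * y)))
      where
      eq′ : ∀ s t u v → s * t + u * 0ℚ + v * 0ℚ ≡ s * t
      eq′ = solve-∀ ring

-- Weighted walks on the integers

walk : ℚ → ℚ → ℤ → ℕ → (ℤ → ℚ) → ℤ → ℚ
walk c b d zero    f v = f v
walk c b d (suc k) f v = c * walk c b d k f v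
  + b * (walk c b d k f (v ℤ.- d) + walk c b d k f (v ℤ.+ d))

module _ {c b : ℚ} (d : ℤ) (0≤c : 0ℚ ≤ c) (0≤b : 0ℚ ≤ b)
         {f : ℤ → ℚ} (0≤f : ∀ v → 0ℚ ≤ f v) (1≤f0 : 1ℚ ≤ f 0ℤ) where

  private
    w : ℕ → ℤ → ℚ
    w k = walk c b d k f

  walk-nonNeg : ∀ k v → 0ℚ ≤ w k v
  walk-nonNeg zero    v = 0≤f v
  walk-nonNeg (suc k) v = +-nonNeg (*-nonNeg 0≤c (walk-nonNeg k v))
    (*-nonNeg 0≤b (+-nonNeg (walk-nonNeg k (v ℤ.- d)) (walk-nonNeg k (v ℤ.+ d))))

  walk-stay : ∀ k → c ^ k ≤ w k 0ℤ
  walk-stay zero    = 1≤f0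
  walk-stay (suc k) = ℚ.≤-trans (*-monoˡ c 0≤c (walk-stay k))
    (≤-by _ (*-nonNeg 0≤b (+-nonNeg (walk-nonNeg k (0ℤ ℤ.- d)) (walk-nonNeg k (0ℤ ℤ.+ d)))) refl)

  private
    -- Records of "one move away from 0" only the consequence used, so that `-d` and `d` share one
    -- argument.
    Neighbour : ℤ → Set
    Neighbour v = ∀ k → w k 0ℤ ≤ w k (v ℤ.- d) + w k (v ℤ.+ d)

    -- Counts the walks whose only move leads to 0: there are k + 1 times at which it can occur.
    walk-near : ∀ {v} → Neighbour v → ∀ k → ι (suc k) * (b * c ^ k) ≤ w (suc k) v
    walk-near {v} nb zero = ℚ.≤-trans (ℚ.≤-trans (ℚ.≤-reflexive (eq b)) (*-monoˡ b 0≤b 1≤f0))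
      (ℚ.≤-trans (*-monoˡ b 0≤b (nb 0)) (≤-by _ (*-nonNeg 0≤c (0≤f v)) (ℚ.+-comm _ (c * f v))))
      where
      eq : ∀ b → (1ℚ + 0ℚ) * (b * 1ℚ) ≡ b * 1ℚ
      eq = solve-∀ ring
    walk-near {v} nb (suc k) = ℚ.≤-trans (ℚ.≤-reflexive (eq b c (ι k) (c ^ k)))
      (ℚ.+-mono-≤ (*-monoˡ c 0≤c (walk-near nb k))
        (*-monoˡ b 0≤b (ℚ.≤-trans (walk-stay (suc k)) (nb (suc k)))))
      where
      eq : ∀ b c k C → (1ℚ + (1ℚ + k)) * (b * (c * C)) ≡ c * ((1ℚ + k) * (b * C)) + b * (c * C)
      eq = solve-∀ ring

    near₋ : Neighbour (0ℤ ℤ.- d)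
    near₋ k = ≤-by (w k (0ℤ ℤ.- d ℤ.- d)) (walk-nonNeg k _)
      (trans (ℚ.+-comm (w k 0ℤ) _) (cong (λ v → w k (0ℤ ℤ.- d ℤ.- d) + w k v) (sym
        (trans (ℤ.+-assoc 0ℤ (ℤ.- d) d) (cong (ℤ._+_ 0ℤ) (ℤ.+-inverseˡ d))))))

    near₊ : Neighbour (0ℤ ℤ.+ d)
    near₊ k = ≤-by (w k (0ℤ ℤ.+ d ℤ.+ d)) (walk-nonNeg k _)
      (cong (λ v → w k v + w k (0ℤ ℤ.+ d ℤ.+ d)) (sym
        (trans (ℤ.+-assoc 0ℤ d (ℤ.- d)) (cong (ℤ._+_ 0ℤ) (ℤ.+-inverseʳ d)))))

  -- Besides the walk that never moves, count those with two opposite moves. With m + 2 steps, an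
  -- ordered pair of distinct times for the move by `d` and the move by `-d` can be chosen in (m +
  -- 2)(m + 1) ways.
  walk-return : ∀ m → c ^ suc (suc m) + ι (suc (suc m)) * ι (suc m) * (c ^ m * (b * b))
                    ≤ w (suc (suc m)) 0ℤ
  walk-return zero = ℚ.≤-trans (ℚ.≤-reflexive (eq c b))
    (ℚ.+-mono-≤ (*-monoˡ c 0≤c (walk-stay 1))
      (*-monoˡ b 0≤b (ℚ.+-mono-≤ (walk-near near₋ 0) (walk-near near₊ 0))))
    where
    eq : ∀ c b → c * (c * 1ℚ) + (1ℚ + (1ℚ + 0ℚ)) * (1ℚ + 0ℚ) * (1ℚ * (b * b))
               ≡ c * (c * 1ℚ) + b * ((1ℚ + 0ℚ) * (b * 1ℚ) + (1ℚ + 0ℚ) * (b * 1ℚ))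
    eq = solve-∀ ring
  walk-return (suc m) = ℚ.≤-trans (ℚ.≤-reflexive (eq c b (ι m) (c ^ m)))
    (ℚ.+-mono-≤ (*-monoˡ c 0≤c (walk-return m))
      (*-monoˡ b 0≤b (ℚ.+-mono-≤ (walk-near near₋ (suc m)) (walk-near near₊ (suc m)))))
    where
    eq : ∀ c b k C → c * (c * (c * C)) + (1ℚ + (1ℚ + (1ℚ + k))) * (1ℚ + (1ℚ + k)) *
      (c * C * (b * b))
       ≡ c * (c * (c * C) + (1ℚ + (1ℚ + k)) * (1ℚ + k) * (C * (b * b)))
         + b * ((1ℚ + (1ℚ + k)) * (b * (c * C)) + (1ℚ + (1ℚ + k)) * (b * (c * C)))
    eq = solve-∀ ring

module _ {a b : ℚ} (0≤b : 0ℚ ≤ b) (b≤a : b ≤ a) (m : ℕ)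
         (steep : a + (1ℚ + ½) * b ≤ (ι (suc (suc m)) * ι (suc (suc m)) - 1ℚ) * b)
         (d : ℤ) {f : ℤ → ℚ} (0≤f : ∀ v → 0ℚ ≤ f v) (1≤f0 : 1ℚ ≤ f 0ℤ) where

  private
    k = ι (suc (suc m))
    x = a * a
    y = b * b
    0≤a = ℚ.≤-trans 0≤b b≤a
    0≤x = *-nonNeg 0≤a 0≤a
    0≤y = *-nonNeg 0≤b 0≤b
    0≤ab = *-nonNeg 0≤a 0≤b
    H = h x y m
    0≤H = h-nonNeg 0≤x 0≤y m
    W = walk (x + y) (a * b) d (suc (suc m)) f 0ℤ

    -- The standing walk contributes k copies of the interior term, by the binomial bound, and the
    -- walks with two moves contribute k (k - 1) more, since `h` is at most the full power of x + y.
    -- Together they give k².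
    W≥ : x ^ suc (suc m) + y ^ suc (suc m) + k * k * (x * y * H) ≤ W
    W≥ = ℚ.≤-trans (ℚ.≤-reflexive (eq a b (ι m) H (x ^ suc (suc m)) (y ^ suc (suc m))))
      (ℚ.≤-trans
        (ℚ.+-mono-≤ ([x+y]ᵐ⁺²≥ 0≤x 0≤y m)
          (*-monoˡ (k * ι (suc m)) (*-nonNeg (0≤ι (suc (suc m))) (0≤ι (suc m)))
            (ℚ.*-monoʳ-≤-nonNeg (a * b * (a * b)) {{ℚ.nonNegative (*-nonNeg 0≤ab 0≤ab)}}
              (h≤[x+y]ᵐ 0≤x 0≤y m))))
        (walk-return d (+-nonNeg 0≤x 0≤y) 0≤ab 0≤f 1≤f0 m))
      where
      eq : ∀ a b k H X Y → X + Y + (1ℚ + (1ℚ + k)) * (1ℚ + (1ℚ + k)) * (a * a * (b * b) * H)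
         ≡ X + Y + (1ℚ + (1ℚ + k)) * (a * a * (b * b) * H)
           + (1ℚ + (1ℚ + k)) * (1ℚ + k) * (H * (a * b * (a * b)))
      eq = solve-∀ ring

    -- G = Σ_{i ≤ 2k} a^(2k-i) b^i, split by the parity of i.
    G = h x y (suc (suc m)) + a * b * h x y (suc m)

    G-telescope : (a - b) * G ≡ a * x ^ suc (suc m) - b * y ^ suc (suc m)
    G-telescope = trans (eq₁ a b (h x y (suc m)) (y ^ suc (suc m)))
      (trans (cong (λ z → a * z + (a - b) * y ^ suc (suc m)) (h-telescope x y (suc m)))
             (eq₂ a b (x ^ suc (suc m)) (y ^ suc (suc m))))
      where
      eq₁ : ∀ a b h Y → (a - b) * (a * a * h + Y + a * b * h)
        ≡ a * ((a * a - b * b) * h) + (a - b) * Y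
      eq₁ = solve-∀ ring
      eq₂ : ∀ a b X Y → a * (X - Y) + (a - b) * Y ≡ a * X - b * Y
      eq₂ = solve-∀ ring

    -- Cancelling the pure powers and one interior term from `G` leaves ab (x H + y · yᵐ) to be paid
    -- from (k² - 1) x y H. In `steep` the summand a pays for the x H part. Of the 3/2 copies of b,
    -- one pays for y · yᵐ, because b ≤ a and yᵐ ≤ H, and the remaining half pays for the extra gap,
    -- because xᵐ ≤ H.
    G+gap≤ : G + ½ * (x * y * x ^ m) ≤ x ^ suc (suc m) + y ^ suc (suc m) + k * k * (x * y * H)
    G+gap≤ = ≤-by slack
      (+-nonNeg (+-nonNeg
        (*-nonNeg (*-nonNeg (*-nonNeg 0≤ab 0≤a) 0≤H) (≤⇒0≤ steep))
        (*-nonNeg (*-nonNeg 0≤ab 0≤b)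
          (≤⇒0≤ (*-mono-≤ 0≤b (^-nonNeg 0≤y m) b≤a (yᵐ≤h 0≤x 0≤y m)))))
        (*-nonNeg 0≤½ (*-nonNeg (*-nonNeg 0≤x 0≤y) (≤⇒0≤ (xᵐ≤h 0≤x 0≤y m)))))
      (trans (cong (λ z → x * z + y * (y * y ^ m) + a * b * (x * H + y * y ^ m)
                          + ½ * (x * y * x ^ m) + slack) (h-flip x y m))
             (eq a b k H (x ^ m) (y ^ m)))
      where
      slack = a * b * a * H * ((k * k - 1ℚ) * b - (a + (1ℚ + ½) * b))
            + a * b * b * (a * H - b * y ^ m) + ½ * (x * y * (H - x ^ m))
      eq : ∀ a b k H X Y →
        a * a * (b * b * H + a * a * X) + b * b * (b * b * Y) + a * b * (a * a * H + b * b * Y)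
          + ½ * (a * a * (b * b) * X)
          + (a * b * a * H * ((k * k - 1ℚ) * b - (a + (1ℚ + ½) * b))
            + a * b * b * ((a * H - b * Y)) + ½ * (a * a * (b * b) * (H - X)))
        ≡ a * a * (a * a * X) + b * b * (b * b * Y) + k * k * (a * a * (b * b) * H)
      eq = solve-∀ ring

  -- Multiplying the bound on `G` by a - b ≥ 0 telescopes `G` into a difference of n-th powers. The
  -- additional summand is what later makes the strict inequality uniform along a Cauchy sequence.
  power-gap≤walk : a ^ suc (suc (suc m) ℕ.* 2) - b ^ suc (suc (suc m) ℕ.* 2)
    + (a - b) * (½ * (x * y * x ^ m))
      ≤ (a - b) * W
  power-gap≤walk = subst (_≤ (a - b) * W)
    (trans (ℚ.*-distribˡ-+ (a - b) G _) (cong (_+ (a - b) * (½ * (x * y * x ^ m)))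
      (trans G-telescope (sym (cong₂ (λ u v → a * u - b * v) (^-double a (suc (suc m)))
        (^-double b (suc (suc m))))))))
    (*-monoˡ (a - b) (≤⇒0≤ b≤a) (ℚ.≤-trans G+gap≤ W≥))

-- Expectations over product measures

∑ : List A → (A → ℚ) → ℚ
∑ []       f = 0ℚ
∑ (a ∷ as) f = f a + ∑ as f

∑-cong : ∀ (as : List A) {f g : A → ℚ} → (∀ a → f a ≡ g a) → ∑ as f ≡ ∑ as g
∑-cong []       f≗g = refl
∑-cong (a ∷ as) f≗g = cong₂ _+_ (f≗g a) (∑-cong as f≗g)

∑-+ : ∀ (as : List A) (f g : A → ℚ) → ∑ as (λ a → f a + g a) ≡ ∑ as f + ∑ as g
∑-+ []       f g = refl
∑-+ (a ∷ as) f g = trans (cong (f a + g a +_) (∑-+ as f g)) (eq (f a) (g a) (∑ as f) (∑ as g))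
  where
  eq : ∀ p q r s → p + q + (r + s) ≡ p + r + (q + s)
  eq = solve-∀ ring

∑-* : ∀ (as : List A) r (f : A → ℚ) → ∑ as (λ a → r * f a) ≡ r * ∑ as f
∑-* []       r f = sym (ℚ.*-zeroʳ r)
∑-* (a ∷ as) r f = trans (cong (r * f a +_) (∑-* as r f)) (sym (ℚ.*-distribˡ-+ r (f a) _))

∑-mono : ∀ (as : List A) {f g : A → ℚ} → (∀ a → f a ≤ g a) → ∑ as f ≤ ∑ as g
∑-mono []       f≤g = ℚ.≤-refl
∑-mono (a ∷ as) f≤g = ℚ.+-mono-≤ (f≤g a) (∑-mono as f≤g)

∑-++ : ∀ (as bs : List A) (f : A → ℚ) → ∑ (as ++ bs) f ≡ ∑ as f + ∑ bs f
∑-++ []       bs f = sym (ℚ.+-identityˡ _)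
∑-++ (a ∷ as) bs f = trans (cong (f a +_) (∑-++ as bs f)) (sym (ℚ.+-assoc (f a) _ _))

∑-map : ∀ (k : A → B) as (f : B → ℚ) → ∑ (List.map k as) f ≡ ∑ as (f ∘ k)
∑-map k []       f = refl
∑-map k (a ∷ as) f = cong (f (k a) +_) (∑-map k as f)

∑-vectors : ∀ (as : List A) n (f : Vec A (suc n) → ℚ) →
            ∑ (vectors as (suc n)) f ≡ ∑ as (λ a → ∑ (vectors as n) (f ∘ (a ∷_)))
∑-vectors {A} as n f = go as
  where
  go : ∀ bs → ∑ (List.cartesianProductWith _∷_ bs (vectors as n)) f
            ≡ ∑ bs (λ a → ∑ (vectors as n) (f ∘ (a ∷_)))
  go []       = refl
  go (b ∷ bs) = trans (∑-++ (List.map (b ∷_) (vectors as n)) _ f)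
    (cong₂ _+_ (∑-map (b ∷_) (vectors as n) f) (go bs))

-- Expectation under a product law, integrated one coordinate at a time. This form lets the later
-- lemmas go by induction on n; `seq-𝔼` connects it with the sum over all vectors.
E : List A → (A → ℚ) → ∀ n → (Vec A n → ℚ) → ℚ
E as m zero    f = f []
E as m (suc n) f = ∑ as λ a → m a * E as m n (f ∘ (a ∷_))

seq-sum : ∀ (as : List A) (f : A → ℝ) i → seq (sum (List.map f as)) i ≡ ∑ as (λ a → seq (f a) i)
seq-sum []       f i = refl
seq-sum (a ∷ as) f i = cong (seq (f a) i +_) (seq-sum as f i)

module _ {A : Set} (as : List A) (m : A → ℚ) where

  E-cong : ∀ n {f g : Vec A n → ℚ} → (∀ v → f v ≡ g v) → E as m n f ≡ E as m n g
  E-cong zero    f≗g = f≗g []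
  E-cong (suc n) f≗g = ∑-cong as λ a → cong (m a *_) (E-cong n (λ v → f≗g (a ∷ v)))

  E-+ : ∀ n (f g : Vec A n → ℚ) → E as m n (λ v → f v + g v) ≡ E as m n f + E as m n g
  E-+ zero    f g = refl
  E-+ (suc n) f g = trans
    (∑-cong as λ a → trans (cong (m a *_) (E-+ n (f ∘ (a ∷_)) (g ∘ (a ∷_))))
                           (ℚ.*-distribˡ-+ (m a) _ _))
    (∑-+ as _ _)

  E-* : ∀ n r (f : Vec A n → ℚ) → E as m n (λ v → r * f v) ≡ r * E as m n f
  E-* zero    r f = refl
  E-* (suc n) r f = trans
    (∑-cong as λ a → trans (cong (m a *_) (E-* n r (f ∘ (a ∷_)))) (eq (m a) r _))
    (∑-* as r _)
    where
    eq : ∀ p q s → p * (q * s) ≡ q * (p * s)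
    eq = solve-∀ ring

  E-zero : ∀ n {f : Vec A n → ℚ} → (∀ v → f v ≡ 0ℚ) → E as m n f ≡ 0ℚ
  E-zero n {f} f≗0 = trans (E-cong n λ v → trans (f≗0 v) (sym (ℚ.*-zeroˡ (f v))))
    (trans (E-* n 0ℚ f) (ℚ.*-zeroˡ (E as m n f)))

  E-mono : (∀ a → 0ℚ ≤ m a) → ∀ n {f g : Vec A n → ℚ} → (∀ v → f v ≤ g v) →
           E as m n f ≤ E as m n g
  E-mono 0≤m zero    f≤g = f≤g []
  E-mono 0≤m (suc n) f≤g = ∑-mono as λ a → *-monoˡ (m a) (0≤m a) (E-mono 0≤m n (λ v → f≤g (a ∷ v)))

seq-𝔼 : ∀ (μ : Measure A) (m : A → ℚ) i → (∀ a → seq (mass μ a) i ≡ m a) →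
        ∀ n (f : Vec A n → ℝ) →
        seq (𝔼 (μ ^⊗ n) f) i ≡ E (outcomes μ) m n (λ v → seq (f v) i)
seq-𝔼 {A} μ m i mass≡ n f = trans (seq-sum (vectors (outcomes μ) n) _ i) (go n (λ v → seq (f v) i))
  where
  P : ∀ {n} → Vec A n → ℚ
  P v = seq (product (Vec.map (mass μ) v)) i

  go : ∀ n (g : Vec A n → ℚ) → ∑ (vectors (outcomes μ) n) (λ v → P v * g v) ≡ E (outcomes μ) m n g
  go zero    g = trans (ℚ.+-identityʳ (1ℚ * g [])) (ℚ.*-identityˡ (g []))
  go (suc n) g = trans (∑-vectors (outcomes μ) n (λ v → P v * g v))
    (∑-cong (outcomes μ) λ a → trans
      (∑-cong (vectors (outcomes μ) n) λ v →
        trans (cong (λ z → z * P v * g (a ∷ v)) (mass≡ a)) (ℚ.*-assoc (m a) (P v) (g (a ∷ v))))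
      (trans (∑-* (vectors (outcomes μ) n) (m a) (λ v → P v * g (a ∷ v)))
             (cong (m a *_) (go n (g ∘ (a ∷_))))))

⟪_⟫ : Bool → ℚ
⟪ p ⟫ = if p then 1ℚ else 0ℚ

neg : Vec Sign n → Vec Sign n
neg = Vec.map opposite

opposite-involutive : ∀ s → opposite (opposite s) ≡ s
opposite-involutive Sign.- = refl
opposite-involutive Sign.+ = refl

neg-involutive : ∀ (u : Vec Sign n) → neg (neg u) ≡ u
neg-involutive []      = refl
neg-involutive (s ∷ u) = cong₂ _∷_ (opposite-involutive s) (neg-involutive u)

total : Vec Sign n → ℤ
total x = Vec.foldr _ ℤ._+_ 0ℤ (Vec.map toℤ x)

toℤ-opposite : ∀ s → toℤ (opposite s) ≡ ℤ.- toℤ s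
toℤ-opposite Sign.- = refl
toℤ-opposite Sign.+ = refl

total-neg : ∀ (u : Vec Sign n) → total (neg u) ≡ ℤ.- total u
total-neg []      = refl
total-neg (s ∷ u) = trans (cong₂ ℤ._+_ (toℤ-opposite s) (total-neg u))
  (sym (ℤ.neg-distrib-+ (toℤ s) (total u)))

-- The value 0 at 0 makes the function odd everywhere, including at the even partial sums that arise
-- once coordinates are fixed. On totals of odd length it agrees with `Maj`, whose tie-breaking
-- never comes into play there.
sgn : ℤ → ℚ
sgn (ℤ.+ zero)  = 0ℚ
sgn (ℤ.+ suc _) = 1ℚ
sgn ℤ.-[1+ _ ]  = - 1ℚ

sgn-odd : ∀ v → sgn (ℤ.- v) ≡ - sgn v
sgn-odd (ℤ.+ zero)  = refl
sgn-odd (ℤ.+ suc _) = refl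
sgn-odd ℤ.-[1+ _ ]  = refl

alt : Sign → ∀ n → Vec Sign n
alt s zero    = []
alt s (suc n) = s ∷ alt (opposite s) n

v-1+1 : ∀ v → v ℤ.+ -1ℤ ℤ.+ 1ℤ ≡ v
v-1+1 v = trans (ℤ.+-assoc v -1ℤ 1ℤ) (ℤ.+-identityʳ v)

v+1-1 : ∀ v → v ℤ.+ 1ℤ ℤ.+ -1ℤ ≡ v
v+1-1 v = trans (ℤ.+-assoc v 1ℤ -1ℤ) (ℤ.+-identityʳ v)

-- In particular, only the even part of f matters at the origin.
walk-even : ∀ c b d r {f η : ℤ → ℚ} → (∀ v → f v + f (ℤ.- v) ≡ r * η v) →
            ∀ k v → walk c b d k f v + walk c b d k f (ℤ.- v) ≡ r * walk c b d k η v
walk-even c b d r         even zero    v = even v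
walk-even c b d r {f} {η} even (suc k) v = trans
  (cong₂ (λ p q → c * w v + b * (w (v ℤ.- d) + w (v ℤ.+ d)) + (c * w (ℤ.- v) + b * (w p + w q)))
    (sym (ℤ.neg-distrib-+ v d))
    (trans (cong (ℤ._+_ (ℤ.- v)) (sym (ℤ.neg-involutive d))) (sym (ℤ.neg-distrib-+ v (ℤ.- d)))))
  (trans (eq₁ c b (w v) (w (ℤ.- v)) (w (v ℤ.- d)) (w (ℤ.- (v ℤ.- d))) (w (v ℤ.+ d))
    (w (ℤ.- (v ℤ.+ d))))
    (trans (cong₂ (λ p q → c * p + b * q) (walk-even c b d r even k v)
              (cong₂ _+_ (walk-even c b d r even k (v ℤ.- d)) (walk-even c b d r even k (v ℤ.+ d))))
      (eq₂ c b r (walk c b d k η v) (walk c b d k η (v ℤ.- d)) (walk c b d k η (v ℤ.+ d)))))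
  where
  w = walk c b d k f
  eq₁ : ∀ c b p p′ q q′ r r′ → c * p + b * (q + r) + (c * p′ + b * (r′ + q′))
                             ≡ c * (p + p′) + b * (q + q′ + (r + r′))
  eq₁ = solve-∀ ring
  eq₂ : ∀ c b r p q s → c * (r * p) + b * (r * q + r * s) ≡ r * (c * p + b * (q + s))
  eq₂ = solve-∀ ring

-- Noise stability

2ℚ 4ℚ 8ℚ : ℚ
2ℚ = ℤ.+ 2 / 1
4ℚ = ℤ.+ 4 / 1
8ℚ = ℤ.+ 8 / 1

infix 4 _≟ᵥ_

_≟ᵥ_ : (u x : Vec Sign n) → Dec (u ≡ x)
_≟ᵥ_ = Vec.≡-dec Sign._≟_

δ : Vec Sign n → Vec Sign n → ℚ
δ u x = ⟪ does (u ≟ᵥ x) ⟫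

pairs : List (Sign × Sign)
pairs = cartesianProduct signs signs

-- DSBS ρ for a = (1 + ρ)/4 and b = (1 - ρ)/4.
dsbs : ℚ → ℚ → Sign × Sign → ℚ
dsbs a b (x , y) = if does (x Sign.≟ y) then a else b

D : Vec Sign n → Vec Sign n → ℚ
D u x = δ u x + - 1ℚ * δ (neg u) x

D-neg : ∀ (u x : Vec Sign n) → D u (neg x) ≡ - D u x
D-neg u x = trans (cong₂ (λ p q → p + - 1ℚ * q) (flip u x) (trans (sym (flip u (neg x)))
    (cong (δ u) (neg-involutive x)))) (eq (δ (neg u) x) (δ u x))
  where
  flip : ∀ {n} (u x : Vec Sign n) → δ u (neg x) ≡ δ (neg u) x
  flip []      []      = refl
  flip (s ∷ u) (t ∷ x) with s | t | flip u x
  ... | Sign.- | Sign.- | _ = refl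
  ... | Sign.+ | Sign.+ | _ = refl
  ... | Sign.- | Sign.+ | h = h
  ... | Sign.+ | Sign.- | h = h
  eq : ∀ p q → p + - 1ℚ * q ≡ - (q + - 1ℚ * p)
  eq = solve-∀ ring

module _ (a b : ℚ) where

  ⟨_,_⟩ : (Vec Sign n → ℚ) → (Vec Sign n → ℚ) → ℚ
  ⟨_,_⟩ {n} f g = E pairs (dsbs a b) n λ z → f (Vec.map proj₁ z) * g (Vec.map proj₂ z)

  ⟨⟩-sym : ∀ n (f g : Vec Sign n → ℚ) → ⟨ f , g ⟩ ≡ ⟨ g , f ⟩
  ⟨⟩-sym zero    f g = ℚ.*-comm (f []) (g [])
  ⟨⟩-sym (suc n) f g = trans
    (cong₂ _+_ (cong (a *_) (swap _ _)) (cong₂ _+_ (cong (b *_) (swap _ _))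
      (cong₂ _+_ (cong (b *_) (swap _ _)) (cong (λ z → a * z + 0ℚ) (swap _ _)))))
    (eq (a * ⟨ g ∘ (Sign.- ∷_) , f ∘ (Sign.- ∷_) ⟩) (b * ⟨ g ∘ (Sign.+ ∷_) , f ∘ (Sign.- ∷_) ⟩)
        (b * ⟨ g ∘ (Sign.- ∷_) , f ∘ (Sign.+ ∷_) ⟩) _)
    where
    swap : ∀ x y → ⟨ f ∘ (x ∷_) , g ∘ (y ∷_) ⟩ ≡ ⟨ g ∘ (y ∷_) , f ∘ (x ∷_) ⟩
    swap x y = ⟨⟩-sym n (f ∘ (x ∷_)) (g ∘ (y ∷_))
    eq : ∀ p q r s → p + (q + (r + s)) ≡ p + (r + (q + s))
    eq = solve-∀ ring

  -- 2⁻ⁿ times the noise operator T_ρ.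
  T : Vec Sign n → (Vec Sign n → ℚ) → ℚ
  T []      f = f []
  T (s ∷ u) f = a * T u (f ∘ (s ∷_)) + b * T u (f ∘ (opposite s ∷_))

  ⟨δ,⟩ : ∀ (u : Vec Sign n) f → ⟨ δ u , f ⟩ ≡ T u f
  ⟨δ,⟩ []      f = ℚ.*-identityˡ (f [])
  ⟨δ,⟩ {suc n} (s ∷ u) f = split s
    where
    off : ∀ y → E pairs (dsbs a b) n (λ z → 0ℚ * f (y ∷ Vec.map proj₂ z)) ≡ 0ℚ
    off y = E-zero pairs (dsbs a b) n λ z → ℚ.*-zeroˡ (f (y ∷ Vec.map proj₂ z))
    on : ∀ y → ⟨ δ u , f ∘ (y ∷_) ⟩ ≡ T u (f ∘ (y ∷_))
    on y = ⟨δ,⟩ u (f ∘ (y ∷_))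
    split : ∀ s → ⟨ δ (s ∷ u) , f ⟩ ≡ T (s ∷ u) f
    split Sign.- = trans
      (cong₂ _+_ (cong (a *_) (on Sign.-)) (cong₂ _+_ (cong (b *_) (on Sign.+))
        (cong₂ _+_ (cong (b *_) (off Sign.-)) (cong (λ z → a * z + 0ℚ) (off Sign.+)))))
      (eq a b _ _)
      where
      eq : ∀ a b p q → a * p + (b * q + (b * 0ℚ + (a * 0ℚ + 0ℚ))) ≡ a * p + b * q
      eq = solve-∀ ring
    split Sign.+ = trans
      (cong₂ _+_ (cong (a *_) (off Sign.-)) (cong₂ _+_ (cong (b *_) (off Sign.+))
        (cong₂ _+_ (cong (b *_) (on Sign.-)) (cong (λ z → a * z + 0ℚ) (on Sign.+)))))
      (eq a b _ _)
      where
      eq : ∀ a b p q → a * 0ℚ + (b * 0ℚ + (b * p + (a * q + 0ℚ))) ≡ a * q + b * p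
      eq = solve-∀ ring

  T-cong : ∀ (u : Vec Sign n) {f g : Vec Sign n → ℚ} → (∀ x → f x ≡ g x) → T u f ≡ T u g
  T-cong []      f≗g = f≗g []
  T-cong (s ∷ u) f≗g = cong₂ (λ p q → a * p + b * q)
    (T-cong u λ x → f≗g (s ∷ x)) (T-cong u λ x → f≗g (opposite s ∷ x))

  T-linear : ∀ (u : Vec Sign n) r f g → T u (λ x → f x + r * g x) ≡ T u f + r * T u g
  T-linear []      r f g = refl
  T-linear (s ∷ u) r f g = trans
    (cong₂ (λ p q → a * p + b * q) (T-linear u r _ _) (T-linear u r _ _)) (eq a b r _ _ _ _)
    where
    eq : ∀ a b t p q r s → a * (p + t * q) + b * (r + t * s) ≡ a * p + b * r + t * (a * q + b * s)
    eq = solve-∀ ring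

  T-zero : ∀ (u : Vec Sign n) → T u (λ _ → 0ℚ) ≡ 0ℚ
  T-zero []      = refl
  T-zero (s ∷ u) = trans (cong₂ (λ p q → a * p + b * q) (T-zero u) (T-zero u)) (eq a b)
    where
    eq : ∀ a b → a * 0ℚ + b * 0ℚ ≡ 0ℚ
    eq = solve-∀ ring

  T-neg : ∀ (u : Vec Sign n) {f} → (∀ x → f (neg x) ≡ - f x) → T (neg u) f ≡ - T u f
  T-neg u {f} odd = trans (flip u f)
    (trans (T-cong u λ x → trans (odd x) (eq (f x)))
    (trans (T-linear u (- 1ℚ) (λ _ → 0ℚ) f)
    (trans (cong (_+ - 1ℚ * T u f) (T-zero u)) (sym (eq (T u f))))))
    where
    flip : ∀ {n} (u : Vec Sign n) f → T (neg u) f ≡ T u (f ∘ neg)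
    flip []      f = refl
    flip (s ∷ u) f = cong₂ (λ p q → a * p + b * q) (flip u _) (flip u _)
    eq : ∀ p → - p ≡ 0ℚ + - 1ℚ * p
    eq = solve-∀ ring

  T-δ : ∀ (u : Vec Sign n) → T u (δ u) ≡ a ^ n
  T-δ-neg : ∀ (u : Vec Sign n) → T u (δ (neg u)) ≡ b ^ n

  private
    first : ∀ a b p → a * p + b * 0ℚ ≡ a * p
    first = solve-∀ ring

    second : ∀ a b p → a * 0ℚ + b * p ≡ b * p
    second = solve-∀ ring

  T-δ []           = refl
  T-δ (Sign.- ∷ u) = trans (cong₂ (λ p q → a * p + b * q) (T-δ u) (T-zero u)) (first a b _)
  T-δ (Sign.+ ∷ u) = trans (cong₂ (λ p q → a * p + b * q) (T-δ u) (T-zero u)) (first a b _)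

  T-δ-neg []           = refl
  T-δ-neg (Sign.- ∷ u) = trans (cong₂ (λ p q → a * p + b * q) (T-zero u) (T-δ-neg u)) (second a b _)
  T-δ-neg (Sign.+ ∷ u) = trans (cong₂ (λ p q → a * p + b * q) (T-zero u) (T-δ-neg u)) (second a b _)

  ⟨⟩-linear : ∀ r (f g k : Vec Sign n → ℚ) → ⟨ (λ x → f x + r * g x) , k ⟩
    ≡ ⟨ f , k ⟩ + r * ⟨ g , k ⟩
  ⟨⟩-linear {n} r f g k = trans
    (E-cong pairs (dsbs a b) n λ z → eq (f (x z)) r (g (x z)) (k (y z)))
    (trans (E-+ pairs (dsbs a b) n (λ z → f (x z) * k (y z)) λ z → r * (g (x z) * k (y z)))
           (cong (⟨ f , k ⟩ +_) (E-* pairs (dsbs a b) n r λ z → g (x z) * k (y z))))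
    where
    x y : Vec (Sign × Sign) n → Vec Sign n
    x = Vec.map proj₁
    y = Vec.map proj₂
    eq : ∀ p r q k → (p + r * q) * k ≡ p * k + r * (q * k)
    eq = solve-∀ ring

  ⟨D,⟩ : ∀ (u : Vec Sign n) {f} → (∀ x → f (neg x) ≡ - f x) → ⟨ D u , f ⟩ ≡ 2ℚ * T u f
  ⟨D,⟩ u {f} odd = trans (⟨⟩-linear (- 1ℚ) (δ u) (δ (neg u)) f)
    (trans (cong₂ (λ p q → p + - 1ℚ * q) (⟨δ,⟩ u f) (trans (⟨δ,⟩ (neg u) f) (T-neg u odd)))
           (eq (T u f)))
    where
    eq : ∀ p → p + - 1ℚ * (- p) ≡ 2ℚ * p
    eq = solve-∀ ring

  -- Bilinearity gives ⟨f, f⟩ + 4 ⟨D, f⟩ + 4 ⟨D, D⟩. Against an odd function, `D u` pairs to twice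
  -- `T u`; applied to `D u` itself this gives 2 (aⁿ - bⁿ), since u agrees with itself in every
  -- coordinate and with its negation in none.
  ⟨⟩-perturb : ∀ (u : Vec Sign n) {f g} → (∀ x → f (neg x) ≡ - f x) →
               (∀ x → g x ≡ f x + 2ℚ * D u x) →
               ⟨ g , g ⟩ ≡ ⟨ f , f ⟩ + 8ℚ * (T u f + (a ^ n - b ^ n))
  ⟨⟩-perturb {n} u {f} {g} odd g≡ = trans (expand g)
    (trans (cong₂ (λ p q → p + 2ℚ * q) (trans (⟨⟩-sym n f g) (expand f)) (⟨D,⟩ u g-odd))
    (trans (cong₂ (λ p q → ⟨ f , f ⟩ + 2ℚ * p + 2ℚ * (2ℚ * q)) (⟨D,⟩ u odd) T-g)
           (eq ⟨ f , f ⟩ (T u f) (a ^ n) (b ^ n))))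
    where
    expand : ∀ k → ⟨ g , k ⟩ ≡ ⟨ f , k ⟩ + 2ℚ * ⟨ D u , k ⟩
    expand k = trans (E-cong pairs (dsbs a b) n λ z → cong (_* k (Vec.map proj₂ z))
      (g≡ (Vec.map proj₁ z)))
      (⟨⟩-linear 2ℚ f (D u) k)
    eq-odd : ∀ p q → - p + 2ℚ * (- q) ≡ - (p + 2ℚ * q)
    eq-odd = solve-∀ ring
    g-odd : ∀ x → g (neg x) ≡ - g x
    g-odd x = trans (g≡ (neg x)) (trans (cong₂ (λ p q → p + 2ℚ * q) (odd x) (D-neg u x))
      (trans (eq-odd (f x) (D u x)) (cong -_ (sym (g≡ x)))))
    T-g : T u g ≡ T u f + 2ℚ * (a ^ n + - 1ℚ * b ^ n)
    T-g = trans (T-cong u g≡) (trans (T-linear u 2ℚ f (D u))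
      (cong (λ z → T u f + 2ℚ * z) (trans (T-linear u (- 1ℚ) (δ u) (δ (neg u)))
        (cong₂ (λ p q → p + - 1ℚ * q) (T-δ u) (T-δ-neg u)))))
    eq : ∀ s t p q → s + 2ℚ * (2ℚ * t) + 2ℚ * (2ℚ * (t + 2ℚ * (p + - 1ℚ * q)))
      ≡ s + 8ℚ * (t + (p - q))
    eq = solve-∀ ring

T-total : ∀ a b s (u : Vec Sign n) (φ : ℤ → ℚ) v →
          T a b (s ∷ u) (λ x → φ (v ℤ.+ total x))
          ≡ a * T a b u (λ x → φ (v ℤ.+ toℤ s ℤ.+ total x))
            + b * T a b u (λ x → φ (v ℤ.+ toℤ (opposite s) ℤ.+ total x))
T-total a b s u φ v = cong₂ (λ p q → a * p + b * q)
  (T-cong a b u λ x → cong φ (sym (ℤ.+-assoc v (toℤ s) (total x))))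
  (T-cong a b u λ x → cong φ (sym (ℤ.+-assoc v (toℤ (opposite s)) (total x))))

-- In a pair (-, +), keeping both signs or flipping both preserves the sum, with weight a² + b².
-- Flipping exactly one changes it by 2 in one direction or the other, each with weight ab, so the
-- walk has step 2. The last, unpaired minus becomes the terminal function.
T-alt : ∀ a b k (φ : ℤ → ℚ) v → T a b (alt Sign.- (suc (k ℕ.* 2))) (λ x → φ (v ℤ.+ total x))
        ≡ walk (a * a + b * b) (a * b) (ℤ.+ 2) k
               (λ v → a * φ (v ℤ.+ -1ℤ) + b * φ (v ℤ.+ 1ℤ)) v
T-alt a b zero    φ v = refl
T-alt a b (suc k) φ v = trans (T-total a b Sign.- (Sign.+ ∷ rest) φ v)
  (trans (cong₂ (λ p q → a * p + b * q) (T-total a b Sign.+ rest φ (v ℤ.+ -1ℤ))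
    (T-total a b Sign.+ rest φ (v ℤ.+ 1ℤ)))
  (trans (cong₂ (λ p q → a * (a * τ p + b * τ (v ℤ.+ -1ℤ ℤ.+ -1ℤ))
    + b * (a * τ (v ℤ.+ 1ℤ ℤ.+ 1ℤ) + b * τ q)) (v-1+1 v) (v+1-1 v))
  (trans (cong₂ (λ p q → a * (a * τ v + b * τ p) + b * (a * τ q + b * τ v)) (ℤ.+-assoc v -1ℤ -1ℤ)
    (ℤ.+-assoc v 1ℤ 1ℤ))
  (trans (eq a b (τ v) (τ (v ℤ.- ℤ.+ 2)) (τ (v ℤ.+ ℤ.+ 2)))
    (cong₂ (λ p q → (a * a + b * b) * p + a * b * q) (T-alt a b k φ v)
      (cong₂ _+_ (T-alt a b k φ (v ℤ.- ℤ.+ 2)) (T-alt a b k φ (v ℤ.+ ℤ.+ 2))))))))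
  where
  rest = alt Sign.- (suc (k ℕ.* 2))
  τ : ℤ → ℚ
  τ v = T a b rest (λ x → φ (v ℤ.+ total x))
  eq : ∀ a b p q r → a * (a * p + b * q) + b * (a * r + b * p)
    ≡ (a * a + b * b) * p + a * b * (q + r)
  eq = solve-∀ ring

-- What remains of the unpaired coordinate after symmetrising in v and extracting the factor -(a -
-- b). It is 1 at 0, 1/2 at ±1 and 0 elsewhere, so on the even integers, which a walk from 0 with
-- step 2 never leaves, it is the indicator of 0.
bump : ℤ → ℚ
bump v = ½ * (sgn (v ℤ.+ 1ℤ) - sgn (v ℤ.+ -1ℤ))

bump-nonNeg : ∀ v → 0ℚ ≤ bump v
bump-nonNeg v = *-nonNeg 0≤½ (≤⇒0≤ (step v))
  where
  -1≤sgn : ∀ v → - 1ℚ ≤ sgn v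
  -1≤sgn (ℤ.+ zero)  = ℚ.nonPositive⁻¹ (- 1ℚ)
  -1≤sgn (ℤ.+ suc _) = ℚ.≤-trans (ℚ.nonPositive⁻¹ (- 1ℚ)) 0≤1
  -1≤sgn ℤ.-[1+ _ ]  = ℚ.≤-refl
  sgn≤1 : ∀ v → sgn v ≤ 1ℚ
  sgn≤1 (ℤ.+ zero)  = 0≤1
  sgn≤1 (ℤ.+ suc _) = ℚ.≤-refl
  sgn≤1 ℤ.-[1+ _ ]  = ℚ.≤-trans (ℚ.nonPositive⁻¹ (- 1ℚ)) 0≤1
  step : ∀ v → sgn (v ℤ.+ -1ℤ) ≤ sgn (v ℤ.+ 1ℤ)
  step (ℤ.+ v)    = ℚ.≤-trans (sgn≤1 (ℤ.+ v ℤ.+ -1ℤ))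
    (ℚ.≤-reflexive (cong (λ n → sgn (ℤ.+ n)) (ℕ.+-comm 1 v)))
  step ℤ.-[1+ v ] = -1≤sgn (ℤ.-[1+ v ] ℤ.+ 1ℤ)

T-maj : ∀ a b k → T a b (alt Sign.- (suc (k ℕ.* 2))) (λ x → sgn (total x))
        ≡ - ((a - b) * walk (a * a + b * b) (a * b) (ℤ.+ 2) k bump 0ℤ)
-- `walk-even` adds the values at v and -v; at v = 0 these coincide, so it computes the double.
T-maj a b k = halve (trans
  (cong (λ z → z + z) (trans (T-cong a b (alt Sign.- (suc (k ℕ.* 2))) λ x → cong sgn
    (sym (ℤ.+-identityˡ (total x))))
    (T-alt a b k sgn 0ℤ)))
  (walk-even (a * a + b * b) (a * b) (ℤ.+ 2) (- (a - b) * 2ℚ) even k 0ℤ))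
  where
  halve : ∀ {t w} → t + t ≡ - (a - b) * 2ℚ * w → t ≡ - ((a - b) * w)
  halve {t} {w} t+t≡ = trans (eq₁ t) (trans (cong (½ *_) t+t≡) (eq₂ a b w))
    where
    eq₁ : ∀ t → t ≡ ½ * (t + t)
    eq₁ = solve-∀ ring
    eq₂ : ∀ a b w → ½ * (- (a - b) * 2ℚ * w) ≡ - ((a - b) * w)
    eq₂ = solve-∀ ring
  even : ∀ v → a * sgn (v ℤ.+ -1ℤ) + b * sgn (v ℤ.+ 1ℤ)
             + (a * sgn (ℤ.- v ℤ.+ -1ℤ) + b * sgn (ℤ.- v ℤ.+ 1ℤ)) ≡ - (a - b) * 2ℚ * bump v
  even v = trans (cong₂ (λ p q → a * sgn (v ℤ.+ -1ℤ) + b * sgn (v ℤ.+ 1ℤ) + (a * p + b * q))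
      (trans (cong sgn (sym (ℤ.neg-distrib-+ v 1ℤ))) (sgn-odd (v ℤ.+ 1ℤ)))
      (trans (cong sgn (sym (ℤ.neg-distrib-+ v -1ℤ))) (sgn-odd (v ℤ.+ -1ℤ))))
    (eq a b (sgn (v ℤ.+ -1ℤ)) (sgn (v ℤ.+ 1ℤ)))
    where
    eq : ∀ a b p q → a * p + b * q + (a * - q + b * - p) ≡ - (a - b) * 2ℚ * (½ * (q - p))
    eq = solve-∀ ring

-- Erasures

cells : List (Sign × Maybe Sign)
cells = cartesianProduct signs symbols

-- SBES p for a = (1 - p)/2 and b = p/2; obs is the law of the received symbol.
sbes : ℚ → ℚ → Sign × Maybe Sign → ℚ
sbes a b (x , just y)  = if does (x Sign.≟ y) then b else 0ℚ
sbes a b (x , nothing) = a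

obs : ℚ → ℚ → Maybe Sign → ℚ
obs a b (just _) = b
obs a b nothing  = a + a

-- E[f(x) | y]
cond : Vec (Maybe Sign) n → (Vec Sign n → ℚ) → ℚ
cond []            f = f []
cond (just s ∷ y)  f = cond y (f ∘ (s ∷_))
cond (nothing ∷ y) f = ½ * (cond y (f ∘ (Sign.- ∷_)) + cond y (f ∘ (Sign.+ ∷_)))

cond-cong : ∀ (y : Vec (Maybe Sign) n) {f g} → (∀ x → f x ≡ g x) → cond y f ≡ cond y g
cond-cong []            f≗g = f≗g []
cond-cong (just s ∷ y)  f≗g = cond-cong y (f≗g ∘ (s ∷_))
cond-cong (nothing ∷ y) f≗g = cong₂ (λ p q → ½ * (p + q))
  (cond-cong y (f≗g ∘ (Sign.- ∷_))) (cond-cong y (f≗g ∘ (Sign.+ ∷_)))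

cond-linear : ∀ (y : Vec (Maybe Sign) n) r f g → cond y (λ x → f x + r * g x)
  ≡ cond y f + r * cond y g
cond-linear []            r f g = refl
cond-linear (just s ∷ y)  r f g = cond-linear y r (f ∘ (s ∷_)) (g ∘ (s ∷_))
cond-linear (nothing ∷ y) r f g = trans
  (cong₂ (λ p q → ½ * (p + q)) (side Sign.-) (side Sign.+))
    (eq r (cond y _) (cond y _) (cond y _) (cond y _))
  where
  side : ∀ s → cond y (λ x → f (s ∷ x) + r * g (s ∷ x))
    ≡ cond y (f ∘ (s ∷_)) + r * cond y (g ∘ (s ∷_))
  side s = cond-linear y r (f ∘ (s ∷_)) (g ∘ (s ∷_))
  eq : ∀ r p q s t → ½ * (p + r * q + (s + r * t)) ≡ ½ * (p + s) + r * (½ * (q + t))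
  eq = solve-∀ ring

cond-const : ∀ (y : Vec (Maybe Sign) n) r → cond y (λ _ → r) ≡ r
cond-const []            r = refl
cond-const (just s ∷ y)  r = cond-const y r
cond-const (nothing ∷ y) r = trans (cong₂ (λ p q → ½ * (p + q)) (cond-const y r) (cond-const y r))
  (eq r)
  where
  eq : ∀ r → ½ * (r + r) ≡ r
  eq = solve-∀ ring

cond-nonNeg : ∀ (y : Vec (Maybe Sign) n) {f} → (∀ x → 0ℚ ≤ f x) → 0ℚ ≤ cond y f
cond-nonNeg []            0≤f = 0≤f []
cond-nonNeg (just s ∷ y)  0≤f = cond-nonNeg y (0≤f ∘ (s ∷_))
cond-nonNeg (nothing ∷ y) 0≤f = *-nonNeg 0≤½
  (+-nonNeg (cond-nonNeg y (0≤f ∘ (Sign.- ∷_))) (cond-nonNeg y (0≤f ∘ (Sign.+ ∷_))))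

cond-just : ∀ (u : Vec Sign n) f → cond (Vec.map just u) f ≡ f u
cond-just []      f = refl
cond-just (s ∷ u) f = cond-just u (f ∘ (s ∷_))

stars : ∀ n → Vec (Maybe Sign) n
stars n = Vec.replicate n nothing

cond-stars-δ : ∀ (u : Vec Sign n) → cond (stars n) (δ u) ≡ ½ ^ n
cond-stars-δ []           = refl
cond-stars-δ {suc n} (Sign.- ∷ u) = cong (½ *_)
  (trans (cong₂ _+_ (cond-stars-δ u) (cond-const (stars n) 0ℚ)) (ℚ.+-identityʳ (½ ^ n)))
cond-stars-δ {suc n} (Sign.+ ∷ u) = cong (½ *_)
  (trans (cong₂ _+_ (cond-const (stars n) 0ℚ) (cond-stars-δ u)) (ℚ.+-identityˡ (½ ^ n)))

⟪⟫-nonNeg : ∀ p → 0ℚ ≤ ⟪ p ⟫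
⟪⟫-nonNeg true  = 0≤1
⟪⟫-nonNeg false = ℚ.≤-refl

⟪yes⟫ : ∀ {P : Set} (P? : Dec P) → P → ⟪ does P? ⟫ ≡ 1ℚ
⟪yes⟫ (yes _) _ = refl
⟪yes⟫ (no ¬p) p = contradiction p ¬p

-- Since u and -u differ in every coordinate, a single revealed coordinate already excludes one of
-- them.
δ-disjoint : ∀ (u : Vec Sign n) y →
             y ≡ stars n ⊎ (cond y (δ u) ≡ 0ℚ ⊎ cond y (δ (neg u)) ≡ 0ℚ)
δ-disjoint []      []            = inj₁ refl
δ-disjoint (s ∷ u) (nothing ∷ y) with δ-disjoint u y
... | inj₁ refl = inj₁ refl
... | inj₂ zeros = inj₂ (half s zeros)
  where
  ½0 : ∀ {p q} → p ≡ 0ℚ → q ≡ 0ℚ → ½ * (p + q) ≡ 0ℚ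
  ½0 refl refl = refl
  half : ∀ s → cond y (δ u) ≡ 0ℚ ⊎ cond y (δ (neg u)) ≡ 0ℚ →
         cond (nothing ∷ y) (δ (s ∷ u)) ≡ 0ℚ ⊎ cond (nothing ∷ y) (δ (neg (s ∷ u))) ≡ 0ℚ
  half Sign.- (inj₁ p) = inj₁ (½0 p (cond-const y 0ℚ))
  half Sign.- (inj₂ p) = inj₂ (½0 (cond-const y 0ℚ) p)
  half Sign.+ (inj₁ p) = inj₁ (½0 (cond-const y 0ℚ) p)
  half Sign.+ (inj₂ p) = inj₂ (½0 p (cond-const y 0ℚ))
δ-disjoint (Sign.- ∷ u) (just Sign.- ∷ y) = inj₂ (inj₂ (cond-const y 0ℚ))
δ-disjoint (Sign.- ∷ u) (just Sign.+ ∷ y) = inj₂ (inj₁ (cond-const y 0ℚ))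
δ-disjoint (Sign.+ ∷ u) (just Sign.- ∷ y) = inj₂ (inj₁ (cond-const y 0ℚ))
δ-disjoint (Sign.+ ∷ u) (just Sign.+ ∷ y) = inj₂ (inj₂ (cond-const y 0ℚ))

shown : Vec (Maybe Sign) n → ℤ
shown []            = 0ℤ
shown (just s ∷ y)  = toℤ s ℤ.+ shown y
shown (nothing ∷ y) = shown y

shown-just : ∀ (u : Vec Sign n) → shown (Vec.map just u) ≡ total u
shown-just []      = refl
shown-just (s ∷ u) = cong (ℤ._+_ (toℤ s)) (shown-just u)

shown-stars : ∀ n → shown (stars n) ≡ 0ℤ
shown-stars zero    = refl
shown-stars (suc n) = shown-stars n

record SignLike (r : ℤ → ℚ) : Set where
  field
    odd : ∀ v → r (ℤ.- v) ≡ - r v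
    pos : ∀ n → 0ℚ ≤ r (ℤ.+ n)

open SignLike

-- Averaging over neighbours keeps a function sign-like: at 0 the average
-- vanishes by oddness, and at n ≥ 1 both neighbours are nonnegative.
cond-total : ∀ (y : Vec (Maybe Sign) n) {φ} → SignLike φ →
          Σ (ℤ → ℚ) λ r → SignLike r × (∀ v → cond y (λ x → φ (v ℤ.+ total x)) ≡ r (v ℤ.+ shown y))
cond-total []            {φ} sl = φ , sl , λ v → refl
cond-total (just s ∷ y)  {φ} sl with cond-total y sl
... | r , r-sl , eq = r , r-sl , λ v → trans
  (cond-cong y λ x → cong φ (sym (ℤ.+-assoc v (toℤ s) (total x))))
  (trans (eq (v ℤ.+ toℤ s)) (cong r (ℤ.+-assoc v (toℤ s) (shown y))))
cond-total (nothing ∷ y) {φ} sl with cond-total y sl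
... | r , r-sl , eq = avg , record { odd = avg-odd ; pos = avg-pos } , λ v →
  cong₂ (λ p q → ½ * (p + q)) (side v -1ℤ) (side v 1ℤ)
  where
  avg : ℤ → ℚ
  avg w = ½ * (r (w ℤ.+ -1ℤ) + r (w ℤ.+ 1ℤ))
  side : ∀ v d → cond y (λ x → φ (v ℤ.+ (d ℤ.+ total x))) ≡ r (v ℤ.+ shown y ℤ.+ d)
  side v d = trans (cond-cong y λ x → cong φ (sym (ℤ.+-assoc v d (total x))))
    (trans (eq (v ℤ.+ d)) (cong r (trans (ℤ.+-assoc v d (shown y))
      (trans (cong (ℤ._+_ v) (ℤ.+-comm d (shown y))) (sym (ℤ.+-assoc v (shown y) d))))))
  eq-odd : ∀ p q → ½ * (- q + - p) ≡ - (½ * (p + q))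
  eq-odd = solve-∀ ring
  avg-odd : ∀ v → avg (ℤ.- v) ≡ - avg v
  avg-odd v = trans (cong₂ (λ p q → ½ * (p + q))
      (trans (cong r (sym (ℤ.neg-distrib-+ v 1ℤ))) (odd r-sl (v ℤ.+ 1ℤ)))
      (trans (cong r (sym (ℤ.neg-distrib-+ v -1ℤ))) (odd r-sl (v ℤ.+ -1ℤ))))
    (eq-odd (r (v ℤ.+ -1ℤ)) (r (v ℤ.+ 1ℤ)))
  avg-pos : ∀ n → 0ℚ ≤ avg (ℤ.+ n)
  avg-pos zero    = ℚ.≤-reflexive (sym (trans (cong (λ z → ½ * (z + r 1ℤ)) (odd r-sl 1ℤ))
    (eq₀ (r 1ℤ))))
    where
    eq₀ : ∀ p → ½ * (- p + p) ≡ 0ℚ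
    eq₀ = solve-∀ ring
  avg-pos (suc n) = *-nonNeg 0≤½ (+-nonNeg (pos r-sl n) (pos r-sl (suc n ℕ.+ 1)))

sgn-signLike : SignLike sgn
sgn-signLike = record { odd = sgn-odd ; pos = λ { zero → ℚ.≤-refl ; (suc _) → 0≤1 } }

maj : Vec Sign n → ℚ
maj x = sgn (total x)

cond-maj≥0 : ∀ (y : Vec (Maybe Sign) n) k → shown y ≡ ℤ.+ k → 0ℚ ≤ cond y maj
cond-maj≥0 y k S≡k with cond-total y sgn-signLike
... | r , r-sl , eq = subst (0ℚ ≤_) (sym (trans
  (cond-cong y λ x → cong sgn (sym (ℤ.+-identityˡ (total x))))
    (trans (eq 0ℤ) (cong r (trans (ℤ.+-identityˡ (shown y)) S≡k))))) (pos r-sl k)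

cond-maj≤0 : ∀ (y : Vec (Maybe Sign) n) k → ℤ.- shown y ≡ ℤ.+ k → 0ℚ ≤ - cond y maj
cond-maj≤0 y k S≡k with cond-total y sgn-signLike
... | r , r-sl , eq = subst (0ℚ ≤_) (sym (trans
  (cong -_ (trans (cond-cong y λ x → cong sgn (sym (ℤ.+-identityˡ (total x))))
    (trans (eq 0ℤ) (cong r (ℤ.+-identityˡ (shown y))))))
    (trans (sym (odd r-sl (shown y))) (cong r S≡k)))) (pos r-sl k)

-- Here 0 goes to 1: if the revealed signs sum to 0 then E[Maj | y] = 0, and a shift in either
-- direction increases the absolute value in full. This asymmetry of `χ` at 0 is what leaves a
-- positive net weight in `U-χ`.
χ : ℤ → ℚ
χ (ℤ.+ _)    = 1ℚ
χ ℤ.-[1+ _ ] = - 1ℚ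

-- If v ≥ 0 then x and the shift have the same sign and absolute values add. If v < 0, the triangle
-- inequality limits the loss to the size of the shift.
abs-shift : ∀ {x c} v → 0ℚ ≤ c → (∀ k → v ≡ ℤ.+ k → 0ℚ ≤ x) →
            ℚ.∣ x ∣ + 2ℚ * c * χ v ≤ ℚ.∣ x + 2ℚ * c ∣
abs-shift {x} {c} (ℤ.+ k) 0≤c 0≤x = ℚ.≤-reflexive (trans
  (cong₂ _+_ (ℚ.0≤p⇒∣p∣≡p (0≤x k refl)) (ℚ.*-identityʳ (2ℚ * c)))
  (sym (ℚ.0≤p⇒∣p∣≡p (+-nonNeg (0≤x k refl) (*-nonNeg (ℚ.nonNegative⁻¹ 2ℚ) 0≤c)))))
abs-shift {x} {c} ℤ.-[1+ k ] 0≤c _ = subst (ℚ.∣ x ∣ + 2ℚ * c * - 1ℚ ≤_) (eq₁ ℚ.∣ x + 2ℚ * c ∣ c)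
  (ℚ.+-monoˡ-≤ (2ℚ * c * - 1ℚ) (subst₂ _≤_ (cong ℚ.∣_∣ (eq₂ x c))
    (cong (ℚ.∣ x + 2ℚ * c ∣ +_)
      (trans (ℚ.∣-p∣≡∣p∣ (2ℚ * c)) (ℚ.0≤p⇒∣p∣≡p (*-nonNeg (ℚ.nonNegative⁻¹ 2ℚ) 0≤c))))
    (ℚ.∣p+q∣≤∣p∣+∣q∣ (x + 2ℚ * c) (- (2ℚ * c)))))
  where
  eq₁ : ∀ p c → p + 2ℚ * c + 2ℚ * c * - 1ℚ ≡ p
  eq₁ = solve-∀ ring
  eq₂ : ∀ x c → x + 2ℚ * c + - (2ℚ * c) ≡ x
  eq₂ = solve-∀ ring

Pr : ℚ → ℚ → Vec (Maybe Sign) n → ℚ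
Pr a b []      = 1ℚ
Pr a b (t ∷ y) = obs a b t * Pr a b y

Pr-stars : ∀ a b n → Pr a b (stars n) ≡ (a + a) ^ n
Pr-stars a b zero    = refl
Pr-stars a b (suc n) = cong ((a + a) *_) (Pr-stars a b n)

Pr-just : ∀ a b (u : Vec Sign n) → Pr a b (Vec.map just u) ≡ b ^ n
Pr-just a b []      = refl
Pr-just a b (s ∷ u) = cong (b *_) (Pr-just a b u)

-- The numerator of the elementary conditional expectation; with f = 1 it becomes the denominator,
-- so the quotient is `cond y f`.
E-cells-≟ : ∀ a b (y : Vec (Maybe Sign) n) f →
          E cells (sbes a b) n (λ z → f (Vec.map proj₁ z) * ⟪ does (Vec.map proj₂ z ≟ₘ y) ⟫)
          ≡ Pr a b y * cond y f
E-cells-≟ a b []      f = trans (ℚ.*-identityʳ (f [])) (sym (ℚ.*-identityˡ (f [])))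
E-cells-≟ {suc n} a b (t ∷ y) f = split t
  where
  off : ∀ x → E cells (sbes a b) n (λ z → f (x ∷ Vec.map proj₁ z) * 0ℚ) ≡ 0ℚ
  off x = E-zero cells (sbes a b) n λ z → ℚ.*-zeroʳ (f (x ∷ Vec.map proj₁ z))
  on : ∀ x → _ ≡ Pr a b y * cond y (f ∘ (x ∷_))
  on x = E-cells-≟ a b y (f ∘ (x ∷_))
  split : ∀ t → E cells (sbes a b) (suc n)
    (λ z → f (Vec.map proj₁ z) * ⟪ does (Vec.map proj₂ z ≟ₘ (t ∷ y)) ⟫)
                ≡ Pr a b (t ∷ y) * cond (t ∷ y) f
  split (just Sign.-) = trans
    (cong₂ _+_ (cong (b *_) (on Sign.-)) (cong₂ _+_ (cong (0ℚ *_) (off Sign.-))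
      (cong₂ _+_ (cong (a *_) (off Sign.-))
      (cong₂ _+_ (cong (0ℚ *_) (on Sign.+))
        (cong₂ _+_ (cong (b *_) (off Sign.+)) (cong (λ p → a * p + 0ℚ) (off Sign.+)))))))
    (eq a b (Pr a b y) (cond y (f ∘ (Sign.- ∷_))) (cond y (f ∘ (Sign.+ ∷_))))
    where
    eq : ∀ a b r p q → b * (r * p) + (0ℚ * 0ℚ
      + (a * 0ℚ + (0ℚ * (r * q) + (b * 0ℚ + (a * 0ℚ + 0ℚ))))) ≡ b * r * p
    eq = solve-∀ ring
  split (just Sign.+) = trans
    (cong₂ _+_ (cong (b *_) (off Sign.-))
      (cong₂ _+_ (cong (0ℚ *_) (on Sign.-)) (cong₂ _+_ (cong (a *_) (off Sign.-))
      (cong₂ _+_ (cong (0ℚ *_) (off Sign.+))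
        (cong₂ _+_ (cong (b *_) (on Sign.+)) (cong (λ p → a * p + 0ℚ) (off Sign.+)))))))
    (eq a b (Pr a b y) (cond y (f ∘ (Sign.- ∷_))) (cond y (f ∘ (Sign.+ ∷_))))
    where
    eq : ∀ a b r p q → b * 0ℚ + (0ℚ * (r * p)
      + (a * 0ℚ + (0ℚ * 0ℚ + (b * (r * q) + (a * 0ℚ + 0ℚ))))) ≡ b * r * q
    eq = solve-∀ ring
  split nothing = trans
    (cong₂ _+_ (cong (b *_) (off Sign.-))
      (cong₂ _+_ (cong (0ℚ *_) (off Sign.-)) (cong₂ _+_ (cong (a *_) (on Sign.-))
      (cong₂ _+_ (cong (0ℚ *_) (off Sign.+))
        (cong₂ _+_ (cong (b *_) (off Sign.+)) (cong (λ p → a * p + 0ℚ) (on Sign.+)))))))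
    (eq a b (Pr a b y) (cond y (f ∘ (Sign.- ∷_))) (cond y (f ∘ (Sign.+ ∷_))))
    where
    eq : ∀ a b r p q → b * 0ℚ + (0ℚ * 0ℚ +
      (a * (r * p) + (0ℚ * 0ℚ + (b * 0ℚ + (a * (r * q) + 0ℚ)))))
                     ≡ (a + a) * r * (½ * (p + q))
    eq = solve-∀ ring

-- Marginalising over the source merges the two cells with an erased symbol, which explains the mass
-- a + a in `obs`.
E-received : ∀ a b n (f : Vec (Maybe Sign) n → ℚ) →
             E cells (sbes a b) n (f ∘ Vec.map proj₂) ≡ E symbols (obs a b) n f
E-received a b zero    f = refl
E-received a b (suc n) f = trans
  (cong₂ _+_ (cong (b *_) (ih (just Sign.-)))
    (cong₂ _+_ (cong (0ℚ *_) (ih (just Sign.+))) (cong₂ _+_ (cong (a *_) (ih nothing))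
    (cong₂ _+_ (cong (0ℚ *_) (ih (just Sign.-)))
      (cong₂ _+_ (cong (b *_) (ih (just Sign.+))) (cong (λ p → a * p + 0ℚ) (ih nothing)))))))
  (eq a b (F (just Sign.-)) (F (just Sign.+)) (F nothing))
  where
  F : Maybe Sign → ℚ
  F t = E symbols (obs a b) n (f ∘ (t ∷_))
  ih : ∀ t → E cells (sbes a b) n (λ z → f (t ∷ Vec.map proj₂ z)) ≡ F t
  ih t = E-received a b n (f ∘ (t ∷_))
  eq : ∀ a b p q r → b * p + (0ℚ * q + (a * r + (0ℚ * p + (b * q + (a * r + 0ℚ)))))
                   ≡ b * p + (b * q + ((a + a) * r + 0ℚ))
  eq = solve-∀ ring

E-symbols-≟ : ∀ a b (y : Vec (Maybe Sign) n) → E symbols (obs a b) n (λ y′ → ⟪ does (y′ ≟ₘ y) ⟫)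
  ≡ Pr a b y
E-symbols-≟ {n} a b y = trans (sym (E-received a b n λ y′ → ⟪ does (y′ ≟ₘ y) ⟫))
  (trans (E-cong cells (sbes a b) n λ z → sym (ℚ.*-identityˡ ⟪ does (Vec.map proj₂ z ≟ₘ y) ⟫))
  (trans (E-cells-≟ a b y λ _ → 1ℚ) (trans (cong (Pr a b y *_) (cond-const y 1ℚ))
    (ℚ.*-identityʳ (Pr a b y)))))

-- The sum of φ (v + shown y) over the y consistent with u, where each revealed coordinate
-- weighs b and each erased one a.
U : ℚ → ℚ → Vec Sign n → (ℤ → ℚ) → ℤ → ℚ
U a b []      φ v = φ v
U a b (s ∷ u) φ v = b * U a b u φ (v ℤ.+ toℤ s) + a * U a b u φ v

-- At an erased coordinate the mass 2a meets the factor 1/2 from `cond`, which leaves a. At a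
-- revealed one only the symbol agreeing with u survives, with mass b.
E-shown : ∀ a b (u : Vec Sign n) φ v →
          E symbols (obs a b) n (λ y → cond y (δ u) * φ (v ℤ.+ shown y)) ≡ U a b u φ v
E-shown a b []      φ v = trans (ℚ.*-identityˡ _) (cong φ (ℤ.+-identityʳ v))
E-shown {suc n} a b (s ∷ u) φ v = split s
  where
  on : ∀ t → E symbols (obs a b) n (λ y → cond y (δ u) * φ (v ℤ.+ (toℤ t ℤ.+ shown y)))
    ≡ U a b u φ (v ℤ.+ toℤ t)
  on t = trans (E-cong symbols (obs a b) n λ y → cong (λ w → cond y (δ u) * φ w)
    (sym (ℤ.+-assoc v (toℤ t) (shown y))))
    (E-shown a b u φ (v ℤ.+ toℤ t))
  off : ∀ t → E symbols (obs a b) n (λ y → cond y (λ _ → 0ℚ) * φ (v ℤ.+ (toℤ t ℤ.+ shown y))) ≡ 0ℚ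
  off t = E-zero symbols (obs a b) n λ y →
    trans (cong (_* φ (v ℤ.+ (toℤ t ℤ.+ shown y))) (cond-const y 0ℚ))
    (ℚ.*-zeroˡ (φ (v ℤ.+ (toℤ t ℤ.+ shown y))))
  hidden : ∀ {k : Vec (Maybe Sign) n → ℚ} → (∀ y → k y ≡ ½ * (cond y (δ u) * φ (v ℤ.+ shown y))) →
           E symbols (obs a b) n k ≡ ½ * U a b u φ v
  hidden k≡ = trans (E-cong symbols (obs a b) n k≡)
    (trans (E-* symbols (obs a b) n ½ λ y → cond y (δ u) * φ (v ℤ.+ shown y))
      (cong (½ *_) (E-shown a b u φ v)))
  split : ∀ s → E symbols (obs a b) (suc n) (λ y → cond y (δ (s ∷ u)) * φ (v ℤ.+ shown y))
    ≡ U a b (s ∷ u) φ v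
  split Sign.- = trans
    (cong₂ _+_ (cong (b *_) (on Sign.-)) (cong₂ _+_ (cong (b *_) (off Sign.+))
      (cong (λ p → (a + a) * p + 0ℚ)
      (hidden λ y → trans (cong (λ z → ½ * (cond y (δ u) + z) * φ (v ℤ.+ shown y))
        (cond-const y 0ℚ))
        (eq′ (cond y (δ u)) (φ (v ℤ.+ shown y)))))))
    (eq a b (U a b u φ (v ℤ.+ toℤ Sign.-)) (U a b u φ v))
    where
    eq′ : ∀ p q → ½ * (p + 0ℚ) * q ≡ ½ * (p * q)
    eq′ = solve-∀ ring
    eq : ∀ a b p q → b * p + (b * 0ℚ + ((a + a) * (½ * q) + 0ℚ)) ≡ b * p + a * q
    eq = solve-∀ ring
  split Sign.+ = trans
    (cong₂ _+_ (cong (b *_) (off Sign.-))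
      (cong₂ _+_ (cong (b *_) (on Sign.+)) (cong (λ p → (a + a) * p + 0ℚ)
      (hidden λ y → trans (cong (λ z → ½ * (z + cond y (δ u)) * φ (v ℤ.+ shown y))
        (cond-const y 0ℚ))
        (eq′ (cond y (δ u)) (φ (v ℤ.+ shown y)))))))
    (eq a b (U a b u φ (v ℤ.+ toℤ Sign.+)) (U a b u φ v))
    where
    eq′ : ∀ p q → ½ * (0ℚ + p) * q ≡ ½ * (p * q)
    eq′ = solve-∀ ring
    eq : ∀ a b p q → b * 0ℚ + (b * p + ((a + a) * (½ * q) + 0ℚ)) ≡ b * p + a * q
    eq = solve-∀ ring

U-neg : ∀ a b (u : Vec Sign n) φ v → U a b (neg u) (φ ∘ ℤ.-_) v ≡ U a b u φ (ℤ.- v)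
U-neg a b []      φ v = refl
U-neg a b (s ∷ u) φ v = cong₂ (λ p q → b * p + a * q)
  (trans (U-neg a b u φ (v ℤ.+ toℤ (opposite s)))
    (cong (U a b u φ) (trans (ℤ.neg-distrib-+ v (toℤ (opposite s)))
      (cong (ℤ._+_ (ℤ.- v)) (trans (cong ℤ.-_ (toℤ-opposite s)) (ℤ.neg-involutive (toℤ s)))))))
  (U-neg a b u φ v)

-- In a pair (-, +), revealing both or neither adds 0 to the visible sum, with weight a² + b².
-- Revealing only one adds -1 or 1 with weight ab. The walk is that of `T-alt` with step 1 in place
-- of 2.
U-alt : ∀ a b k (φ : ℤ → ℚ) v → U a b (alt Sign.- (suc (k ℕ.* 2))) φ v
        ≡ walk (a * a + b * b) (a * b) 1ℤ k (λ v → b * φ (v ℤ.+ -1ℤ) + a * φ v) v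
U-alt a b zero    φ v = refl
U-alt a b (suc k) φ v = trans
  (cong (λ w → b * (b * υ w + a * υ (v ℤ.+ -1ℤ)) + a * (b * υ (v ℤ.+ 1ℤ) + a * υ v)) (v-1+1 v))
  (trans (eq a b (υ v) (υ (v ℤ.+ -1ℤ)) (υ (v ℤ.+ 1ℤ)))
    (cong₂ (λ p q → (a * a + b * b) * p + a * b * q) (U-alt a b k φ v)
      (cong₂ _+_ (U-alt a b k φ (v ℤ.- 1ℤ)) (U-alt a b k φ (v ℤ.+ 1ℤ)))))
  where
  υ : ℤ → ℚ
  υ = U a b (alt Sign.- (suc (k ℕ.* 2))) φ
  eq : ∀ a b p q r → b * (b * p + a * q) + a * (b * r + a * p)
    ≡ (a * a + b * b) * p + a * b * (q + r)
  eq = solve-∀ ring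

spike : ℤ → ℚ
spike (ℤ.+ zero)  = 1ℚ
spike (ℤ.+ suc _) = 0ℚ
spike ℤ.-[1+ _ ]  = 0ℚ

spike-nonNeg : ∀ v → 0ℚ ≤ spike v
spike-nonNeg (ℤ.+ zero)  = 0≤1
spike-nonNeg (ℤ.+ suc _) = ℚ.≤-refl
spike-nonNeg ℤ.-[1+ _ ]  = ℚ.≤-refl

-- Symmetrising the terminal function cancels every v except 0. There the erased unpaired coordinate
-- contributes a and the revealed one, which shifts the sum to -1, contributes -b; hence the factor
-- a - b.
U-χ : ∀ a b k → U a b (alt Sign.- (suc (k ℕ.* 2))) χ 0ℤ + U a b (alt Sign.- (suc (k ℕ.* 2))) χ 0ℤ
      ≡ (a - b) * 2ℚ * walk (a * a + b * b) (a * b) 1ℤ k spike 0ℤ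
U-χ a b k = trans (cong (λ z → z + z) (U-alt a b k χ 0ℤ))
  (walk-even (a * a + b * b) (a * b) 1ℤ ((a - b) * 2ℚ) even k 0ℤ)
  where
  zero-case : ∀ a b → b * - 1ℚ + a * 1ℚ + (b * - 1ℚ + a * 1ℚ) ≡ (a - b) * 2ℚ * 1ℚ
  zero-case = solve-∀ ring
  pos-case : ∀ a b → b * 1ℚ + a * 1ℚ + (b * - 1ℚ + a * - 1ℚ) ≡ (a - b) * 2ℚ * 0ℚ
  pos-case = solve-∀ ring
  neg-case : ∀ a b → b * - 1ℚ + a * - 1ℚ + (b * 1ℚ + a * 1ℚ) ≡ (a - b) * 2ℚ * 0ℚ
  neg-case = solve-∀ ring
  even : ∀ v → b * χ (v ℤ.+ -1ℤ) + a * χ v + (b * χ (ℤ.- v ℤ.+ -1ℤ) + a * χ (ℤ.- v))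
             ≡ (a - b) * 2ℚ * spike v
  even (ℤ.+ zero)  = zero-case a b
  even (ℤ.+ suc m) = pos-case a b
  even ℤ.-[1+ m ]  = neg-case a b

total-alt : ∀ k → total (alt Sign.- (suc (k ℕ.* 2))) ≡ -1ℤ
total-alt zero    = refl
total-alt (suc k) = trans (sym (ℤ.+-assoc -1ℤ 1ℤ rest)) (trans (ℤ.+-identityˡ rest) (total-alt k))
  where rest = total (alt Sign.- (suc (k ℕ.* 2)))

-- Pointwise comparison of the conditional expectations

module _ {k : ℕ} (u : Vec Sign (suc k)) (total-u : total u ≡ -1ℤ) {g : Vec Sign (suc k) → ℚ}
         (g≡ : ∀ x → g x ≡ maj x + 2ℚ * D u x) where

  private
    N = suc k

    c₊ c₋ : Vec (Maybe Sign) N → ℚ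
    c₊ y = cond y (δ u)
    c₋ y = cond y (δ (neg u))

    cond-g : ∀ y → cond y g ≡ cond y maj + 2ℚ * (c₊ y + - 1ℚ * c₋ y)
    cond-g y = trans (cond-cong y g≡) (trans (cond-linear y 2ℚ maj (D u))
      (cong (λ z → cond y maj + 2ℚ * z) (cond-linear y (- 1ℚ) (δ u) (δ (neg u)))))

    -- A lower bound for |E[g | y]| - |E[Maj | y]|.  It fails when nothing is revealed, as then
    -- c₊ = c₋ = 2⁻ⁿ, and loses 2 when all of ±u is revealed; correction repairs both.
    main : Vec (Maybe Sign) N → ℚ
    main y = 2ℚ * c₊ y * χ (shown y) + 2ℚ * c₋ y * χ (ℤ.- shown y)

    correction : ℚ → ℚ → ℚ → ℚ
    correction p q r = - (2ℚ * (2ℚ * ½ ^ N)) * p + (2ℚ * q + 2ℚ * r)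

    c≥0 : ∀ (v : Vec Sign N) y → 0ℚ ≤ cond y (δ v)
    c≥0 v y = cond-nonNeg y λ x → ⟪⟫-nonNeg (does (v ≟ᵥ x))

    -- With one of ±u excluded, E[Maj | y] is shifted in one direction only, and the sum of the
    -- revealed signs predicts its sign, so `abs-shift` applies. If u is the excluded one,
    -- everything is negated first.
    generic : ∀ y → c₊ y ≡ 0ℚ ⊎ c₋ y ≡ 0ℚ → ℚ.∣ cond y maj ∣ + main y ≤ ℚ.∣ cond y g ∣
    generic y (inj₂ c₋≡0) = subst₂ _≤_
      (trans (eq₁ ℚ.∣ cond y maj ∣ (c₊ y) (χ (shown y)) (χ (ℤ.- shown y)))
        (cong (λ z → ℚ.∣ cond y maj ∣ + (2ℚ * c₊ y * χ (shown y) + 2ℚ * z * χ (ℤ.- shown y)))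
          (sym c₋≡0)))
      (cong ℚ.∣_∣ (sym (trans (cond-g y) (trans
        (cong (λ z → cond y maj + 2ℚ * (c₊ y + - 1ℚ * z)) c₋≡0)
        (eq₂ (cond y maj) (c₊ y))))))
      (abs-shift (shown y) (c≥0 u y) (cond-maj≥0 y))
      where
      eq₁ : ∀ p c s t → p + 2ℚ * c * s ≡ p + (2ℚ * c * s + 2ℚ * 0ℚ * t)
      eq₁ = solve-∀ ring
      eq₂ : ∀ p c → p + 2ℚ * (c + - 1ℚ * 0ℚ) ≡ p + 2ℚ * c
      eq₂ = solve-∀ ring
    generic y (inj₁ c₊≡0) = subst₂ _≤_
      (trans (cong (_+ 2ℚ * c₋ y * χ (ℤ.- shown y)) (ℚ.∣-p∣≡∣p∣ (cond y maj)))
        (trans (eq₁ ℚ.∣ cond y maj ∣ (c₋ y) (χ (ℤ.- shown y)) (χ (shown y)))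
        (cong (λ z → ℚ.∣ cond y maj ∣ + (2ℚ * z * χ (shown y) + 2ℚ * c₋ y * χ (ℤ.- shown y)))
          (sym c₊≡0))))
      (trans (sym (ℚ.∣-p∣≡∣p∣ (- cond y maj + 2ℚ * c₋ y)))
        (cong ℚ.∣_∣ (sym (trans (cond-g y)
          (trans (cong (λ z → cond y maj + 2ℚ * (z + - 1ℚ * c₋ y)) c₊≡0)
        (eq₂ (cond y maj) (c₋ y)))))))
      (abs-shift (ℤ.- shown y) (c≥0 (neg u) y) (cond-maj≤0 y))
      where
      eq₁ : ∀ p c s t → p + 2ℚ * c * s ≡ p + (2ℚ * 0ℚ * t + 2ℚ * c * s)
      eq₁ = solve-∀ ring
      eq₂ : ∀ p c → p + 2ℚ * (0ℚ + - 1ℚ * c) ≡ - (- p + 2ℚ * c)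
      eq₂ = solve-∀ ring

    δ-self : ∀ {n} (v : Vec Sign n) → δ v v ≡ 1ℚ
    δ-self v = ⟪yes⟫ (v ≟ᵥ v) refl

    δ-opposite : ∀ {n} (v : Vec Sign (suc n)) → δ v (neg v) ≡ 0ℚ
    δ-opposite (Sign.- ∷ v) = refl
    δ-opposite (Sign.+ ∷ v) = refl

    δ-opposite′ : ∀ {n} (v : Vec Sign (suc n)) → δ (neg v) v ≡ 0ℚ
    δ-opposite′ (Sign.- ∷ v) = refl
    δ-opposite′ (Sign.+ ∷ v) = refl

    just≢ : ∀ {n} (v : Vec Sign (suc n)) → Vec.map just v ≢ Vec.map just (neg v)
    just≢ (Sign.- ∷ v) ()
    just≢ (Sign.+ ∷ v) ()

    stars≢ : ∀ {n} (v : Vec Sign (suc n)) → stars (suc n) ≢ Vec.map just v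
    stars≢ (s ∷ v) ()

    special : ∀ y p q r {m c c′ v} → cond y maj ≡ m → c₊ y ≡ c → c₋ y ≡ c′ → shown y ≡ v →
      ℚ.∣ m ∣ + (2ℚ * c * χ v + 2ℚ * c′ * χ (ℤ.- v) + correction p q r)
        ≡ ℚ.∣ m + 2ℚ * (c + - 1ℚ * c′) ∣ →
      ℚ.∣ cond y maj ∣ + (main y + correction p q r) ≤ ℚ.∣ cond y g ∣
    special y p q r m≡ c≡ c′≡ v≡ eq = subst (ℚ.∣ cond y maj ∣ + (main y + correction p q r) ≤_)
      (cong ℚ.∣_∣ (sym (cond-g y))) (transport m≡ c≡ c′≡ v≡ (ℚ.≤-reflexive eq))
      where
      transport : ∀ {m m₁ c c₁ c′ c′₁ v v₁} → m ≡ m₁ → c ≡ c₁ → c′ ≡ c′₁ → v ≡ v₁ →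
        ℚ.∣ m₁ ∣ + (2ℚ * c₁ * χ v₁ + 2ℚ * c′₁ * χ (ℤ.- v₁) + correction p q r)
          ≤ ℚ.∣ m₁ + 2ℚ * (c₁ + - 1ℚ * c′₁) ∣ →
        ℚ.∣ m ∣ + (2ℚ * c * χ v + 2ℚ * c′ * χ (ℤ.- v) + correction p q r)
          ≤ ℚ.∣ m + 2ℚ * (c + - 1ℚ * c′) ∣
      transport refl refl refl refl le = le

    pointwise : ∀ y → ℚ.∣ cond y maj ∣ + (main y + correction ⟪ does (y ≟ₘ stars N) ⟫
                  ⟪ does (y ≟ₘ Vec.map just u) ⟫ ⟪ does (y ≟ₘ Vec.map just (neg u)) ⟫)
                    ≤ ℚ.∣ cond y g ∣
    pointwise y with y ≟ₘ stars N | y ≟ₘ Vec.map just u | y ≟ₘ Vec.map just (neg u)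
    ... | yes refl | yes eq | _      = contradiction eq (stars≢ u)
    ... | yes refl | _      | yes eq = contradiction eq (stars≢ (neg u))
    ... | yes refl | no _   | no _   =
      special (stars N) 1ℚ 0ℚ 0ℚ refl (cond-stars-δ u) (cond-stars-δ (neg u)) (shown-stars N)
        (trans (eq₁ ℚ.∣ cond (stars N) maj ∣ (½ ^ N))
          (cong ℚ.∣_∣ (eq₂ (cond (stars N) maj) (½ ^ N))))
      where
      eq₁ : ∀ m h → m + (2ℚ * h * 1ℚ + 2ℚ * h * 1ℚ
        + (- (2ℚ * (2ℚ * h)) * 1ℚ + (2ℚ * 0ℚ + 2ℚ * 0ℚ))) ≡ m
      eq₁ = solve-∀ ring
      eq₂ : ∀ m h → m ≡ m + 2ℚ * (h + - 1ℚ * h)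
      eq₂ = solve-∀ ring
    ... | no _     | yes refl | yes eq = contradiction eq (just≢ u)
    ... | no _     | yes refl | no _   =
      special (Vec.map just u) 0ℚ 1ℚ 0ℚ (trans (cond-just u maj) (cong sgn total-u))
        (trans (cond-just u (δ u)) (δ-self u)) (trans (cond-just u (δ (neg u))) (δ-opposite′ u))
        (trans (shown-just u) total-u) (eq (½ ^ N))
      where
      eq : ∀ h → 1ℚ + (2ℚ * 1ℚ * - 1ℚ + 2ℚ * 0ℚ * 1ℚ
        + (- (2ℚ * (2ℚ * h)) * 0ℚ + (2ℚ * 1ℚ + 2ℚ * 0ℚ))) ≡ 1ℚ
      eq = solve-∀ ring
    ... | no _     | no _     | yes refl =
      special (Vec.map just (neg u)) 0ℚ 0ℚ 1ℚ (trans (cond-just (neg u) maj) (cong sgn total-neg-u))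
        (trans (cond-just (neg u) (δ u)) (δ-opposite u))
          (trans (cond-just (neg u) (δ (neg u))) (δ-self (neg u)))
        (trans (shown-just (neg u)) total-neg-u) (eq (½ ^ N))
      where
      total-neg-u : total (neg u) ≡ 1ℤ
      total-neg-u = trans (total-neg u) (cong ℤ.-_ total-u)
      eq : ∀ h → 1ℚ + (2ℚ * 0ℚ * 1ℚ + 2ℚ * 1ℚ * - 1ℚ
        + (- (2ℚ * (2ℚ * h)) * 0ℚ + (2ℚ * 0ℚ + 2ℚ * 1ℚ))) ≡ 1ℚ
      eq = solve-∀ ring
    ... | no y≢⋆   | no _     | no _ with δ-disjoint u y
    ...   | inj₁ y≡⋆ = contradiction y≡⋆ y≢⋆
    ...   | inj₂ zeros = subst (_≤ ℚ.∣ cond y g ∣) (eq ℚ.∣ cond y maj ∣ (main y) (½ ^ N))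
      (generic y zeros)
      where
      eq : ∀ p q h → p + q ≡ p + (q + (- (2ℚ * (2ℚ * h)) * 0ℚ + (2ℚ * 0ℚ + 2ℚ * 0ℚ)))
      eq = solve-∀ ring

  module _ {a b : ℚ} (0≤a : 0ℚ ≤ a) (0≤b : 0ℚ ≤ b) where
    private
      𝔼ₛ : (Vec (Maybe Sign) N → ℚ) → ℚ
      𝔼ₛ = E symbols (obs a b) N

      linear : ∀ r s f f′ → 𝔼ₛ (λ y → r * f y + s * f′ y) ≡ r * 𝔼ₛ f + s * 𝔼ₛ f′
      linear r s f f′ = trans (E-+ symbols (obs a b) N (λ y → r * f y) (λ y → s * f′ y))
        (cong₂ _+_ (E-* symbols (obs a b) N r f) (E-* symbols (obs a b) N s f′))

      main-sum : 𝔼ₛ main ≡ 2ℚ * U a b u χ 0ℤ + 2ℚ * U a b u χ 0ℤ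
      main-sum = trans
        (E-cong symbols (obs a b) N λ y → cong₂ _+_ (ℚ.*-assoc 2ℚ (c₊ y) (χ (shown y)))
          (ℚ.*-assoc 2ℚ (c₋ y) (χ (ℤ.- shown y))))
        (trans (linear 2ℚ 2ℚ (λ y → c₊ y * χ (shown y)) (λ y → c₋ y * χ (ℤ.- shown y)))
          (cong₂ (λ p q → 2ℚ * p + 2ℚ * q)
            (trans (E-cong symbols (obs a b) N λ y → cong (λ w → c₊ y * χ w)
              (sym (ℤ.+-identityˡ (shown y))))
                   (E-shown a b u χ 0ℤ))
            (trans (E-cong symbols (obs a b) N λ y → cong (λ w → c₋ y * χ (ℤ.- w))
              (sym (ℤ.+-identityˡ (shown y))))
              (trans (E-shown a b (neg u) (χ ∘ ℤ.-_) 0ℤ) (U-neg a b u χ 0ℤ)))))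

      [⋆] [u] [-u] : Vec (Maybe Sign) N → ℚ
      [⋆] y  = ⟪ does (y ≟ₘ stars N) ⟫
      [u] y  = ⟪ does (y ≟ₘ Vec.map just u) ⟫
      [-u] y = ⟪ does (y ≟ₘ Vec.map just (neg u)) ⟫

      -- The source of aⁿ - bⁿ for Φ: total erasure has probability (2a)ⁿ and each correction there
      -- carries 2⁻ⁿ, while each of u and -u is fully revealed with probability bⁿ.
      correction-sum : 𝔼ₛ (λ y → correction ([⋆] y) ([u] y) ([-u] y))
                     ≡ - (2ℚ * (2ℚ * a ^ N)) + (2ℚ * b ^ N + 2ℚ * b ^ N)
      correction-sum = trans
        (E-+ symbols (obs a b) N (λ y → - (2ℚ * (2ℚ * ½ ^ N)) * [⋆] y)
          (λ y → 2ℚ * [u] y + 2ℚ * [-u] y))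
        (cong₂ _+_
          (trans (E-* symbols (obs a b) N (- (2ℚ * (2ℚ * ½ ^ N))) [⋆])
            (trans (cong (- (2ℚ * (2ℚ * ½ ^ N)) *_)
              (trans (E-symbols-≟ a b (stars N)) (Pr-stars a b N)))
              (trans (eq (½ ^ N) ((a + a) ^ N)) (cong (λ z → - (2ℚ * (2ℚ * z))) (half^ a N)))))
          (trans (linear 2ℚ 2ℚ [u] [-u]) (cong₂ (λ p q → 2ℚ * p + 2ℚ * q)
            (trans (E-symbols-≟ a b (Vec.map just u)) (Pr-just a b u))
            (trans (E-symbols-≟ a b (Vec.map just (neg u))) (Pr-just a b (neg u))))))
        where
        eq : ∀ h p → - (2ℚ * (2ℚ * h)) * p ≡ - (2ℚ * (2ℚ * (h * p)))
        eq = solve-∀ ring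
        half^ : ∀ a n → ½ ^ n * (a + a) ^ n ≡ a ^ n
        half^ a zero    = refl
        half^ a (suc n) = trans (eq′ a (½ ^ n) ((a + a) ^ n)) (cong (a *_) (half^ a n))
          where
          eq′ : ∀ a p q → ½ * p * ((a + a) * q) ≡ a * (p * q)
          eq′ = solve-∀ ring

      obs≥0 : ∀ t → 0ℚ ≤ obs a b t
      obs≥0 (just _) = 0≤b
      obs≥0 nothing  = +-nonNeg 0≤a 0≤a

    Φ-perturb : 𝔼ₛ (λ y → ℚ.∣ cond y maj ∣)
      + 2ℚ * (U a b u χ 0ℤ + U a b u χ 0ℤ - 2ℚ * (a ^ N - b ^ N))
              ≤ 𝔼ₛ (λ y → ℚ.∣ cond y g ∣)
    Φ-perturb = subst (_≤ 𝔼ₛ (λ y → ℚ.∣ cond y g ∣))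
      (trans (E-+ symbols (obs a b) N (λ y → ℚ.∣ cond y maj ∣)
        (λ y → main y + correction ([⋆] y) ([u] y) ([-u] y)))
        (cong (𝔼ₛ (λ y → ℚ.∣ cond y maj ∣) +_)
          (trans (E-+ symbols (obs a b) N main (λ y → correction ([⋆] y) ([u] y) ([-u] y)))
            (trans (cong₂ _+_ main-sum correction-sum) (eq (U a b u χ 0ℤ) (a ^ N) (b ^ N))))))
      (E-mono symbols (obs a b) obs≥0 N pointwise)
      where
      eq : ∀ t p q → 2ℚ * t + 2ℚ * t + (- (2ℚ * (2ℚ * p)) + (2ℚ * q + 2ℚ * q))
        ≡ 2ℚ * (t + t - 2ℚ * (p - q))
      eq = solve-∀ ring

-- The size of ε

*-pos : ∀ {p q} → 0ℚ ℚ.< p → 0ℚ ℚ.< q → 0ℚ ℚ.< p * q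
*-pos {p} {q} 0<p 0<q = subst (ℚ._< p * q) (ℚ.*-zeroʳ p)
  (ℚ.*-monoʳ-<-pos p {{ℚ.positive 0<p}} 0<q)

ι-+ : ∀ m n → ι (m ℕ.+ n) ≡ ι m + ι n
ι-+ zero    n = sym (ℚ.+-identityˡ (ι n))
ι-+ (suc m) n = trans (cong (1ℚ +_) (ι-+ m n)) (sym (ℚ.+-assoc 1ℚ (ι m) (ι n)))

ι-* : ∀ m n → ι (m ℕ.* n) ≡ ι m * ι n
ι-* zero    n = sym (ℚ.*-zeroˡ (ι n))
ι-* (suc m) n = trans (ι-+ n (m ℕ.* n)) (trans (cong (ι n +_) (ι-* m n)) (eq (ι m) (ι n)))
  where
  eq : ∀ p q → q + p * q ≡ (1ℚ + p) * q
  eq = solve-∀ ring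

ι-mono : ∀ {m n} → m ℕ.≤ n → ι m ≤ ι n
ι-mono {n = n} ℕ.z≤n   = 0≤ι n
ι-mono (ℕ.s≤s m≤n)     = ℚ.+-monoʳ-≤ 1ℚ (ι-mono m≤n)

-- Division on ℚ reduces to lowest terms and does not compute for a variable denominator, so the
-- proof passes through unnormalised rationals.
/-ι : ∀ m n → .{{_ : ℕ.NonZero n}} → (ℤ.+ m / n) * ι n ≡ ι m
/-ι m (suc n) = ℚ.toℚᵘ-injective (ℚᵘ.≃-trans (ℚ.toℚᵘ-homo-* (ℤ.+ m / suc n) (ι (suc n)))
  (ℚᵘ.≃-trans (ℚᵘ.*-cong (ℚ.toℚᵘ-fromℚᵘ (ℚᵘ.mkℚᵘ (ℤ.+ m) n)) (toℚᵘ-ι (suc n)))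
  (ℚᵘ.≃-trans (ℚᵘ.*≡* (eq₂ (ℤ.+ m) (ℤ.+ suc n) (ℤ.+ (suc n ℕ.* 1))
    (cong (λ z → ℤ.+ z) (ℕ.*-identityʳ (suc n)))))
    (ℚᵘ.≃-sym (toℚᵘ-ι m)))))
  where
  eq₁ : ∀ n → (1ℤ ℤ.* 1ℤ ℤ.+ n ℤ.* 1ℤ) ℤ.* 1ℤ ≡ (1ℤ ℤ.+ n) ℤ.* 1ℤ
  eq₁ = solve-∀ᶻ
  toℚᵘ-ι : ∀ n → ℚ.toℚᵘ (ι n) ℚᵘ.≃ ℚᵘ.mkℚᵘ (ℤ.+ n) 0
  toℚᵘ-ι zero    = ℚᵘ.≃-refl
  toℚᵘ-ι (suc n) = ℚᵘ.≃-trans (ℚ.toℚᵘ-homo-+ 1ℚ (ι n))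
    (ℚᵘ.≃-trans (ℚᵘ.+-cong (ℚᵘ.≃-refl {ℚ.toℚᵘ 1ℚ}) (toℚᵘ-ι n)) (ℚᵘ.*≡* (eq₁ (ℤ.+ n))))
  eq₂ : ∀ m n n′ → n′ ≡ n → m ℤ.* n ℤ.* 1ℤ ≡ m ℤ.* n′
  eq₂ m n n′ refl = ℤ.*-identityʳ (m ℤ.* n)

-- Put k = j + 2, so n - 3 = 2 (k - 1). As a + b = 1/2, the goal is 1/2 ≤ (k² - 3/2) b, while the
-- hypothesis gives 1/2 ≤ ((k - 1)² + 3/2) b. The two coefficients differ by 2k - 4 = 2j. At n = 5
-- they coincide, which is how the constants 3 and 6 in ε fit.
ε-margin : ∀ j a b → a + b ≡ ½ → ½ * ε (suc (suc (suc j) ℕ.* 2)) ≤ b →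
           a + (1ℚ + ½) * b ≤ (ι (suc (suc j)) * ι (suc (suc j)) - 1ℚ) * b
ε-margin j a b a+b≡½ ε≤b = ≤-by ((½ * ½) * (Q * b - Q * (½ * e)) + 2ℚ * (x * b))
  (+-nonNeg (*-nonNeg (ℚ.nonNegative⁻¹ (½ * ½)) (≤⇒0≤ (*-monoˡ Q 0≤Q ε≤b)))
    (*-nonNeg (ℚ.nonNegative⁻¹ 2ℚ) (*-nonNeg (0≤ι j) (ℚ.≤-trans 0≤½e ε≤b))))
  (trans (cong (λ q → a + (1ℚ + ½) * b + ((½ * ½) * (Q * b - q) + 2ℚ * (x * b))) Qe)
  (trans (cong (λ q → a + (1ℚ + ½) * b + ((½ * ½) * (q * b - 2ℚ) + 2ℚ * (x * b))) Q≡)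
  (trans (eq₁ a b x) (trans (cong (λ q → q - ½ + (1ℚ + (1ℚ + x)) * (1ℚ + (1ℚ + x)) * b - b) a+b≡½)
    (eq₂ b x)))))
  where
  w = suc (suc (j ℕ.* 2))
  e = ε (suc (suc (suc j) ℕ.* 2))
  x = ι j
  -- Q e = 4, so the hypothesis reads 2 ≤ Q b.
  Q = ι (6 ℕ.+ w ℕ.^ 2)
  0≤Q = 0≤ι (6 ℕ.+ w ℕ.^ 2)
  0≤½e : 0ℚ ≤ ½ * e
  0≤½e = *-nonNeg 0≤½ (ℚ.nonNegative⁻¹ e {{ℚ.normalize-nonNeg 4 (6 ℕ.+ w ℕ.^ 2)}})
  Qe : Q * (½ * e) ≡ 2ℚ
  Qe = trans (eq Q e) (cong (½ *_) (/-ι 4 (6 ℕ.+ w ℕ.^ 2)))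
    where
    eq : ∀ Q e → Q * (½ * e) ≡ ½ * (e * Q)
    eq = solve-∀ ring
  ι-w : ι w ≡ 1ℚ + (1ℚ + x * 2ℚ)
  ι-w = cong (λ z → 1ℚ + (1ℚ + z)) (ι-* j 2)
  Q≡ : Q ≡ ι 6 + (1ℚ + (1ℚ + x * 2ℚ)) * ((1ℚ + (1ℚ + x * 2ℚ)) * 1ℚ)
  Q≡ = trans (ι-+ 6 (w ℕ.^ 2)) (cong (ι 6 +_) (trans (ι-* w (w ℕ.* 1))
    (cong₂ _*_ ι-w (trans (ι-* w 1) (cong (_* 1ℚ) ι-w)))))
  eq₁ : ∀ a b x → a + (1ℚ + ½) * b + ((½ * ½) *
    ((ι 6 + (1ℚ + (1ℚ + x * 2ℚ)) * ((1ℚ + (1ℚ + x * 2ℚ)) * 1ℚ)) * b - 2ℚ)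
          + 2ℚ * (x * b)) ≡ a + b - ½ + (1ℚ + (1ℚ + x)) * (1ℚ + (1ℚ + x)) * b - b
  eq₁ = solve-∀ ring
  eq₂ : ∀ b x → ½ - ½ + (1ℚ + (1ℚ + x)) * (1ℚ + (1ℚ + x)) * b - b
    ≡ ((1ℚ + (1ℚ + x)) * (1ℚ + (1ℚ + x)) - 1ℚ) * b
  eq₂ = solve-∀ ring

o : ℕ → ℚ
o n = ε n * ι (n ℕ.^ 2) - ℤ.+ 4 / 1

ε≡ : ∀ n → .{{_ : ℕ.NonZero n}} → ε n ≡ (ℤ.+ 4 / 1 + o n) * 1/ n ²
ε≡ (suc n) = sym (trans (eq (ε (suc n)) (ι (suc n ℕ.^ 2)) (1/ (suc n) ²))
  (trans (cong (ε (suc n) *_) (/-ι 1 (suc n ℕ.^ 2) {{ℕ.m^n≢0 (suc n) 2}}))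
    (ℚ.*-identityʳ (ε (suc n)))))
  where
  eq : ∀ e q r → (ℤ.+ 4 / 1 + (e * q - ℤ.+ 4 / 1)) * r ≡ e * (r * q)
  eq = solve-∀ ring

-- The denominator of `e` serves: multiplying by it gives the numerator, a positive integer.
archimedean : ∀ {e} → 0ℚ ℚ.< e → ∃ λ K → 1ℚ ≤ e * ι K
archimedean {ℚ.mkℚ (ℤ.+ zero) d c}   0<e = contradiction 0<e λ { (ℚ.*<* (ℤ.+<+ ())) }
archimedean {e@(ℚ.mkℚ (ℤ.+ suc a) d c)} 0<e = suc d ,
  subst (1ℚ ≤_) (sym (trans (cong (_* ι (suc d)) (sym (ℚ.↥p/↧p≡p e))) (/-ι (suc a) (suc d))))
    (ℚ.+-monoʳ-≤ 1ℚ (0≤ι a))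
archimedean {ℚ.mkℚ ℤ.-[1+ _ ] d c}   0<e = contradiction 0<e λ { (ℚ.*<* ()) }

-- o (m + 3) = (24 m + 12) / (m² + 6), which is at most 36 / m for m ≥ 1.
o-tendsToZero : TendsToZero o
o-tendsToZero e 0<e with archimedean 0<e
-- With n = m + 3 this threshold says m ≥ 36 K + 1: the multiple of K gives e m ≥ 36, and the extra
-- 1 ensures m ≥ 1 even for K = 0.
... | K , 1≤eK = 4 ℕ.+ K ℕ.* 36 , λ n N≤n → subst (λ n → ℚ.∣ o n ∣ ≤ e)
    (ℕ.m+[n∸m]≡n (ℕ.≤-trans (ℕ.m≤m+n 3 (suc (K ℕ.* 36))) N≤n))
      (bounded (n ℕ.∸ 3) (ℕ.∸-monoˡ-≤ 3 N≤n))
  where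
  bounded : ∀ m → suc (K ℕ.* 36) ℕ.≤ m → ℚ.∣ o (3 ℕ.+ m) ∣ ≤ e
  bounded m K<m = subst (_≤ e) (sym (ℚ.0≤p⇒∣p∣≡p 0≤o)) o≤e
    where
    M = ι m
    Q = ι (6 ℕ.+ m ℕ.^ 2)
    instance
      Q>0 : ℚ.Positive Q
      Q>0 = ℚ.positive (ℚ.<-≤-trans (ℚ.positive⁻¹ 1ℚ) (ℚ.+-monoʳ-≤ 1ℚ (0≤ι (5 ℕ.+ m ℕ.^ 2))))
    Q≡ : Q ≡ ι 6 + M * (M * 1ℚ)
    Q≡ = trans (ι-+ 6 (m ℕ.^ 2)) (cong (ι 6 +_) (trans (ι-* m (m ℕ.* 1)) (cong (M *_) (ι-* m 1))))
    oQ : o (3 ℕ.+ m) * Q ≡ ι 24 * M + ι 12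
    oQ = trans (eq₁ (ε (3 ℕ.+ m)) (ι ((3 ℕ.+ m) ℕ.^ 2)) Q)
      (trans (cong₂ (λ p q → p * q - ι 4 * Q) (/-ι 4 (6 ℕ.+ m ℕ.^ 2))
          (trans (ι-* (3 ℕ.+ m) ((3 ℕ.+ m) ℕ.* 1)) (cong (ι (3 ℕ.+ m) *_) (ι-* (3 ℕ.+ m) 1))))
      (trans (cong (λ q → ι 4 * (ι (3 ℕ.+ m) * (ι (3 ℕ.+ m) * 1ℚ)) - ι 4 * q) Q≡) (eq₂ M)))
      where
      eq₁ : ∀ e n Q → (e * n - ℤ.+ 4 / 1) * Q ≡ e * Q * n - ι 4 * Q
      eq₁ = solve-∀ ring
      eq₂ : ∀ M → ι 4 * ((1ℚ + (1ℚ + (1ℚ + M))) * ((1ℚ + (1ℚ + (1ℚ + M))) * 1ℚ))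
        - ι 4 * (ι 6 + M * (M * 1ℚ))
                ≡ ι 24 * M + ι 12
      eq₂ = solve-∀ ring
    0≤o : 0ℚ ≤ o (3 ℕ.+ m)
    0≤o = ℚ.*-cancelʳ-≤-pos Q (subst₂ _≤_ (sym (ℚ.*-zeroˡ Q)) (sym oQ)
      (+-nonNeg (*-nonNeg (0≤ι 24) (0≤ι m)) (0≤ι 12)))
    0≤e : 0ℚ ≤ e
    0≤e = ℚ.<⇒≤ 0<e
    1≤M : 1ℚ ≤ M
    1≤M = ι-mono (ℕ.≤-trans (ℕ.s≤s ℕ.z≤n) K<m)
    36≤eM : ι 36 ≤ e * M
    36≤eM = ℚ.≤-trans (*-monoˡ (ι 36) (0≤ι 36) 1≤eK)
      (subst (_≤ e * M) (trans (cong (e *_) (ι-* K 36)) (eq e (ι K)))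
        (*-monoˡ e 0≤e (ι-mono (ℕ.≤-trans (ℕ.n≤1+n _) K<m))))
      where
      eq : ∀ e K → e * (K * ι 36) ≡ ι 36 * (e * K)
      eq = solve-∀ ring
    o≤e : o (3 ℕ.+ m) ≤ e
    o≤e = ℚ.*-cancelʳ-≤-pos Q (subst₂ _≤_ (sym oQ) (cong (e *_) (sym Q≡))
      (≤-by ((e * M - ι 36) * M + ι 12 * (M - 1ℚ) + e * ι 6)
        (+-nonNeg (+-nonNeg (*-nonNeg (≤⇒0≤ 36≤eM) (0≤ι m)) (*-nonNeg (0≤ι 12) (≤⇒0≤ 1≤M)))
          (*-nonNeg 0≤e (0≤ι 6)))
        (eq e M)))
      where
      eq : ∀ e M → ι 24 * M + ι 12 + ((e * M - ι 36) * M + ι 12 * (M - 1ℚ) + e * ι 6)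
        ≡ e * (ι 6 + M * (M * 1ℚ))
      eq = solve-∀ ring

-- The threshold function

val : Sign → ℚ
val s = toℤ s / 1

minuses : Vec Sign n → ℕ
minuses []           = 0
minuses (Sign.- ∷ x) = suc (minuses x)
minuses (Sign.+ ∷ x) = minuses x

total+2minuses : ∀ (x : Vec Sign n) → total x ℤ.+ ℤ.+ (minuses x ℕ.* 2) ≡ ℤ.+ n
total+2minuses []           = refl
total+2minuses (Sign.- ∷ x) = trans (eq (total x) (ℤ.+ (minuses x ℕ.* 2)))
  (cong (ℤ._+_ 1ℤ) (total+2minuses x))
  where
  eq : ∀ t m → -1ℤ ℤ.+ t ℤ.+ (ℤ.+ 2 ℤ.+ m) ≡ 1ℤ ℤ.+ (t ℤ.+ m)
  eq = solve-∀ᶻ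
total+2minuses (Sign.+ ∷ x) = trans (ℤ.+-assoc 1ℤ (total x) (ℤ.+ (minuses x ℕ.* 2)))
  (cong (ℤ._+_ 1ℤ) (total+2minuses x))

even≢odd : ∀ m k → m ℕ.* 2 ≢ suc (k ℕ.* 2)
even≢odd (suc zero)    (suc k) ()
even≢odd (suc (suc m)) (suc k) eq = even≢odd (suc m) k (ℕ.suc-injective (ℕ.suc-injective eq))

-- By parity: the sum and n differ by twice the number of minus signs, and n is odd.
total≢0 : ∀ {k} (x : Vec Sign (suc (k ℕ.* 2))) → total x ≢ 0ℤ
total≢0 {k} x t≡0 = even≢odd (minuses x) k (ℤ.+-injective
  (trans (sym (ℤ.+-identityˡ _)) (trans (cong (ℤ._+ ℤ.+ (minuses x ℕ.* 2)) (sym t≡0))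
    (total+2minuses x))))

val-sign : ∀ v → v ≢ 0ℤ → val (ℤ.sign v) ≡ sgn v
val-sign (ℤ.+ zero)  v≢0 = contradiction refl v≢0
val-sign (ℤ.+ suc _) _   = refl
val-sign ℤ.-[1+ _ ]  _   = refl

override : ∀ {P Q : Set} → Dec P → Dec Q → Sign → Sign
override P? Q? s = if does P? then Sign.+ else if does Q? then Sign.- else s

g : ∀ n → BoolFun n
g n x = override (alt Sign.- n ≟ᵥ x) (neg (alt Sign.- n) ≟ᵥ x) (Maj n x)

neg≢ : ∀ {n} (u : Vec Sign (suc n)) → neg u ≢ u
neg≢ (Sign.- ∷ u) ()
neg≢ (Sign.+ ∷ u) ()

module Odd (k : ℕ) where

  N = suc (k ℕ.* 2)
  u = alt Sign.- N

  G M : Vec Sign N → ℚ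
  G x = val (g N x)
  M x = val (Maj N x)

  total-neg-u : total (neg u) ≡ 1ℤ
  total-neg-u = trans (total-neg u) (cong ℤ.-_ (total-alt k))

  M≡ : ∀ x → M x ≡ maj x
  M≡ x = val-sign (total x) (total≢0 {k} x)

  -- The vectors u and -u have sums -1 and 1, so adding 2 and -2 respectively is exactly a change of
  -- sign.
  G≡ : ∀ x → G x ≡ maj x + 2ℚ * D u x
  G≡ x = go (u ≟ᵥ x) (neg u ≟ᵥ x)
    where
    go : ∀ (P? : Dec (u ≡ x)) (Q? : Dec (neg u ≡ x)) →
         val (override P? Q? (Maj N x)) ≡ maj x + 2ℚ * (⟪ does P? ⟫ + - 1ℚ * ⟪ does Q? ⟫)
    go (yes refl) (yes eq)   = contradiction eq (neg≢ u)
    go (yes refl) (no _)     = cong (λ t → sgn t + 2ℚ * (1ℚ + - 1ℚ * 0ℚ)) (sym (total-alt k))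
    go (no _)     (yes refl) = cong (λ t → sgn t + 2ℚ * (0ℚ + - 1ℚ * 1ℚ)) (sym total-neg-u)
    go (no _)     (no _)     = trans (M≡ x) (sym (ℚ.+-identityʳ (maj x)))

  maj-odd : ∀ (x : Vec Sign N) → maj (neg x) ≡ - maj x
  maj-odd x = trans (cong sgn (total-neg x)) (sgn-odd (total x))

  G-odd : ∀ x → G (neg x) ≡ - G x
  G-odd x = trans (G≡ (neg x)) (trans (cong₂ (λ p q → p + 2ℚ * q) (maj-odd x) (D-neg u x))
    (trans (eq (maj x) (D u x)) (cong -_ (sym (G≡ x)))))
    where
    eq : ∀ p q → - p + 2ℚ * (- q) ≡ - (p + 2ℚ * q)
    eq = solve-∀ ring

∑-neg : ∀ n (f : Vec Sign n → ℚ) → ∑ (vectors signs n) (f ∘ neg) ≡ ∑ (vectors signs n) f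
∑-neg zero    f = refl
∑-neg (suc n) f = trans (∑-vectors signs n (f ∘ neg))
  (trans (cong₂ (λ p q → p + (q + 0ℚ)) (∑-neg n (f ∘ (Sign.+ ∷_))) (∑-neg n (f ∘ (Sign.- ∷_))))
  (trans (eq (S Sign.+) (S Sign.-)) (sym (∑-vectors signs n f))))
  where
  S : Sign → ℚ
  S s = ∑ (vectors signs n) (f ∘ (s ∷_))
  eq : ∀ p q → p + (q + 0ℚ) ≡ q + (p + 0ℚ)
  eq = solve-∀ ring

odd⇒unbiased : ∀ {n} (f : BoolFun n) → (∀ x → val (f (neg x)) ≡ - val (f x)) → Unbiased f
odd⇒unbiased {n} f odd e 0<e = 0 , λ i _ → subst (λ z → ℚ.∣ z - 0ℚ ∣ ≤ e) (sym (vanish i))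
  (ℚ.<⇒≤ 0<e)
  where
  r = (ℤ.+ 1 / (2 ℕ.^ n)) {{ℕ.m^n≢0 2 n}}
  S = ∑ (vectors signs n) (λ x → val (f x))
  double : ∀ p → p ≡ ½ * (p + p)
  double = solve-∀ ring
  cancel : ∀ p → ½ * (- 1ℚ * p + p) ≡ 0ℚ
  cancel = solve-∀ ring
  minus : ∀ p → - p ≡ - 1ℚ * p
  minus = solve-∀ ring
  S≡-S : S ≡ - 1ℚ * S
  S≡-S = trans (sym (∑-neg n (λ x → val (f x))))
    (trans (∑-cong (vectors signs n) λ x → trans (odd x) (minus (val (f x))))
           (∑-* (vectors signs n) (- 1ℚ) λ x → val (f x)))
  S≡0 : S ≡ 0ℚ
  S≡0 = trans (double S) (trans (cong (λ z → ½ * (z + S)) S≡-S) (cancel S))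
  vanish : ∀ i → seq (𝔼 (uniform n) (λ x → ⟦ f x ⟧)) i ≡ 0ℚ
  vanish i = trans (seq-sum (vectors signs n) _ i)
    (trans (∑-* (vectors signs n) r (λ x → val (f x))) (trans (cong (r *_) S≡0) (ℚ.*-zeroʳ r)))

dot : Vec Sign n → Vec Sign n → ℚ
dot []      []      = 0ℚ
dot (s ∷ u) (t ∷ x) = val s * val t + dot u x

plain : Vec Sign n → ℚ
plain []      = 0ℚ
plain (t ∷ x) = val t + plain x

dot-neg : ∀ (u x : Vec Sign n) → dot (neg u) x ≡ - dot u x
dot-neg []      []      = refl
dot-neg (s ∷ u) (t ∷ x) = trans (cong₂ (λ p q → p * val t + q) (val-opposite s) (dot-neg u x))
  (eq (val s) (val t) (dot u x))
  where
  val-opposite : ∀ s → val (opposite s) ≡ - val s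
  val-opposite Sign.- = refl
  val-opposite Sign.+ = refl
  eq : ∀ s t d → - s * t + - d ≡ - (s * t + d)
  eq = solve-∀ ring

dot-self : ∀ (u : Vec Sign n) → dot u u ≡ ι n
dot-self []           = refl
dot-self (Sign.- ∷ u) = cong (1ℚ +_) (dot-self u)
dot-self (Sign.+ ∷ u) = cong (1ℚ +_) (dot-self u)

-- The inner product is n minus twice the number of disagreements, and distinct vectors have at
-- least one.
dot-≢ : ∀ (u x : Vec Sign n) → u ≢ x → dot u x + 2ℚ ≤ ι n
dot-≤ : ∀ (u x : Vec Sign n) → dot u x ≤ ι n

dot-≤ u x with u ≟ᵥ x
... | yes refl = ℚ.≤-reflexive (dot-self u)
... | no u≢x   = ℚ.≤-trans (≤-by 2ℚ (ℚ.nonNegative⁻¹ 2ℚ) refl) (dot-≢ u x u≢x)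

dot-≢ {suc n} u x u≢x = go u x u≢x
  where
  same : ∀ d → d + 2ℚ ≤ ι n → 1ℚ + d + 2ℚ ≤ 1ℚ + ι n
  same d h = subst (_≤ 1ℚ + ι n) (sym (ℚ.+-assoc 1ℚ d 2ℚ)) (ℚ.+-monoʳ-≤ 1ℚ h)
  different : ∀ d → d ≤ ι n → - 1ℚ + d + 2ℚ ≤ 1ℚ + ι n
  different d h = subst (_≤ 1ℚ + ι n) (eq d) (ℚ.+-monoʳ-≤ 1ℚ h)
    where
    eq : ∀ d → 1ℚ + d ≡ - 1ℚ + d + 2ℚ
    eq = solve-∀ ring
  go : ∀ (u x : Vec Sign (suc n)) → u ≢ x → dot u x + 2ℚ ≤ ι (suc n)
  go (Sign.- ∷ u) (Sign.- ∷ x) u≢x = same (dot u x) (dot-≢ u x (u≢x ∘ cong (Sign.- ∷_)))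
  go (Sign.+ ∷ u) (Sign.+ ∷ x) u≢x = same (dot u x) (dot-≢ u x (u≢x ∘ cong (Sign.+ ∷_)))
  go (Sign.- ∷ u) (Sign.+ ∷ x) u≢x = different (dot u x) (dot-≤ u x)
  go (Sign.+ ∷ u) (Sign.- ∷ x) u≢x = different (dot u x) (dot-≤ u x)
dot-≢ [] [] u≢x = contradiction refl u≢x

ζ : ℤ → ℚ
ζ (ℤ.+ n)    = ι n
ζ ℤ.-[1+ n ] = - ι (suc n)

plain≡ : ∀ (x : Vec Sign n) → plain x ≡ ζ (total x)
plain≡ []           = refl
plain≡ (Sign.+ ∷ x) = trans (cong (1ℚ +_) (plain≡ x)) (up (total x))
  where
  eq : ∀ p → 1ℚ + - (1ℚ + (1ℚ + p)) ≡ - (1ℚ + p)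
  eq = solve-∀ ring
  up : ∀ v → 1ℚ + ζ v ≡ ζ (1ℤ ℤ.+ v)
  up (ℤ.+ n)         = refl
  up ℤ.-[1+ zero ]   = refl
  up ℤ.-[1+ suc n ]  = eq (ι n)
plain≡ (Sign.- ∷ x) = trans (cong (- 1ℚ +_) (plain≡ x)) (down (total x))
  where
  eq₁ : ∀ p → - 1ℚ + (1ℚ + p) ≡ p
  eq₁ = solve-∀ ring
  eq₂ : ∀ p → - 1ℚ + - (1ℚ + p) ≡ - (1ℚ + (1ℚ + p))
  eq₂ = solve-∀ ring
  down : ∀ v → - 1ℚ + ζ v ≡ ζ (-1ℤ ℤ.+ v)
  down (ℤ.+ zero)   = refl
  down (ℤ.+ suc n)  = eq₁ (ι n)
  down ℤ.-[1+ n ]   = eq₂ (ι n)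

module LTF (k : ℕ) where
  open Odd k

  κ : ℚ
  κ = ι (k ℕ.* 2)

  -- The score is (n - 1) Σ xᵢ + u · x; the second term decides its sign only at x = ±u.
  weights : ∀ {n} → Vec Sign n → Vec ℝ n
  weights = Vec.map λ s → fromℚ (κ + val s)

  score : Vec Sign N → ℚ
  score x = κ * plain x + dot u x

  seq-weightedSum : ∀ {n} (v x : Vec Sign n) i → seq (weightedSum (weights v) x) i
    ≡ κ * plain x + dot v x
  seq-weightedSum []      []      i = sym (trans (ℚ.+-identityʳ (κ * 0ℚ)) (ℚ.*-zeroʳ κ))
  seq-weightedSum (s ∷ v) (t ∷ x) i = trans (cong ((κ + val s) * val t +_) (seq-weightedSum v x i))
    (eq κ (val s) (val t) (plain x) (dot v x))
    where
    eq : ∀ κ s t p d → (κ + s) * t + (κ * p + d) ≡ κ * (t + p) + (s * t + d)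
    eq = solve-∀ ring

  Decides : Sign → ℚ → Set
  Decides s q = (s ≡ Sign.+ × 1ℚ ≤ q) ⊎ (s ≡ Sign.- × q ≤ - 1ℚ)

  -- At u the score is n - κ = 1, so u overrides its own majority. If x is neither u nor -u and has
  -- positive sum, that sum is at least 1 and u · x ≥ 2 - n, so the score is at least κ + 2 - n = 1.
  -- Negative sums are symmetric. Both bounds require n - 2 < κ < n, and κ = n - 1 is the midpoint.
  decides : ∀ x → Decides (g N x) (score x)
  decides x = go (u ≟ᵥ x) (neg u ≟ᵥ x)
    where
    plain-at : ∀ {v} (y : Vec Sign N) → total y ≡ v → plain y ≡ ζ v
    plain-at y eq = trans (plain≡ y) (cong ζ eq)
    eq₊ : ∀ κ → 1ℚ ≡ κ * - 1ℚ + (1ℚ + κ)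
    eq₊ = solve-∀ ring
    eq₋ : ∀ κ → κ * 1ℚ + - (1ℚ + κ) ≡ - 1ℚ
    eq₋ = solve-∀ ring
    eq₁ : ∀ κ m d → 1ℚ + (κ * m + (1ℚ + κ - (- d + 2ℚ))) ≡ κ * (1ℚ + m) + d
    eq₁ = solve-∀ ring
    eq₂ : ∀ κ m d → κ * - (1ℚ + m) + d + (κ * m + (1ℚ + κ - (d + 2ℚ))) ≡ - 1ℚ
    eq₂ = solve-∀ ring
    by-total : u ≢ x → neg u ≢ x → ∀ t → total x ≡ t → Decides (ℤ.sign t) (score x)
    by-total u≢x -u≢x (ℤ.+ zero)  t≡ = contradiction t≡ (total≢0 {k} x)
    by-total u≢x -u≢x (ℤ.+ suc m) t≡ = inj₁ (refl , ≤-by _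
      (+-nonNeg (*-nonNeg (0≤ι (k ℕ.* 2)) (0≤ι m))
        (≤⇒0≤ (subst (λ z → z + 2ℚ ≤ 1ℚ + κ) (dot-neg u x) (dot-≢ (neg u) x -u≢x))))
      (trans (eq₁ κ (ι m) (dot u x)) (cong (λ z → κ * z + dot u x) (sym (plain-at x t≡)))))
    by-total u≢x -u≢x ℤ.-[1+ m ]  t≡ = inj₂ (refl , ≤-by _
      (+-nonNeg (*-nonNeg (0≤ι (k ℕ.* 2)) (0≤ι m)) (≤⇒0≤ (dot-≢ u x u≢x)))
      (trans (cong (λ z → κ * z + dot u x + (κ * ι m + (1ℚ + κ - (dot u x + 2ℚ))))
        (plain-at x t≡)) (eq₂ κ (ι m) (dot u x))))
    go : (P? : Dec (u ≡ x)) (Q? : Dec (neg u ≡ x)) → Decides (override P? Q? (Maj N x)) (score x)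
    go (yes refl) _          = inj₁ (refl , ℚ.≤-reflexive
      (trans (eq₊ κ) (sym (cong₂ (λ p d → κ * p + d) (plain-at u (total-alt k)) (dot-self u)))))
    go (no _)     (yes refl) = inj₂ (refl , ℚ.≤-reflexive
      (trans (cong₂ (λ p d → κ * p + d) (plain-at (neg u) total-neg-u)
        (trans (cong (λ v → dot v (neg u)) (sym (neg-involutive u)))
          (trans (dot-neg (neg u) (neg u)) (cong -_ (dot-self (neg u)))))) (eq₋ κ)))
    go (no u≢x)   (no -u≢x)  = by-total u≢x -u≢x (total x) refl

  isLTF : IsLTF (g N)
  isLTF = weights u , (λ x → nonzero x (decides x)) , λ x → correct x (decides x)
    where
    nonzero : ∀ x → Decides (g N x) (score x) → weightedSum (weights u) x # 0ℝ
    nonzero x (inj₁ (_ , 1≤q))  = inj₂ (less 1ℚ (ℚ.positive⁻¹ 1ℚ) 0 λ i _ →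
      subst (0ℚ + 1ℚ ≤_) (sym (seq-weightedSum u x i)) 1≤q)
    nonzero x (inj₂ (_ , q≤-1)) = inj₁ (less 1ℚ (ℚ.positive⁻¹ 1ℚ) 0 λ i _ →
      subst (λ z → z + 1ℚ ≤ 0ℚ) (sym (seq-weightedSum u x i)) (ℚ.+-monoˡ-≤ 1ℚ q≤-1))
    correct : ∀ x (d : Decides (g N x) (score x)) → g N x
      ≡ sign (weightedSum (weights u) x) (nonzero x d)
    correct x (inj₁ (g≡ , _)) = g≡
    correct x (inj₂ (g≡ , _)) = g≡

odd-view : ∀ n → n ℕ.% 2 ≡ 1 → 5 ℕ.≤ n → ∃ λ j → n ≡ suc (suc (suc j) ℕ.* 2)
odd-view n n%2≡1 5≤n = go (n ℕ./ 2) (trans (m≡m%n+[m/n]*n n 2) (cong (ℕ._+ n ℕ./ 2 ℕ.* 2) n%2≡1))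
  where
  go : ∀ q → n ≡ 1 ℕ.+ q ℕ.* 2 → ∃ λ j → n ≡ suc (suc (suc j) ℕ.* 2)
  go zero          eq = contradiction (subst (5 ℕ.≤_) eq 5≤n) λ { (ℕ.s≤s ()) }
  go (suc zero)    eq = contradiction (subst (5 ℕ.≤_) eq 5≤n) λ { (ℕ.s≤s (ℕ.s≤s (ℕ.s≤s ()))) }
  go (suc (suc j)) eq = j , eq

-- Comparison with Maj

seq-𝟙 : ∀ {P : Set} (P? : Dec P) i → seq (𝟙 P?) i ≡ ⟪ does P? ⟫
seq-𝟙 (yes _) i = refl
seq-𝟙 (no _)  i = refl

seq-Stab : ∀ ρ (f : BoolFun n) i →
           seq (Stab ρ f) i ≡ ⟨_,_⟩ (ℤ.+ 1 / 4 * (1ℚ + seq ρ i)) (ℤ.+ 1 / 4 * (1ℚ - seq ρ i))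
             (val ∘ f) (val ∘ f)
seq-Stab {n} ρ f i = seq-𝔼 (DSBS ρ) (dsbs (ℤ.+ 1 / 4 * (1ℚ + seq ρ i))
  (ℤ.+ 1 / 4 * (1ℚ - seq ρ i))) i mass≡ n
  λ z → Defs._*_ ⟦ f (Vec.map proj₁ z) ⟧ ⟦ f (Vec.map proj₂ z) ⟧
  where
  mass≡ : ∀ z → seq (mass (DSBS ρ) z) i ≡ dsbs (ℤ.+ 1 / 4 * (1ℚ + seq ρ i))
    (ℤ.+ 1 / 4 * (1ℚ - seq ρ i)) z
  mass≡ (Sign.- , Sign.-) = refl
  mass≡ (Sign.- , Sign.+) = refl
  mass≡ (Sign.+ , Sign.-) = refl
  mass≡ (Sign.+ , Sign.+) = refl

module _ {p : ℝ} (0<p : 0ℝ < p) (p<1 : p < 1ℝ) (i : ℕ) where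
  private
    a b : ℚ
    a = ½ * (1ℚ - seq p i)
    b = ½ * seq p i

    mass≡ : ∀ z → seq (mass (SBES p) z) i ≡ sbes a b z
    mass≡ (Sign.- , just Sign.-) = refl
    mass≡ (Sign.- , just Sign.+) = refl
    mass≡ (Sign.+ , just Sign.-) = refl
    mass≡ (Sign.+ , just Sign.+) = refl
    mass≡ (x , nothing)          = refl

  module _ (0<a : 0ℚ ℚ.< a) (0<b : 0ℚ ℚ.< b) where
    private
      Pr>0 : ∀ {n} (y : Vec (Maybe Sign) n) → 0ℚ ℚ.< Pr a b y
      Pr>0 []            = ℚ.positive⁻¹ 1ℚ
      Pr>0 (just _ ∷ y)  = *-pos 0<b (Pr>0 y)
      Pr>0 (nothing ∷ y) = *-pos (ℚ.+-mono-< 0<a 0<a) (Pr>0 y)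

    -- The real inverse is the termwise `recip`. At an index where a and b are positive, the
    -- probability of y is nonzero, so `recip` is a true inverse and cancels it.
    seq-𝔼-received : ∀ (f : BoolFun n) y → seq (𝔼[ f ∣received≡ y ] 0<p p<1) i ≡ cond y (val ∘ f)
    seq-𝔼-received {n} f y = trans
      (cong₂ (λ q r → q * recip r)
        (trans (seq-𝔼 (SBES p) (sbes a b) i mass≡ n _)
          (trans (E-cong cells (sbes a b) n λ z → cong (val (f (source z)) *_)
            (seq-𝟙 (received z ≟ₘ y) i))
                 (E-cells-≟ a b y (val ∘ f))))
        (trans (seq-𝔼 (SBES p) (sbes a b) i mass≡ n λ z → 𝟙 (received z ≟ₘ y))
          (trans (E-cong cells (sbes a b) n λ z → trans (seq-𝟙 (received z ≟ₘ y) i)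
                                                        (sym (ℚ.*-identityˡ ⟪ does
                                                          (received z ≟ₘ y) ⟫)))
          (trans (E-cells-≟ a b y λ _ → 1ℚ)
          (trans (cong (Pr a b y *_) (cond-const y 1ℚ)) (ℚ.*-identityʳ (Pr a b y)))))))
      (trans (eq (Pr a b y) (cond y (val ∘ f)) (recip (Pr a b y)))
        (trans (cong (_* cond y (val ∘ f))
          (recip-inverse (Pr a b y) λ Pr≡0 → ℚ.<-irrefl (sym Pr≡0) (Pr>0 y)))
               (ℚ.*-identityˡ (cond y (val ∘ f)))))
      where
      eq : ∀ r c s → r * c * s ≡ s * r * c
      eq = solve-∀ ring

    seq-Φ : ∀ (f : BoolFun n) → seq (Φ p 0<p p<1 f) i
      ≡ E symbols (obs a b) n (λ y → ℚ.∣ cond y (val ∘ f) ∣)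
    seq-Φ {n} f = trans (seq-𝔼 (SBES p) (sbes a b) i mass≡ n _)
      (trans (E-cong cells (sbes a b) n λ z → cong ℚ.∣_∣ (seq-𝔼-received f (received z)))
             (E-received a b n λ y → ℚ.∣ cond y (val ∘ f) ∣))

module Comparison (j : ℕ) where
  private
    k = suc (suc j)
  open Odd k

  -- c₀ bounds the slack in power-gap≤walk from below, uniformly in a ≥ ¼ and b ≥ b₀.
  ¼ b₀ c₀ : ℚ
  ¼  = ½ * ½
  b₀ = ½ * ε N
  c₀ = ½ * (¼ * ¼ * (b₀ * b₀) * (¼ * ¼) ^ j)

  0<b₀ : 0ℚ ℚ.< b₀
  0<b₀ = *-pos (ℚ.positive⁻¹ ½) (ℚ.positive⁻¹ (ε N) {{ℚ.normalize-pos 4 (6 ℕ.+ (N ℕ.∸ 3) ℕ.^ 2)}})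

  0<c₀ : 0ℚ ℚ.< c₀
  0<c₀ = *-pos (ℚ.positive⁻¹ ½) (*-pos (*-pos 0<¼¼ (*-pos 0<b₀ 0<b₀)) (power j))
    where
    0<¼¼ : 0ℚ ℚ.< ¼ * ¼
    0<¼¼ = ℚ.positive⁻¹ (¼ * ¼)
    power : ∀ m → 0ℚ ℚ.< (¼ * ¼) ^ m
    power zero    = ℚ.positive⁻¹ 1ℚ
    power (suc m) = *-pos 0<¼¼ (power m)

  module _ (a b : ℚ) (a+b≡½ : a + b ≡ ½) (b₀≤b : b₀ ≤ b) {d : ℚ} (0≤d : 0ℚ ≤ d)
    (d≤a-b : d ≤ a - b) where
    private
      0≤b₀ : 0ℚ ≤ b₀
      0≤b₀ = ℚ.<⇒≤ 0<b₀
      0≤b : 0ℚ ≤ b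
      0≤b = ℚ.≤-trans 0≤b₀ b₀≤b
      0≤a-b : 0ℚ ≤ a - b
      0≤a-b = ℚ.≤-trans 0≤d d≤a-b
      b≤a : b ≤ a
      b≤a = ≤-by (a - b) 0≤a-b (eq a b)
        where
        eq : ∀ a b → b + (a - b) ≡ a
        eq = solve-∀ ring
      ¼≤a : ¼ ≤ a
      ¼≤a = ≤-by (½ * (a - b)) (*-nonNeg 0≤½ 0≤a-b)
        (trans (cong (λ z → ½ * z + ½ * (a - b)) (sym a+b≡½)) (eq a b))
        where
        eq : ∀ a b → ½ * (a + b) + ½ * (a - b) ≡ a
        eq = solve-∀ ring
      0≤¼ : 0ℚ ≤ ¼
      0≤¼ = ℚ.nonNegative⁻¹ ¼
      ¼¼≤aa : ¼ * ¼ ≤ a * a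
      ¼¼≤aa = *-mono-≤ 0≤¼ 0≤¼ ¼≤a ¼≤a
      0≤¼¼ : 0ℚ ≤ ¼ * ¼
      0≤¼¼ = *-nonNeg 0≤¼ 0≤¼
      dc₀≤ : d * c₀ ≤ (a - b) * (½ * (a * a * (b * b) * (a * a) ^ j))
      dc₀≤ = *-mono-≤ 0≤d (ℚ.<⇒≤ 0<c₀) d≤a-b (*-monoˡ ½ 0≤½
        (*-mono-≤ (*-nonNeg 0≤¼¼ (*-nonNeg 0≤b₀ 0≤b₀)) (^-nonNeg 0≤¼¼ j)
          (*-mono-≤ 0≤¼¼ (*-nonNeg 0≤b₀ 0≤b₀) ¼¼≤aa (*-mono-≤ 0≤b₀ 0≤b₀ b₀≤b b₀≤b))
          (^-mono-≤ 0≤¼¼ ¼¼≤aa j)))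

      margin : ∀ s {η} → (∀ v → 0ℚ ≤ η v) → 1ℚ ≤ η 0ℤ →
               a ^ N - b ^ N + d * c₀ ≤ (a - b) * walk (a * a + b * b) (a * b) s k η 0ℤ
      margin s 0≤η 1≤η0 = ℚ.≤-trans (ℚ.+-monoʳ-≤ (a ^ N - b ^ N) dc₀≤)
        (power-gap≤walk 0≤b b≤a j (ε-margin j a b a+b≡½ b₀≤b) s 0≤η 1≤η0)

    ⟨⟩-separated : ⟨_,_⟩ a b G G + 8ℚ * (d * c₀) ≤ ⟨_,_⟩ a b M M
    ⟨⟩-separated = ≤-by (8ℚ * ((a - b) * W - (a ^ N - b ^ N + d * c₀)))
      (*-nonNeg (ℚ.nonNegative⁻¹ 8ℚ) (≤⇒0≤ (margin (ℤ.+ 2) bump-nonNeg ℚ.≤-refl)))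
      (trans (cong (λ z → z + 8ℚ * (d * c₀) + 8ℚ * ((a - b) * W - (a ^ N - b ^ N + d * c₀)))
               (trans (⟨⟩-perturb a b u maj-odd G≡)
                      (cong (λ t → ⟨maj,maj⟩ + 8ℚ * (t + (a ^ N - b ^ N))) (T-maj a b k))))
      (trans (eq ⟨maj,maj⟩ ((a - b) * W) (a ^ N) (b ^ N) (d * c₀))
        (sym (E-cong pairs (dsbs a b) N λ z → cong₂ _*_ (M≡ (Vec.map proj₁ z))
          (M≡ (Vec.map proj₂ z))))))
      where
      ⟨maj,maj⟩ = ⟨_,_⟩ a b {N} maj maj
      W = walk (a * a + b * b) (a * b) (ℤ.+ 2) k bump 0ℤ
      eq : ∀ m w p q t → m + 8ℚ * (- w + (p - q)) + 8ℚ * t + 8ℚ * (w - (p - q + t)) ≡ m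
      eq = solve-∀ ring

    Φ-separated : E symbols (obs a b) N (λ y → ℚ.∣ cond y M ∣) + 4ℚ * (d * c₀)
                ≤ E symbols (obs a b) N (λ y → ℚ.∣ cond y G ∣)
    Φ-separated = ℚ.≤-trans
      (≤-by (4ℚ * ((a - b) * W - (a ^ N - b ^ N + d * c₀)))
        (*-nonNeg (ℚ.nonNegative⁻¹ 4ℚ) (≤⇒0≤ (margin 1ℤ spike-nonNeg ℚ.≤-refl)))
        (trans (cong (λ z → z + 4ℚ * (d * c₀) + 4ℚ * ((a - b) * W - (a ^ N - b ^ N + d * c₀)))
                 (E-cong symbols (obs a b) N λ y → cong ℚ.∣_∣ (cond-cong y M≡)))
        (trans (eq (E symbols (obs a b) N (λ y → ℚ.∣ cond y maj ∣)) (a - b) W (a ^ N) (b ^ N)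
          (d * c₀))
          (cong (λ z → E symbols (obs a b) N (λ y → ℚ.∣ cond y maj ∣)
            + 2ℚ * (z - 2ℚ * (a ^ N - b ^ N)))
            (sym (U-χ a b k))))))
      (Φ-perturb u (total-alt k) G≡ (ℚ.≤-trans 0≤b b≤a) 0≤b)
      where
      W = walk (a * a + b * b) (a * b) 1ℤ k spike 0ℤ
      eq : ∀ m s w p q t → m + 4ℚ * t + 4ℚ * (s * w - (p - q + t))
        ≡ m + 2ℚ * (s * 2ℚ * w - 2ℚ * (p - q))
      eq = solve-∀ ring

  Stab-g<Stab-Maj : ∀ ρ → 0ℝ < ρ → ρ < fromℚ (1ℚ - (ℤ.+ 2 / 1) * ε N) →
                    Stab ρ (g N) < Stab ρ (Maj N)
  Stab-g<Stab-Maj ρ (less d₁ 0<d₁ n₁ sep₁) (less d₂ 0<d₂ n₂ sep₂) =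
    -- Here a - b = ρ/2, so the separation `d₁` of ρ from 0 yields a - b ≥ `d₁`/2 at all late
    -- indices; the upper bound on ρ supplies b ≥ ε/2.
    less (8ℚ * (½ * d₁ * c₀)) (*-pos (ℚ.positive⁻¹ 8ℚ) (*-pos (*-pos (ℚ.positive⁻¹ ½) 0<d₁) 0<c₀))
      (n₁ ℕ.⊔ n₂) λ i i≥ →
      let r    = seq ρ i
          d₁≤r = subst (_≤ r) (ℚ.+-identityˡ d₁) (sep₁ i (ℕ.m⊔n≤o⇒m≤o n₁ n₂ i≥))
          r≤   = ℚ.≤-trans (≤-by d₂ (ℚ.<⇒≤ 0<d₂) refl) (sep₂ i (ℕ.m⊔n≤o⇒n≤o n₁ n₂ i≥))
      in subst₂ (λ p q → p + 8ℚ * (½ * d₁ * c₀) ≤ q) (sym (seq-Stab ρ (g N) i))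
            (sym (seq-Stab ρ (Maj N) i))
        (⟨⟩-separated (ℤ.+ 1 / 4 * (1ℚ + r)) (ℤ.+ 1 / 4 * (1ℚ - r)) (eq₁ r)
          (≤-by (ℤ.+ 1 / 4 * (1ℚ - 2ℚ * ε N - r))
            (*-nonNeg (ℚ.nonNegative⁻¹ (ℤ.+ 1 / 4)) (≤⇒0≤ r≤)) (eq₂ (ε N) r))
          (*-nonNeg 0≤½ (ℚ.<⇒≤ 0<d₁))
          (subst (½ * d₁ ≤_) (eq₃ r) (*-monoˡ ½ 0≤½ d₁≤r)))
    where
    eq₁ : ∀ r → ℤ.+ 1 / 4 * (1ℚ + r) + ℤ.+ 1 / 4 * (1ℚ - r) ≡ ½
    eq₁ = solve-∀ ring
    eq₂ : ∀ e r → ½ * e + ℤ.+ 1 / 4 * (1ℚ - 2ℚ * e - r) ≡ ℤ.+ 1 / 4 * (1ℚ - r)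
    eq₂ = solve-∀ ring
    eq₃ : ∀ r → ½ * r ≡ ℤ.+ 1 / 4 * (1ℚ + r) - ℤ.+ 1 / 4 * (1ℚ - r)
    eq₃ = solve-∀ ring

  -- The proofs of 0 < p and p < 1 enter the definition of `Φ` through the inverse, so they are kept
  -- arbitrary and can be those that the theorem assembles by transitivity. Now a - b = 1/2 - p, and
  -- the strict gap comes from p < 1/2.
  Φ-Maj<Φ-g : ∀ p (ε<p : fromℚ (ε N) < p) (p<½ : p < fromℚ ½) 0<p p<1 →
              Φ p 0<p p<1 (Maj N) < Φ p 0<p p<1 (g N)
  Φ-Maj<Φ-g p (less d₁ 0<d₁ n₁ sep₁) (less d₂ 0<d₂ n₂ sep₂) 0<p p<1 =
    less (4ℚ * (d₂ * c₀)) (*-pos (ℚ.positive⁻¹ 4ℚ) (*-pos 0<d₂ 0<c₀)) (n₁ ℕ.⊔ n₂) λ i i≥ →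
      let q    = seq p i
          ε≤q : ε N ≤ q
          ε≤q  = ℚ.≤-trans (≤-by {ε N} d₁ (ℚ.<⇒≤ 0<d₁) refl) (sep₁ i (ℕ.m⊔n≤o⇒m≤o n₁ n₂ i≥))
          b₀≤b = *-monoˡ ½ 0≤½ ε≤q
          d₂≤  = subst₂ _≤_ (eq₁ q d₂) (eq₂ q) (ℚ.+-monoˡ-≤ (- q) (sep₂ i (ℕ.m⊔n≤o⇒n≤o n₁ n₂ i≥)))
          0<b  = ℚ.<-≤-trans 0<b₀ b₀≤b
          0<a  = subst (0ℚ ℚ.<_) (eq₃ q) (ℚ.+-mono-< 0<b (ℚ.<-≤-trans 0<d₂ d₂≤))
      in subst₂ (λ s t → s + 4ℚ * (d₂ * c₀) ≤ t)
        (sym (seq-Φ 0<p p<1 i 0<a 0<b (Maj N))) (sym (seq-Φ 0<p p<1 i 0<a 0<b (g N)))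
        (Φ-separated (½ * (1ℚ - q)) (½ * q) (eq₄ q) b₀≤b (ℚ.<⇒≤ 0<d₂) d₂≤)
    where
    eq₁ : ∀ q d → q + d - q ≡ d
    eq₁ = solve-∀ ring
    eq₂ : ∀ q → ½ - q ≡ ½ * (1ℚ - q) - ½ * q
    eq₂ = solve-∀ ring
    eq₃ : ∀ q → ½ * q + (½ * (1ℚ - q) - ½ * q) ≡ ½ * (1ℚ - q)
    eq₃ = solve-∀ ring
    eq₄ : ∀ q → ½ * (1ℚ - q) + ½ * q ≡ ½
    eq₄ = solve-∀ ring

open import Data.Integer using (+_)

theorem9 :
  (Σ (ℕ → ℚ) λ o → TendsToZero o ×
    (∀ n → .{{_ : NonZero n}} → ε n ≡ (+ 4 / 1 ℚ.+ o n) ℚ.* 1/ n ²))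
  ×
  (Σ (∀ n → BoolFun n) λ g →
    ∀ n → n % 2 ≡ 1 → 5 ℕ.≤ n →
      Unbiased (g n)
      × IsLTF (g n)
      × (∀ ρ → 0ℝ < ρ → ρ < fromℚ (1ℚ ℚ.- (+ 2 / 1) ℚ.* ε n) →
           Stab ρ (g n) < Stab ρ (Maj n))
      × (∀ p → (ε<p : fromℚ (ε n) < p) → (p<½ : p < fromℚ ½) →
           Φ p (<-trans (0<ε n) ε<p) (<-trans p<½ ½<1) (Maj n)
           < Φ p (<-trans (0<ε n) ε<p) (<-trans p<½ ½<1) (g n)))
theorem9 = (o , o-tendsToZero , ε≡) , g , λ n n%2≡1 5≤n → prove n (odd-view n n%2≡1 5≤n)
  where
  prove : ∀ n → (∃ λ j → n ≡ suc (suc (suc j) ℕ.* 2)) → _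
  prove n (j , refl) =
      odd⇒unbiased (g n) (Odd.G-odd (suc (suc j)))
    , LTF.isLTF (suc (suc j))
    , Comparison.Stab-g<Stab-Maj j
    , λ p ε<p p<½ → Comparison.Φ-Maj<Φ-g j p ε<p p<½ _ _
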